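{- Let $h\ge 1$ be an integer. If $G$ is a finite simple graph with maximum degree $\Delta(G)\ge h+2$, then $\chi^h_{\mathrm{pcf}}(G)\le (h+1)\Delta(G)-1$.
   Context: All graphs are finite and simple. For a positive integer $k$, a proper $k$-coloring of $G$ assigns each vertex a color in $\{1,\dots,k\}$ so that adjacent vertices receive different colors. For a positive integer $h$ and a vertex $v$, let $h_v=\min\{\deg_G(v),h\}$. A proper $h$-conflict-free $k$-coloring of $G$ is a proper $k$-coloring such that for every vertex $v$, at least $h_v$ distinct colors each appear exactly once on the neighborhood $N_G(v)$. The proper $h$-conflict-free chromatic number $\chi^h_{\mathrm{pcf}}(G)$ is the minimum $k$ such that $G$ has a proper $h$-conflict-free $k$-coloring. -}

module Defs where

open import Data.Nat using (ℕ; zero; suc; _+_; _*_; _∸_; _≤_; _⊔_; _⊓_)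
open import Data.Fin using (Fin)
open import Data.Bool using (Bool; true; false; T)
open import Data.List using (List; filter; length; map; foldr)
open import Data.List using (allFin)
open import Data.Product using (Σ; _×_; _,_)
open import Relation.Binary.PropositionalEquality using (_≡_; _≢_)
open import Relation.Nullary using (¬_)
open import Relation.Nullary.Decidable using (does)
open import Data.Fin using (_≟_)
import Data.Nat as ℕ

record Graph (n : ℕ) : Set where
  field
    adj   : Fin n → Fin n → Bool
    sym   : ∀ u v → adj u v ≡ adj v u
    irrefl : ∀ v → adj v v ≡ false
open Graph public

nbrs : ∀ {n} → Graph n → Fin n → List (Fin n)
nbrs G v = filter (λ u → T? (adj G v u)) (allFin _)
  where
  open import Data.Bool.Properties using () renaming (T? to T?)

degree : ∀ {n} → Graph n → Fin n → ℕ
degree G v = length (nbrs G v)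

maxDegree : ∀ {n} → Graph n → ℕ
maxDegree G = foldr _⊔_ 0 (map (degree G) (allFin _))

IsProperColoring : ∀ {n k} → Graph n → (Fin n → Fin k) → Set
IsProperColoring G c = ∀ u v → adj G u v ≡ true → c u ≢ c v

colourCount : ∀ {n k} → Graph n → (Fin n → Fin k) → Fin n → Fin k → ℕ
colourCount G c v i = length (filter (λ u → c u ≟ i) (nbrs G v))

uniqueColours : ∀ {n k} → Graph n → (Fin n → Fin k) → Fin n → List (Fin k)
uniqueColours G c v = filter (λ i → colourCount G c v i ℕ.≟ 1) (allFin _)

IsPCFColoring : ∀ {n k} → ℕ → Graph n → (Fin n → Fin k) → Set
IsPCFColoring h G c =
  IsProperColoring G c ×
  (∀ v → degree G v ⊓ h ≤ length (uniqueColours G c v))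

HasPCFColoring : ∀ {n} → ℕ → Graph n → ℕ → Set
HasPCFColoring h G k = Σ (Fin _ → Fin k) (λ c → IsPCFColoring h G c)

χpcf≤ : ∀ {n} → ℕ → Graph n → ℕ → Set
χpcf≤ h G k = Σ ℕ (λ k' → k' ≤ k × HasPCFColoring h G k')

{-# OPTIONS --safe #-}
-- Write D for the maximum degree and k = (h + 1) D - 1.  We extend partial colourings in which every vertex,
-- coloured or not, already sees enough unique colours among its coloured neighbours.  When a vertex v is coloured,
-- a neighbour forbids its own colour and at most h further colours, so v can be coloured as soon as two of these
-- (h + 1) D colours are saved.  Each uncoloured neighbour and each repeated colour around v saves one, a
-- neighbour that sees more than h unique colours saves h, and deg v < D saves h + 1.
--
-- By induction on the set of vertices to be coloured, it suffices to find a set S that can be coloured last.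
-- If a single vertex does not do, S can be taken to be a cycle or a path whose vertices have exactly two
-- uncoloured neighbours each (for D ≤ h + 3, next to vertices that stay uncoloured, one or two vertices suffice).
-- If D ≥ h + 4, such a vertex either sees a repeated colour or is rich: it keeps seeing more than h unique colours
-- while it has an uncoloured neighbour.  Colour the rich vertices first and then the others along the path.
-- If D ≤ h + 3, all colours around a vertex of S are distinct; on a cycle z, u, x, ... choose the colour of u
-- not occurring around z and that of x not occurring around u, which makes z and u rich.
-- Only for h = 1, D = 4 are there too few colours for this; there a triangle, or a path on four vertices in a
-- triangle-free graph, serves as S.
module Submission where

-- A colour that is unique at a vertex can be lost again, so `h < uniq` does not persist. What never
-- decreases under extension is `uniq + total`: a second occurrence costs one unique colour but adds
-- one to the total. Since `total < D` while a neighbour is blank, `uniq + total ≥ D + h` guarantees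
-- more than `h` unique colours for as long as this matters. This is the definition of rich.
-- Distinctness for `D = g + 3` is a matter of rigidity: a full vertex with two blank neighbours
-- sees `g + 1` occurrences, at least `g` of them unique, and a multiset never has exactly one
-- non-unique element. With `g = h` this serves `D = h + 3`. For `D = h + 2` such a vertex sees only
-- `h` colours and cannot exceed a demand of `h`; lowering the demand to `h - 1` while a neighbour
-- is blank restores the argument. The price is the jump of the demand at the last neighbour. That
-- at most `h` colours are blocked there too follows from `2 dist ≤ uniq + total`, and uses
-- `D ≤ h + 2`.

open import Defs renaming (sym to adj-sym; irrefl to adj-irrefl)
open import Data.Bool using (Bool; true; false; not; if_then_else_; _∨_)
open import Data.Bool.Properties using (T?) renaming (_≟_ to _≟ᵇ_)
open import Data.Empty using (⊥)
open import Data.Fin using (Fin; zero; suc; _≟_)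
open import Data.Fin.Properties using (any?; all?)
open import Data.List using (List; []; _∷_; _++_; length; filter; tabulate; map; foldr)
open import Data.List.Membership.Propositional using (_∈_; _∉_; find)
open import Data.List.Membership.Propositional.Properties using (∈-allFin)
open import Data.List.Properties using (++-identityʳ)
open import Data.List.Relation.Binary.Permutation.Propositional using (_↭_; ↭-sym; ↭-swap; ↭-refl; ↭-prep; ↭-trans; ↭⇒↭ₛ)
open import Data.List.Relation.Binary.Permutation.Propositional.Properties using (∈-resp-↭; All-resp-↭; ++-comm; ∷↭∷ʳ; ↭-reverse)
import Data.List.Relation.Binary.Permutation.Setoid.Properties as Permutation
open import Data.List.Relation.Unary.All as All using (All; []; _∷_; lookup)
open import Data.List.Relation.Unary.AllPairs using ([]; _∷_)
open import Data.List.Relation.Unary.Any as Any using (here; there)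
open import Data.List.Relation.Unary.Unique.Propositional using (Unique)
open import Data.Maybe using (Maybe; just; nothing)
open import Data.Nat using (ℕ; zero; suc; pred; _+_; _*_; _∸_; _≤_; _<_; _⊓_; _⊔_; z≤n; s≤s; _≤?_; _<?_; >-nonZero) renaming (_≟_ to _≟ⁿ_)
open import Data.Nat.Induction using (<-wellFounded)
open import Data.Nat.Properties hiding (_≟_)
open import Data.Nat.Tactic.RingSolver using (solve-∀)
open import Data.Product using (∃; ∃₂; _×_; _,_; proj₁; proj₂)
open import Data.Sum using (_⊎_; inj₁; inj₂; [_,_]′; swap)
open import Data.Unit using (⊤; tt)
open import Function using (_∘_; id)
open import Induction.WellFounded using (Acc; acc)
open import Relation.Binary.Definitions using (tri<; tri≈; tri>)
open import Relation.Binary.PropositionalEquality using (_≡_; _≢_; refl; sym; trans; cong; cong₂; subst; subst₂; setoid; module ≡-Reasoning)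
open import Relation.Nullary using (¬_; Dec; yes; no; does; contradiction)
open import Relation.Nullary.Decidable using (_×-dec_; _→-dec_; ¬?; decidable-stable)
open import Algebra.Properties.Semiring.Sum +-*-semiring using (sum; sum-cong-≗; ∑-distrib-+; ∑-comm; *-distribˡ-sum; sum-replicate-zero)

-- Linear inequalities are derived from a combination x ≤ y of the hypotheses and an identity of semirings.
linear : ∀ {x y} a b s → x ≤ y → a + y + s ≡ b + x → a ≤ b
linear {x} {y} a b s x≤y eq = +-cancelʳ-≤ y a b (begin
  a + y      ≤⟨ m≤m+n (a + y) s ⟩
  a + y + s  ≡⟨ eq ⟩
  b + x      ≤⟨ +-monoʳ-≤ b x≤y ⟩
  b + y      ∎)
  where open ≤-Reasoning

-- Finite sums of natural numbers

⟦_⟧ : Bool → ℕ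
⟦ true ⟧ = 1
⟦ false ⟧ = 0

⟦⟧≤1 : ∀ b → ⟦ b ⟧ ≤ 1
⟦⟧≤1 true = ≤-refl
⟦⟧≤1 false = z≤n

sum-mono : ∀ {n} {f g : Fin n → ℕ} → (∀ i → f i ≤ g i) → sum f ≤ sum g
sum-mono {zero}  f≤g = z≤n
sum-mono {suc n} f≤g = +-mono-≤ (f≤g zero) (sum-mono (f≤g ∘ suc))

sum-zero : ∀ {n} {f : Fin n → ℕ} → (∀ i → f i ≡ 0) → sum f ≡ 0
sum-zero {n} f≡0 = trans (sum-cong-≗ f≡0) (sum-replicate-zero n)

term≤sum : ∀ {n} (f : Fin n → ℕ) i → f i ≤ sum f
term≤sum f zero    = m≤m+n _ _
term≤sum f (suc i) = ≤-trans (term≤sum (f ∘ suc) i) (m≤n+m _ _)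

sum≡0⇒ : ∀ {n} (f : Fin n → ℕ) → sum f ≡ 0 → ∀ i → f i ≡ 0
sum≡0⇒ f eq i = n≤0⇒n≡0 (subst (f i ≤_) eq (term≤sum f i))

two-terms≤sum : ∀ {n} (f : Fin n → ℕ) {i j} → i ≢ j → f i + f j ≤ sum f
two-terms≤sum f {zero}  {zero}  i≢j = contradiction refl i≢j
two-terms≤sum f {zero}  {suc j} i≢j = +-monoʳ-≤ (f zero) (term≤sum (f ∘ suc) j)
two-terms≤sum f {suc i} {zero}  i≢j =
  subst (_≤ sum f) (+-comm (f zero) (f (suc i))) (+-monoʳ-≤ (f zero) (term≤sum (f ∘ suc) i))
two-terms≤sum f {suc i} {suc j} i≢j =
  ≤-trans (two-terms≤sum (f ∘ suc) (i≢j ∘ cong suc)) (m≤n+m _ _)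

δ : ∀ {n} → Fin n → Fin n → ℕ
δ a i = ⟦ does (a ≟ i) ⟧

δ-refl : ∀ {n} (a : Fin n) → δ a a ≡ 1
δ-refl a with a ≟ a
... | yes _ = refl
... | no a≢a = contradiction refl a≢a

δ-≢ : ∀ {n} {a i : Fin n} → a ≢ i → δ a i ≡ 0
δ-≢ {a = a} {i} a≢i with a ≟ i
... | yes a≡i = contradiction a≡i a≢i
... | no _ = refl

sum-δ : ∀ {n} (a : Fin n) (f : Fin n → ℕ) → sum (λ i → δ a i * f i) ≡ f a
sum-δ {suc n} zero f = trans (cong₂ _+_ (+-identityʳ (f zero)) (sum-zero {n} (λ _ → refl))) (+-identityʳ _)
sum-δ {suc n} (suc a) f = trans (sum-cong-≗ (λ i → cong (_* f (suc i)) (δ-suc a i))) (sum-δ a (f ∘ suc))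
  where
  δ-suc : ∀ {m} (a i : Fin m) → δ (suc a) (suc i) ≡ δ a i
  δ-suc a i with a ≟ i
  ... | yes refl = refl
  ... | no _ = refl

sum-δ₁ : ∀ {n} (a : Fin n) → sum (δ a) ≡ 1
sum-δ₁ a = trans (sum-cong-≗ (λ i → sym (*-identityʳ (δ a i)))) (sum-δ a (λ _ → 1))

-- The two exchanged terms stand on opposite sides, which avoids truncated subtraction.
sum-update : ∀ {n} (f g : Fin n → ℕ) a → (∀ i → a ≢ i → f i ≡ g i) → sum f + g a ≡ sum g + f a
sum-update f g a agree = begin
  sum f + g a                            ≡⟨ cong (sum f +_) (sum-δ a g) ⟨
  sum f + sum (λ i → δ a i * g i)        ≡⟨ ∑-distrib-+ f _ ⟨
  sum (λ i → f i + δ a i * g i)          ≡⟨ sum-cong-≗ pointwise ⟩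
  sum (λ i → g i + δ a i * f i)          ≡⟨ ∑-distrib-+ g _ ⟩
  sum g + sum (λ i → δ a i * f i)        ≡⟨ cong (sum g +_) (sum-δ a f) ⟩
  sum g + f a                            ∎
  where
  open ≡-Reasoning
  pointwise : ∀ i → f i + δ a i * g i ≡ g i + δ a i * f i
  pointwise i with a ≟ i
  ... | yes refl rewrite +-identityʳ (f a) | +-identityʳ (g a) = +-comm (f a) (g a)
  ... | no a≢i = cong (_+ 0) (agree i a≢i)

-- Pigeonhole principle: `f` will count the objections to each colour, and too few objections leave
-- some colour without any.
sum-<⇒zero : ∀ {n} (f : Fin n → ℕ) → sum f < n → ∃ λ i → f i ≡ 0
sum-<⇒zero {suc n} f f<n with f zero in eq
... | zero  = zero , eq
... | suc m with sum-<⇒zero (f ∘ suc) (≤-trans (s≤s (m≤n+m _ m)) (≤-pred f<n))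
...   | i , fi≡0 = suc i , fi≡0

three-terms≤sum : ∀ {m} (f : Fin m → ℕ) {x y z} → x ≢ y → x ≢ z → y ≢ z → f x + (f y + f z) ≤ sum f
three-terms≤sum f {x} {y} {z} x≢y x≢z y≢z = ≤-trans (≤-reflexive (sym split-sum)) (sum-mono pointwise)
  where
  term : _ → _ → ℕ
  term i u = δ i u * f u
  split-sum : sum (λ u → term x u + (term y u + term z u)) ≡ f x + (f y + f z)
  split-sum = trans (∑-distrib-+ (term x) _) (cong₂ _+_ (sum-δ x f)
    (trans (∑-distrib-+ (term y) (term z)) (cong₂ _+_ (sum-δ y f) (sum-δ z f))))
  pointwise : ∀ u → term x u + (term y u + term z u) ≤ f u
  pointwise u with x ≟ u | y ≟ u | z ≟ u
  ... | yes refl | yes refl | _        = contradiction refl x≢y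
  ... | yes refl | no _     | yes refl = contradiction refl x≢z
  ... | yes refl | no _     | no _     = ≤-reflexive (trans (+-identityʳ _) (+-identityʳ (f u)))
  ... | no _     | yes refl | yes refl = contradiction refl y≢z
  ... | no _     | yes refl | no _     = ≤-reflexive (trans (+-identityʳ _) (+-identityʳ (f u)))
  ... | no _     | no _     | yes refl = ≤-reflexive (+-identityʳ (f u))
  ... | no _     | no _     | no _     = z≤n

-- Multisets of colours, given by their multiplicities

one : ℕ → ℕ
one 1 = 1
one _ = 0

pos : ℕ → ℕ
pos 0 = 0
pos (suc _) = 1

fails : ∀ {A : Set} → Dec A → ℕ
fails d = ⟦ not (does d) ⟧

fails≡0⇒ : ∀ {A : Set} (d : Dec A) → fails d ≡ 0 → A
fails≡0⇒ (yes a) _ = a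

⇒fails≡0 : ∀ {A : Set} (d : Dec A) → A → fails d ≡ 0
⇒fails≡0 (yes _) _ = refl
⇒fails≡0 (no ¬a) a = contradiction a ¬a

module _ {k : ℕ} where

  -- `rep` counts the occurrences beyond the first of each colour, that is, how many neighbours
  -- forbid nothing new by their own colour.
  total uniq dist rep : (Fin k → ℕ) → ℕ
  total f = sum f
  uniq f = sum (one ∘ f)
  dist f = sum (pos ∘ f)
  rep f = sum (pred ∘ f)

  bump : Fin k → (Fin k → ℕ) → Fin k → ℕ
  bump a f i = f i + δ a i

  dist+rep≡total : ∀ f → dist f + rep f ≡ total f
  dist+rep≡total f = trans (sym (∑-distrib-+ (pos ∘ f) (pred ∘ f))) (sum-cong-≗ (λ i → pointwise (f i)))
    where
    pointwise : ∀ x → pos x + pred x ≡ x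
    pointwise zero = refl
    pointwise (suc x) = refl

  -- A colour that is present but not unique is counted at least twice in the total.
  2dist≤uniq+total : ∀ f → dist f + dist f ≤ uniq f + total f
  2dist≤uniq+total f = begin
    dist f + dist f                    ≡⟨ ∑-distrib-+ (pos ∘ f) (pos ∘ f) ⟨
    sum (λ i → pos (f i) + pos (f i))  ≤⟨ sum-mono (λ i → pointwise (f i)) ⟩
    sum (λ i → one (f i) + f i)        ≡⟨ ∑-distrib-+ (one ∘ f) f ⟩
    uniq f + total f                   ∎
    where
    open ≤-Reasoning
    pointwise : ∀ x → pos x + pos x ≤ one x + x
    pointwise 0 = z≤n
    pointwise 1 = ≤-refl
    pointwise (suc (suc x)) = s≤s (s≤s z≤n)

  dist≤total : ∀ f → dist f ≤ total f
  dist≤total f = subst (dist f ≤_) (dist+rep≡total f) (m≤m+n _ _)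

  uniq≤dist : ∀ f → uniq f ≤ dist f
  uniq≤dist f = sum-mono (λ i → pointwise (f i))
    where
    pointwise : ∀ x → one x ≤ pos x
    pointwise 0 = ≤-refl
    pointwise 1 = ≤-refl
    pointwise (suc (suc x)) = z≤n

  uniq≤total : ∀ f → uniq f ≤ total f
  uniq≤total f = ≤-trans (uniq≤dist f) (dist≤total f)

  -- A colour of multiplicity m ≥ 2 satisfies m ≤ 2(m - 1).
  total≤uniq+2rep : ∀ f → total f ≤ uniq f + (rep f + rep f)
  total≤uniq+2rep f = linear (total f) _ 0 (2dist≤uniq+total f)
    (subst (λ t → t + (uniq f + t) + 0 ≡ uniq f + (rep f + rep f) + (dist f + dist f)) (dist+rep≡total f)
      (regroup (dist f) (rep f) (uniq f)))
    where
    regroup : ∀ d r u → (d + r) + (u + (d + r)) + 0 ≡ u + (r + r) + (d + d)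
    regroup = solve-∀

  rep≡0⇒uniq≡total : ∀ f → rep f ≡ 0 → uniq f ≡ total f
  rep≡0⇒uniq≡total f eq = ≤-antisym (uniq≤total f)
    (subst (λ r → total f ≤ r) (trans (cong (λ r → uniq f + (r + r)) eq) (+-identityʳ _)) (total≤uniq+2rep f))

  -- No multiset has exactly one non-unique element.
  total≤1+uniq⇒uniq≡total : ∀ f → total f ≤ suc (uniq f) → uniq f ≡ total f
  total≤1+uniq⇒uniq≡total f le = trans (sym (+-identityʳ _)) (trans (cong (uniq f +_) (sym rest≡0)) split)
    where
    rest : ℕ → ℕ
    rest 1 = 0
    rest x = x
    one+rest : ∀ x → one x + rest x ≡ x
    one+rest 0 = refl
    one+rest 1 = refl
    one+rest (suc (suc x)) = refl
    rest≤1⇒≡0 : ∀ x → rest x ≤ 1 → rest x ≡ 0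
    rest≤1⇒≡0 0 _ = refl
    rest≤1⇒≡0 1 _ = refl
    rest≤1⇒≡0 (suc (suc x)) (s≤s ())
    split : uniq f + sum (rest ∘ f) ≡ total f
    split = trans (sym (∑-distrib-+ (one ∘ f) (rest ∘ f))) (sum-cong-≗ (λ i → one+rest (f i)))
    rest≤1 : sum (rest ∘ f) ≤ 1
    rest≤1 = +-cancelˡ-≤ (uniq f) _ _ (subst₂ _≤_ (sym split) (+-comm 1 (uniq f)) le)
    rest≡0 : sum (rest ∘ f) ≡ 0
    rest≡0 = sum-zero (λ i → rest≤1⇒≡0 (f i) (≤-trans (term≤sum (rest ∘ f) i) rest≤1))

  module _ {f f′ : Fin k → ℕ} (f≤f′ : ∀ i → f i ≤ f′ i) where

    rep-mono : rep f ≤ rep f′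
    rep-mono = sum-mono (λ i → pred-mono-≤ (f≤f′ i))

    -- Repeating a unique colour lowers `uniq` by one, and the new occurrence makes up for it in
    -- `total`. This sum is the potential behind `Rich` and `Base`.
    uniq+total-mono : uniq f + total f ≤ uniq f′ + total f′
    uniq+total-mono = subst₂ _≤_ (∑-distrib-+ (one ∘ f) f) (∑-distrib-+ (one ∘ f′) f′)
      (sum-mono (λ i → pointwise (f≤f′ i)))
      where
      pointwise : ∀ {x y} → x ≤ y → one x + x ≤ one y + y
      pointwise {0} _ = z≤n
      pointwise {1} {1} _ = ≤-refl
      pointwise {1} {suc (suc y)} _ = s≤s (s≤s z≤n)
      pointwise {suc (suc x)} {suc zero} (s≤s ())
      pointwise {suc (suc x)} {suc (suc y)} x≤y = x≤y

  module _ {f f′ : Fin k → ℕ} (f≗f′ : ∀ i → f i ≡ f′ i) where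

    total-cong : total f ≡ total f′
    total-cong = sum-cong-≗ f≗f′

    uniq-cong : uniq f ≡ uniq f′
    uniq-cong = sum-cong-≗ (cong one ∘ f≗f′)

    rep-cong : rep f ≡ rep f′
    rep-cong = sum-cong-≗ (cong pred ∘ f≗f′)

  total-bump : ∀ a f → total (bump a f) ≡ suc (total f)
  total-bump a f = trans (∑-distrib-+ f (δ a)) (trans (cong (total f +_) (sum-δ₁ a)) (+-comm _ 1))

  bump-self : ∀ a f → bump a f a ≡ suc (f a)
  bump-self a f = trans (cong (f a +_) (δ-refl a)) (+-comm _ 1)

  uniq-bump : ∀ a f → uniq (bump a f) + one (f a) ≡ uniq f + one (suc (f a))
  uniq-bump a f = trans (sum-update (one ∘ bump a f) (one ∘ f) a unchanged)
    (cong (λ x → uniq f + one x) (bump-self a f))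
    where
    unchanged : ∀ i → a ≢ i → one (bump a f i) ≡ one (f i)
    unchanged i a≢i = cong one (trans (cong (f i +_) (δ-≢ a≢i)) (+-identityʳ _))

  uniq-bump-fresh : ∀ a f → f a ≡ 0 → uniq (bump a f) ≡ suc (uniq f)
  uniq-bump-fresh a f fa≡0 with f a | uniq-bump a f
  ... | 0 | eq = trans (sym (+-identityʳ _)) (trans eq (+-comm _ 1))

  uniq≤uniq-bump : ∀ a f → one (f a) ≡ 0 → uniq f ≤ uniq (bump a f)
  uniq≤uniq-bump a f eq = linear (uniq f) (uniq (bump a f)) (one (suc (f a))) (≤-reflexive eq)
    (trans (cong (_+ one (suc (f a))) (+-identityʳ _)) (sym (uniq-bump a f)))

  uniq≤1+uniq-bump : ∀ a f → uniq f ≤ suc (uniq (bump a f))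
  uniq≤1+uniq-bump a f = begin
    uniq f                          ≤⟨ m≤m+n _ _ ⟩
    uniq f + one (suc (f a))        ≡⟨ uniq-bump a f ⟨
    uniq (bump a f) + one (f a)     ≤⟨ +-monoʳ-≤ _ (one≤1 (f a)) ⟩
    uniq (bump a f) + 1             ≡⟨ +-comm _ 1 ⟩
    suc (uniq (bump a f))           ∎
    where
    open ≤-Reasoning
    one≤1 : ∀ x → one x ≤ 1
    one≤1 0 = z≤n
    one≤1 1 = ≤-refl
    one≤1 (suc (suc x)) = z≤n

  rep-bump-repeated : ∀ a f → 1 ≤ f a → 1 ≤ rep (bump a f)
  rep-bump-repeated a f 1≤fa = ≤-trans (subst (1 ≤_) (sym (cong pred (bump-self a f))) 1≤fa)
    (term≤sum (pred ∘ bump a f) a)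

-- Around a vertex with j uncoloured neighbours, f counts the occurrences of each colour.  Asking for only
-- g = h - 1 unique colours while j > 0 is what makes the case D = h + 2 work; otherwise g = h.
module Cost {k : ℕ} (h g : ℕ) (g≤h : g ≤ h) (h≤1+g : h ≤ suc g) where

  need : ℕ → ℕ → ℕ
  need zero    m = m ⊓ h
  need (suc _) m = m ⊓ g

  Ok : ℕ → (Fin k → ℕ) → Set
  Ok j f = need j (total f) ≤ uniq f

  -- The neighbour that receives `a` is one of the `j` blank ones, so afterwards the demand is that
  -- for `pred j`.
  bad : ℕ → (Fin k → ℕ) → Fin k → ℕ
  bad j f a = fails (need (pred j) (total (bump a f)) ≤? uniq (bump a f))

  cost : ℕ → (Fin k → ℕ) → ℕ
  cost j f = sum (bad j f)

  need≤h : ∀ j m → need j m ≤ h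
  need≤h zero    m = m⊓n≤n m h
  need≤h (suc j) m = ≤-trans (m⊓n≤n m g) g≤h

  need≤total : ∀ j m → need j m ≤ m
  need≤total zero    m = m⊓n≤m m h
  need≤total (suc j) m = m⊓n≤m m g

  ⊓g≤need : ∀ j m → m ⊓ g ≤ need j m
  ⊓g≤need zero    m = ⊓-monoʳ-≤ m g≤h
  ⊓g≤need (suc j) m = ≤-refl

  need≤⊓1+g : ∀ j m → need j m ≤ m ⊓ suc g
  need≤⊓1+g zero    m = ⊓-monoʳ-≤ m h≤1+g
  need≤⊓1+g (suc j) m = ⊓-monoʳ-≤ m (n≤1+n g)

  need-pred≤g : ∀ {j} m → 2 ≤ j → need (pred j) m ≤ g
  need-pred≤g {suc (suc j)} m _ = m⊓n≤n m g
  need-pred≤g {suc zero} m (s≤s ())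

  bad≡0⇒Ok : ∀ j f a → bad j f a ≡ 0 → Ok (pred j) (bump a f)
  bad≡0⇒Ok j f a = fails≡0⇒ (need (pred j) (total (bump a f)) ≤? uniq (bump a f))

  Ok⇒bad≡0 : ∀ j f a → Ok (pred j) (bump a f) → bad j f a ≡ 0
  Ok⇒bad≡0 j f a = ⇒fails≡0 (need (pred j) (total (bump a f)) ≤? uniq (bump a f))

  module _ (j : ℕ) (f : Fin k → ℕ) where

    target : ℕ
    target = need (pred j) (suc (total f))

    Ok-bump : ∀ a → target ≤ uniq (bump a f) → bad j f a ≡ 0
    Ok-bump a le = Ok⇒bad≡0 j f a (subst (λ t → need (pred j) t ≤ uniq (bump a f)) (sym (total-bump a f)) le)

    bad≤ : ∀ (w : ℕ → ℕ) a → (w (f a) ≡ 0 → bad j f a ≡ 0) → (∀ x → w x ≡ 0 ⊎ w x ≡ 1) → bad j f a ≤ w (f a)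
    bad≤ w a zeros values with values (f a)
    ... | inj₁ eq = subst (_≤ w (f a)) (sym (zeros eq)) z≤n
    ... | inj₂ eq = subst (bad j f a ≤_) (sym eq) (⟦⟧≤1 _)

    -- Any colour destroys at most one unique colour, so one unique colour above the target is
    -- enough.
    cost≡0 : target < uniq f → cost j f ≡ 0
    cost≡0 lt = sum-zero (λ a → Ok-bump a (≤-pred (≤-trans lt (uniq≤1+uniq-bump a f))))

    -- Only a currently unique colour can lower `uniq` when it is used again.
    cost≤uniq : target ≤ uniq f → cost j f ≤ uniq f
    cost≤uniq le = sum-mono (λ a → bad≤ one a (λ eq → Ok-bump a (≤-trans le (uniq≤uniq-bump a f eq))) values)
      where
      values : ∀ x → one x ≡ 0 ⊎ one x ≡ 1
      values 0 = inj₁ refl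
      values 1 = inj₂ refl
      values (suc (suc x)) = inj₁ refl

    module _ (1≤j : 1 ≤ j) (ok : Ok j f) where

      -- One more coloured neighbour raises the demand by at most one, even where it passes from `g`
      -- to `h`, because `h ≤ 1 + g`.
      target≤1+uniq : target ≤ suc (uniq f)
      target≤1+uniq = begin
        target                      ≤⟨ need≤⊓1+g (pred j) (suc (total f)) ⟩
        suc (total f) ⊓ suc g       ≤⟨ s≤s (⊓g≤need j (total f)) ⟩
        suc (need j (total f))      ≤⟨ s≤s ok ⟩
        suc (uniq f)                ∎
        where open ≤-Reasoning

      -- A fresh colour adds one to `uniq`, which covers the growth of the demand; so only colours
      -- already present can be bad.
      cost≤dist : cost j f ≤ dist f
      cost≤dist = sum-mono (λ a → bad≤ pos a (λ eq → Ok-bump a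
        (subst (target ≤_) (sym (uniq-bump-fresh a f (pos≡0 (f a) eq))) target≤1+uniq)) values)
        where
        pos≡0 : ∀ x → pos x ≡ 0 → x ≡ 0
        pos≡0 zero _ = refl
        values : ∀ x → pos x ≡ 0 ⊎ pos x ≡ 1
        values 0 = inj₁ refl
        values (suc x) = inj₂ refl

      cost-bound : (b : ℕ) → target ≤ b → (uniq f < target → dist f ≤ b) → cost j f ≤ b
      cost-bound b t≤b dist≤b with <-cmp target (uniq f)
      ... | tri< lt _ _ = subst (_≤ b) (sym (cost≡0 lt)) z≤n
      ... | tri≈ _ eq _ = ≤-trans (cost≤uniq (≤-reflexive eq)) (subst (_≤ b) eq t≤b)
      ... | tri> _ _ gt = ≤-trans cost≤dist (dist≤b gt)

      -- If `total ⊓ g ≤ uniq < g`, the minimum must be `total`.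
      total≤g : uniq f < g → total f ≤ g
      total≤g lt with ≤-total (total f) g
      ... | inj₁ le = le
      ... | inj₂ ge = contradiction (≤-trans (≤-trans (≤-reflexive (sym (m≥n⇒m⊓n≡n ge))) (⊓g≤need j (total f))) ok) (<⇒≱ lt)

      cost≤g : 2 ≤ j → cost j f ≤ g
      cost≤g 2≤j = cost-bound g (need-pred≤g _ 2≤j)
        (λ lt → ≤-trans (dist≤total f) (total≤g (≤-trans lt (need-pred≤g _ 2≤j))))

      cost≤h : (g ≡ h ⊎ total f ≤ suc h) → cost j f ≤ h
      cost≤h mode = cost-bound h (need≤h (pred j) _) (bound mode)
        where
        bound : (g ≡ h ⊎ total f ≤ suc h) → uniq f < target → dist f ≤ h
        bound mode lt with uniq f <? g
        ... | yes q<g = ≤-trans (dist≤total f) (≤-trans (total≤g q<g) g≤h)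
        bound (inj₁ refl) lt | no q≮g = contradiction (≤-trans lt (need≤h (pred j) _)) q≮g
        -- The demand exceeds `uniq`, so `uniq ≤ h - 1`; with `total ≤ h + 1` the bound on
        -- `2 * dist` is exactly 2h. This is where `D ≤ h + 2` enters for `g = h - 1`.
        bound (inj₂ m≤1+h) lt | no q≮g = *-cancelˡ-≤ 2 (begin
          2 * dist f           ≡⟨ double (dist f) ⟩
          dist f + dist f      ≤⟨ 2dist≤uniq+total f ⟩
          uniq f + total f     ≤⟨ +-monoʳ-≤ (uniq f) m≤1+h ⟩
          uniq f + suc h       ≡⟨ +-suc (uniq f) h ⟩
          suc (uniq f) + h     ≤⟨ +-monoˡ-≤ h (≤-trans lt (need≤h (pred j) _)) ⟩
          h + h                ≡⟨ double h ⟨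
          2 * h                ∎)
          where
          open ≤-Reasoning
          double : ∀ x → 2 * x ≡ x + x
          double = solve-∀

      cost≡0-h : suc h ≤ uniq f → cost j f ≡ 0
      cost≡0-h lt = cost≡0 (≤-trans (s≤s (need≤h (pred j) _)) lt)

      cost≡0-g : 2 ≤ j → suc g ≤ uniq f → cost j f ≡ 0
      cost≡0-g 2≤j lt = cost≡0 (≤-trans (s≤s (need-pred≤g _ 2≤j)) lt)

-- Partial colourings and the counting of forbidden colours

has : ∀ {k} → Maybe (Fin k) → Fin k → ℕ
has nothing  i = 0
has (just a) i = δ a i

blank : ∀ {k} → Maybe (Fin k) → ℕ
blank nothing  = 1
blank (just _) = 0

blank+has : ∀ {k} (m : Maybe (Fin k)) → sum (has m) + blank m ≡ 1
blank+has {k} nothing = cong (_+ 1) (sum-zero {k} (λ _ → refl))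
blank+has (just a)    = trans (+-identityʳ _) (sum-δ₁ a)

module Colourings {n : ℕ} (G : Graph n) where

  _~_ : Fin n → Fin n → Set
  u ~ v = adj G u v ≡ true

  ~-sym : ∀ {u v} → u ~ v → v ~ u
  ~-sym {u} {v} u~v = trans (adj-sym G v u) u~v

  ~⇒≢ : ∀ {u v} → u ~ v → u ≢ v
  ~⇒≢ {u} u~u refl with trans (sym u~u) (adj-irrefl G u)
  ... | ()

  _~?_ : ∀ u v → Dec (u ~ v)
  u ~? v with adj G u v
  ... | true  = yes refl
  ... | false = no λ ()

  A : Fin n → Fin n → ℕ
  A u v = ⟦ adj G u v ⟧

  A≡1 : ∀ {u v} → u ~ v → A u v ≡ 1
  A≡1 = cong ⟦_⟧

  A≡0 : ∀ {u v} → ¬ u ~ v → A u v ≡ 0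
  A≡0 {u} {v} u≁v with adj G u v
  ... | true  = contradiction refl u≁v
  ... | false = refl

  A-diag : ∀ v → A v v ≡ 0
  A-diag v = cong ⟦_⟧ (adj-irrefl G v)

  A* : ∀ {v x} {a b : ℕ} → (v ~ x → a ≡ b) → A v x * a ≡ A v x * b
  A* {v} {x} eq with adj G v x
  ... | true  = cong (_+ 0) (eq refl)
  ... | false = refl

  A*≡ : ∀ {v x} {a : ℕ} → v ~ x → A v x * a ≡ a
  A*≡ {a = a} v~x = trans (cong (_* a) (A≡1 v~x)) (+-identityʳ a)

  deg : Fin n → ℕ
  deg v = sum (A v)

  module _ {k : ℕ} where

    Colouring : Set
    Colouring = Fin n → Maybe (Fin k)

    opaque
      _[_↦_] : Colouring → Fin n → Fin k → Colouring
      (c [ v ↦ a ]) u = if does (v ≟ u) then just a else c u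

      update-self : ∀ c v a → (c [ v ↦ a ]) v ≡ just a
      update-self c v a with v ≟ v
      ... | yes _  = refl
      ... | no v≢v = contradiction refl v≢v

      update-other : ∀ c {v} a {u} → v ≢ u → (c [ v ↦ a ]) u ≡ c u
      update-other c {v} a {u} v≢u with v ≟ u
      ... | yes v≡u = contradiction v≡u v≢u
      ... | no _    = refl

    cnt : Colouring → Fin n → Fin k → ℕ
    cnt c x i = sum λ u → A x u * has (c u) i

    free : Colouring → Fin n → ℕ
    free c x = sum λ u → A x u * blank (c u)

    -- Double counting: each neighbour contributes either one colour or one blank.
    total+free≡deg : ∀ c x → total (cnt c x) + free c x ≡ deg x
    total+free≡deg c x = begin
      total (cnt c x) + free c x
        ≡⟨ cong (_+ free c x) (∑-comm (λ i u → A x u * has (c u) i)) ⟩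
      sum (λ u → sum λ i → A x u * has (c u) i) + free c x
        ≡⟨ cong (_+ free c x) (sum-cong-≗ λ u → *-distribˡ-sum (A x u) (has (c u))) ⟨
      sum (λ u → A x u * sum (has (c u))) + free c x
        ≡⟨ ∑-distrib-+ (λ u → A x u * sum (has (c u))) _ ⟨
      sum (λ u → A x u * sum (has (c u)) + A x u * blank (c u))
        ≡⟨ sum-cong-≗ (λ u → trans (sym (*-distribˡ-+ (A x u) _ _))
                                   (trans (cong (A x u *_) (blank+has (c u))) (*-identityʳ _))) ⟩
      deg x ∎
      where open ≡-Reasoning

    cnt≥1 : ∀ c {x u a} → x ~ u → c u ≡ just a → 1 ≤ cnt c x a
    cnt≥1 c {x} {u} {a} x~u cu≡a = subst (_≤ cnt c x a)
      (trans (A*≡ x~u) (trans (cong (λ m → has m a) cu≡a) (δ-refl a)))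
      (term≤sum (λ u → A x u * has (c u) a) u)

    module _ (c : Colouring) {v : Fin n} (cv : c v ≡ nothing) (a : Fin k) where

      cnt-update : ∀ x i → cnt (c [ v ↦ a ]) x i ≡ cnt c x i + A x v * δ a i
      cnt-update x i = trans (sym (+-identityʳ _)) (trans
        (subst₂ (λ p q → cnt (c [ v ↦ a ]) x i + p ≡ cnt c x i + q)
          (trans (cong (λ m → A x v * has m i) cv) (*-zeroʳ (A x v)))
          (cong (λ m → A x v * has m i) (update-self c v a))
          (sum-update _ _ v (λ u v≢u → cong (λ m → A x u * has m i) (update-other c a v≢u))))
        refl)

      free-update : ∀ x → free (c [ v ↦ a ]) x + A x v ≡ free c x
      free-update x = trans
        (subst₂ (λ p q → free (c [ v ↦ a ]) x + p ≡ free c x + q)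
          (trans (cong (λ m → A x v * blank m) cv) (*-identityʳ (A x v)))
          (trans (cong (λ m → A x v * blank m) (update-self c v a)) (*-zeroʳ (A x v)))
          (sum-update _ _ v (λ u v≢u → cong (λ m → A x u * blank m) (update-other c a v≢u))))
        (+-identityʳ _)

      cnt-update-adj : ∀ {x} → x ~ v → ∀ i → cnt (c [ v ↦ a ]) x i ≡ bump a (cnt c x) i
      cnt-update-adj x~v i = trans (cnt-update _ i) (cong (cnt c _ i +_) (A*≡ x~v))

      cnt-update-nonadj : ∀ {x} → ¬ x ~ v → ∀ i → cnt (c [ v ↦ a ]) x i ≡ cnt c x i
      cnt-update-nonadj x≁v i =
        trans (cnt-update _ i) (trans (cong (λ w → cnt c _ i + w * δ a i) (A≡0 x≁v)) (+-identityʳ _))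

      free-update-adj : ∀ {x} → x ~ v → free (c [ v ↦ a ]) x ≡ pred (free c x)
      free-update-adj {x} x~v = cong pred (trans (+-comm 1 _)
        (trans (cong (free (c [ v ↦ a ]) x +_) (sym (A≡1 x~v))) (free-update x)))

      free-update-nonadj : ∀ {x} → ¬ x ~ v → free (c [ v ↦ a ]) x ≡ free c x
      free-update-nonadj {x} x≁v = trans (sym (+-identityʳ _))
        (trans (cong (free (c [ v ↦ a ]) x +_) (sym (A≡0 x≁v))) (free-update x))

      cnt-mono : ∀ x i → cnt c x i ≤ cnt (c [ v ↦ a ]) x i
      cnt-mono x i = subst (cnt c x i ≤_) (sym (cnt-update x i)) (m≤m+n _ _)

    blank-nbr≤free : ∀ c {x u} → x ~ u → c u ≡ nothing → 1 ≤ free c x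
    blank-nbr≤free c {x} {u} x~u cu = subst (_≤ free c x)
      (trans (A*≡ x~u) (cong blank cu)) (term≤sum (λ u → A x u * blank (c u)) u)

    two-blank-nbrs≤free : ∀ c {x u w} → u ≢ w → x ~ u → c u ≡ nothing → x ~ w → c w ≡ nothing → 2 ≤ free c x
    two-blank-nbrs≤free c {x} {u} {w} u≢w x~u cu x~w cw = subst (_≤ free c x)
      (cong₂ _+_ (trans (A*≡ x~u) (cong blank cu)) (trans (A*≡ x~w) (cong blank cw)))
      (two-terms≤sum (λ u → A x u * blank (c u)) u≢w)

  -- `enough` is the colour count (h + 1)D - 1 without subtraction. `mode` lists the two regimes in
  -- which a neighbour blocks at most `h` colours besides its own.
  record Setting (k h g D : ℕ) : Set where
    field
      g≤h    : g ≤ h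
      h≤1+g  : h ≤ suc g
      1≤h    : 1 ≤ h
      mode   : g ≡ h ⊎ D ≤ suc (suc h)
      deg≤D  : ∀ v → deg v ≤ D
      enough : suc h * D ≤ suc k

  module Extension {k h g D : ℕ} (setting : Setting k h g D) where

    open Setting setting public
    open Cost {k} h g g≤h h≤1+g public

    OkAt : Colouring → Fin n → Set
    OkAt c x = Ok (free c x) (cnt c x)

    record Good (c : Colouring {k}) : Set where
      field
        proper : ∀ {u v a} → u ~ v → c u ≡ just a → c v ≡ just a → ⊥
        okAt   : ∀ x → OkAt c x
    open Good public

    costAt : Colouring → Fin n → ℕ
    costAt c x = cost (free c x) (cnt c x)

    -- What the neighbour x contributes to the surplus of colours available for an uncoloured vertex.
    σ : Colouring → Fin n → ℕ
    σ c x = blank (c x) + (h ∸ costAt c x)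

    gain : Colouring → Fin n → ℕ
    gain c v = sum λ x → A v x * σ c x

    total<D : ∀ (c : Colouring {k}) {x v} → x ~ v → c v ≡ nothing → total (cnt c x) < D
    total<D c {x} x~v cv = begin-strict
      total (cnt c x)             <⟨ m<m+n _ (blank-nbr≤free c x~v cv) ⟩
      total (cnt c x) + free c x  ≡⟨ total+free≡deg c x ⟩
      deg x                       ≤⟨ deg≤D x ⟩
      D                           ∎
      where open ≤-Reasoning

    costAt≤h : ∀ {c x v} → Good c → x ~ v → c v ≡ nothing → costAt c x ≤ h
    costAt≤h {c} {x} good x~v cv = cost≤h (free c x) (cnt c x) (blank-nbr≤free c x~v cv) (okAt good x) (mode′ mode)
      where
      mode′ : g ≡ h ⊎ D ≤ suc (suc h) → g ≡ h ⊎ total (cnt c x) ≤ suc h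
      mode′ (inj₁ eq) = inj₁ eq
      mode′ (inj₂ le) = inj₂ (≤-pred (≤-trans (total<D c x~v cv) le))

    -- Nothing is asked at `v` itself, since colouring `v` does not change the colours on its own
    -- neighbourhood.
    Valid : Colouring → Fin n → Fin k → Set
    Valid c v a = cnt c v a ≡ 0 × (∀ x → v ~ x → bad (free c x) (cnt c x) a ≡ 0)

    OkAt-cong : ∀ {j j′} {f f′ : Fin k → ℕ} → j′ ≡ j → (∀ i → f′ i ≡ f i) → Ok j f → Ok j′ f′
    OkAt-cong {j} refl eq ok = subst₂ _≤_ (sym (cong (need j) (total-cong eq))) (sym (uniq-cong eq)) ok

    module _ {c : Colouring} (good : Good c) {v : Fin n} (cv : c v ≡ nothing) where

      blocked : ℕ
      blocked = sum λ x → A v x * costAt c x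

      -- Because `costAt ≤ h` around a blank `v`, the truncated subtraction in `σ` is exact and each
      -- neighbour contributes `blank + h`.
      blocked+gain : blocked + gain c v ≡ free c v + deg v * h
      blocked+gain = begin
        blocked + gain c v
          ≡⟨ ∑-distrib-+ _ (λ x → A v x * σ c x) ⟨
        sum (λ x → A v x * costAt c x + A v x * σ c x)
          ≡⟨ sum-cong-≗ pointwise ⟩
        sum (λ x → A v x * blank (c x) + h * A v x)
          ≡⟨ ∑-distrib-+ (λ x → A v x * blank (c x)) _ ⟩
        free c v + sum (λ x → h * A v x)
          ≡⟨ cong (free c v +_) (*-distribˡ-sum h (A v)) ⟨
        free c v + h * deg v
          ≡⟨ cong (free c v +_) (*-comm h (deg v)) ⟩
        free c v + deg v * h ∎
        where
        open ≡-Reasoning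
        regroup : ∀ p b s → p + (b + s) ≡ b + (s + p)
        regroup = solve-∀
        pointwise : ∀ x → A v x * costAt c x + A v x * σ c x ≡ A v x * blank (c x) + h * A v x
        pointwise x = begin
          A v x * costAt c x + A v x * σ c x  ≡⟨ *-distribˡ-+ (A v x) _ _ ⟨
          A v x * (costAt c x + σ c x)        ≡⟨ A* (λ v~x → trans (regroup (costAt c x) (blank (c x)) (h ∸ costAt c x))
                                                   (cong (blank (c x) +_) (m∸n+n≡m (costAt≤h good (~-sym v~x) cv)))) ⟩
          A v x * (blank (c x) + h)           ≡⟨ *-distribˡ-+ (A v x) _ h ⟩
          A v x * blank (c x) + A v x * h     ≡⟨ cong (A v x * blank (c x) +_) (*-comm (A v x) h) ⟩
          A v x * blank (c x) + h * A v x     ∎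

      valid⇒good : ∀ {a} → Valid c v a → Good (c [ v ↦ a ])
      valid⇒good {a} (absent , harmless) = record { proper = proper′ ; okAt = okAt′ }
        where
        c′ : Colouring
        c′ = c [ v ↦ a ]
        no-nbr : ∀ {u} → v ~ u → c u ≡ just a → ⊥
        no-nbr v~u cu = contradiction (cnt≥1 c v~u cu) (<⇒≱ (s≤s (≤-reflexive absent)))
        same-colour : ∀ {u b} → v ≢ u → c′ u ≡ just b → c′ v ≡ just b → c u ≡ just a
        same-colour v≢u c′u c′v =
          trans (sym (update-other c a v≢u)) (trans c′u (trans (sym c′v) (update-self c v a)))
        proper′ : ∀ {u w b} → u ~ w → c′ u ≡ just b → c′ w ≡ just b → ⊥
        proper′ {u} {w} u~w c′u c′w with v ≟ u | v ≟ w
        ... | yes refl | yes refl = ~⇒≢ u~w refl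
        ... | yes refl | no v≢w   = no-nbr u~w (same-colour v≢w c′w c′u)
        ... | no v≢u   | yes refl = no-nbr (~-sym u~w) (same-colour v≢u c′u c′w)
        ... | no v≢u   | no v≢w   =
          proper good u~w (trans (sym (update-other c a v≢u)) c′u) (trans (sym (update-other c a v≢w)) c′w)
        okAt′ : ∀ x → OkAt c′ x
        okAt′ x with x ~? v
        ... | yes x~v = OkAt-cong (free-update-adj c cv a x~v) (cnt-update-adj c cv a x~v)
                          (bad≡0⇒Ok (free c x) (cnt c x) a (harmless x (~-sym x~v)))
        ... | no x≁v  = OkAt-cong (free-update-nonadj c cv a x≁v) (cnt-update-nonadj c cv a x≁v) (okAt good x)

      -- Present and blocked colours number at most `dist + blocked`, which equals (h + 1) `deg v`
      -- less `rep` and `gain`. `X` adds colours to be avoided for other reasons, typically those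
      -- seen at another vertex.
      choose-general : (X : Fin k → ℕ) →
        2 + sum X + (deg v + deg v * h) ≤ suc h * D + (rep (cnt c v) + gain c v) → ∃ λ a → X a ≡ 0 × Valid c v a
      choose-general X surplus with sum-<⇒zero weight weight<k
        where
        present nuisance weight : Fin k → ℕ
        present a = pos (cnt c v a)
        nuisance a = sum λ x → A v x * bad (free c x) (cnt c x) a
        weight a = (present a + nuisance a) + X a
        nuisance-sum : sum nuisance ≡ blocked
        nuisance-sum = trans (∑-comm (λ a x → A v x * bad (free c x) (cnt c x) a))
          (sum-cong-≗ λ x → sym (*-distribˡ-sum (A v x) (bad (free c x) (cnt c x))))
        weight-sum : sum weight ≡ (dist (cnt c v) + blocked) + sum X
        weight-sum = trans (∑-distrib-+ (λ a → present a + nuisance a) X)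
          (cong (_+ sum X) (trans (∑-distrib-+ present nuisance) (cong (dist (cnt c v) +_) nuisance-sum)))
        weight<k : sum weight < k
        weight<k = subst (_< k) (sym weight-sum) (≤-pred (+-cancelʳ-≤ (rep (cnt c v) + gain c v) _ _ (begin
          2 + ((d + blocked) + X′) + (r + γ)      ≡⟨ regroup₁ d blocked X′ r γ ⟩
          2 + X′ + ((d + r) + (blocked + γ))      ≡⟨ cong₂ (λ p q → 2 + X′ + (p + q)) (dist+rep≡total (cnt c v)) blocked+gain ⟩
          2 + X′ + (t + (free c v + deg v * h))   ≡⟨ cong (2 + X′ +_) (+-assoc t _ _) ⟨
          2 + X′ + (t + free c v + deg v * h)     ≡⟨ cong (λ p → 2 + X′ + (p + deg v * h)) (total+free≡deg c v) ⟩
          2 + X′ + (deg v + deg v * h)            ≤⟨ surplus ⟩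
          suc h * D + (r + γ)                     ≤⟨ +-monoˡ-≤ (r + γ) enough ⟩
          suc k + (r + γ)                         ∎)))
          where
          open ≤-Reasoning
          d r γ t X′ : ℕ
          d = dist (cnt c v)
          r = rep (cnt c v)
          γ = gain c v
          t = total (cnt c v)
          X′ = sum X
          regroup₁ : ∀ d b x r γ → 2 + ((d + b) + x) + (r + γ) ≡ 2 + x + ((d + r) + (b + γ))
          regroup₁ = solve-∀
      ... | a , weight≡0 = a , m+n≡0⇒n≡0 _ weight≡0 , absent , harmless
        where
        rest≡0 : pos (cnt c v a) + sum (λ x → A v x * bad (free c x) (cnt c x) a) ≡ 0
        rest≡0 = m+n≡0⇒m≡0 _ weight≡0
        absent : cnt c v a ≡ 0
        absent with cnt c v a | m+n≡0⇒m≡0 (pos (cnt c v a)) rest≡0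
        ... | zero | _ = refl
        harmless : ∀ x → v ~ x → bad (free c x) (cnt c x) a ≡ 0
        harmless x v~x = trans (sym (A*≡ v~x))
          (sum≡0⇒ (λ x → A v x * bad (free c x) (cnt c x) a) (m+n≡0⇒n≡0 (pos (cnt c v a)) rest≡0) x)

      -- Of the `2`, one pays for the colour missing from (h + 1)D and one for the strictness of the
      -- pigeonhole.
      choose-avoiding : (X : Fin k → ℕ) → 2 + sum X ≤ rep (cnt c v) + gain c v → ∃ λ a → X a ≡ 0 × Valid c v a
      choose-avoiding X le = choose-general X (subst (2 + sum X + (deg v + deg v * h) ≤_) (+-comm _ (suc h * D))
        (+-mono-≤ le (subst (_≤ suc h * D) (cong (deg v +_) (*-comm h (deg v))) (*-monoʳ-≤ (suc h) (deg≤D v)))))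

      no-colour-avoided : sum {k} (λ _ → 0) ≡ 0
      no-colour-avoided = sum-zero {k} (λ _ → refl)

      colour-avoiding : (X : Fin k → ℕ) → 2 + sum X ≤ rep (cnt c v) + gain c v → ∃ λ a → X a ≡ 0 × Good (c [ v ↦ a ])
      colour-avoiding X le = let (a , avoided , valid) = choose-avoiding X le in a , avoided , valid⇒good valid

      choose : 2 ≤ rep (cnt c v) + gain c v → ∃ λ a → Valid c v a
      choose le = let (a , _ , valid) = choose-avoiding (λ _ → 0) surplus in a , valid
        where
        surplus : 2 + sum {k} (λ _ → 0) ≤ rep (cnt c v) + gain c v
        surplus = ≤-trans (≤-reflexive (cong (2 +_) no-colour-avoided)) le

      colour : 2 ≤ rep (cnt c v) + gain c v → ∃ λ a → Good (c [ v ↦ a ])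
      colour le = let (a , valid) = choose le in a , valid⇒good valid

      colour-low : deg v < D → ∃ λ a → Good (c [ v ↦ a ])
      colour-low deg<D = let (a , _ , valid) = choose-general (λ _ → 0) surplus in a , valid⇒good valid
        where
        open ≤-Reasoning
        regroup : ∀ d h → suc h + (d + d * h) ≡ suc h * suc d
        regroup = solve-∀
        surplus : 2 + sum {k} (λ _ → 0) + (deg v + deg v * h) ≤ suc h * D + (rep (cnt c v) + gain c v)
        surplus = begin
          2 + sum {k} (λ _ → 0) + (deg v + deg v * h)  ≡⟨ cong (λ s → 2 + s + (deg v + deg v * h)) no-colour-avoided ⟩
          2 + (deg v + deg v * h)                      ≤⟨ +-monoˡ-≤ (deg v + deg v * h) (s≤s 1≤h) ⟩
          suc h + (deg v + deg v * h)                  ≡⟨ regroup (deg v) h ⟩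
          suc h * suc (deg v)                          ≤⟨ *-monoʳ-≤ (suc h) deg<D ⟩
          suc h * D                                    ≤⟨ m≤m+n _ _ ⟩
          suc h * D + (rep (cnt c v) + gain c v)       ∎

-- Extending good partial colourings

module PartialColourings {n : ℕ} {G : Graph n} {k h g D : ℕ} (setting : Colourings.Setting G k h g D) where

  open Colourings G public
  open Extension setting public

  Partial : Set
  Partial = Colouring {k}

  Extendable : Partial → Fin n → Set
  Extendable c v = ∃ λ a → Good (c [ v ↦ a ])

  _⊑_ : Partial → Partial → Set
  c ⊑ c′ = ∀ u → c u ≡ nothing ⊎ c′ u ≡ c u

  ⊑-trans : ∀ {c c′ c″} → c ⊑ c′ → c′ ⊑ c″ → c ⊑ c″
  ⊑-trans p q u with p u | q u
  ... | inj₁ cu   | _         = inj₁ cu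
  ... | inj₂ same | inj₁ c′u  = inj₁ (trans (sym same) c′u)
  ... | inj₂ same | inj₂ same′ = inj₂ (trans same′ same)

  ⊑-update : ∀ (c : Partial) {v} a → c v ≡ nothing → c ⊑ (c [ v ↦ a ])
  ⊑-update c {v} a cv u with v ≟ u
  ... | yes refl = inj₁ cv
  ... | no v≢u   = inj₂ (update-other c a v≢u)

  cnt-⊑ : ∀ {c c′} → c ⊑ c′ → ∀ x i → cnt c x i ≤ cnt c′ x i
  cnt-⊑ {c} {c′} p x i = sum-mono (λ u → *-monoʳ-≤ (A x u) (pointwise u))
    where
    pointwise : ∀ u → has (c u) i ≤ has (c′ u) i
    pointwise u with p u
    ... | inj₁ cu   = subst (λ m → has m i ≤ has (c′ u) i) (sym cu) z≤n
    ... | inj₂ same = ≤-reflexive (cong (λ m → has m i) (sym same))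

  rep-⊑ : ∀ {c c′} → c ⊑ c′ → ∀ x → rep (cnt c x) ≤ rep (cnt c′ x)
  rep-⊑ p x = rep-mono (cnt-⊑ p x)

  -- While a neighbour is blank, `total < D` and hence `uniq > h`. In terms of `uniq + total` the
  -- property survives every extension, unlike `h < uniq`.
  Rich : Partial → Fin n → Set
  Rich c x = D + h ≤ uniq (cnt c x) + total (cnt c x)

  Rich-⊑ : ∀ {c c′} → c ⊑ c′ → ∀ {x} → Rich c x → Rich c′ x
  Rich-⊑ p {x} rich = ≤-trans rich (uniq+total-mono (cnt-⊑ p x))

  module _ (c : Partial) {v : Fin n} (cv : c v ≡ nothing) (a : Fin k) {x : Fin n} where

    uniq-nonadj : ¬ x ~ v → uniq (cnt (c [ v ↦ a ]) x) ≡ uniq (cnt c x)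
    uniq-nonadj x≁v = uniq-cong (cnt-update-nonadj c cv a x≁v)

    total-adj : x ~ v → total (cnt (c [ v ↦ a ]) x) ≡ suc (total (cnt c x))
    total-adj x~v = trans (total-cong (cnt-update-adj c cv a x~v)) (total-bump a (cnt c x))

    uniq-fresh : x ~ v → cnt c x a ≡ 0 → uniq (cnt (c [ v ↦ a ]) x) ≡ suc (uniq (cnt c x))
    uniq-fresh x~v fresh = trans (uniq-cong (cnt-update-adj c cv a x~v)) (uniq-bump-fresh a (cnt c x) fresh)

    uniq≤uniq-fresh : x ~ v → cnt c x a ≡ 0 → uniq (cnt c x) ≤ uniq (cnt (c [ v ↦ a ]) x)
    uniq≤uniq-fresh x~v fresh = ≤-trans (n≤1+n _) (≤-reflexive (sym (uniq-fresh x~v fresh)))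

    rep-repeated : x ~ v → 1 ≤ cnt c x a → 1 ≤ rep (cnt (c [ v ↦ a ]) x)
    rep-repeated x~v seen =
      subst (1 ≤_) (sym (rep-cong (cnt-update-adj c cv a x~v))) (rep-bump-repeated a (cnt c x) seen)

  ~-irrefl : ∀ v → ¬ v ~ v
  ~-irrefl v v~v = ~⇒≢ v~v refl

  uniq-self : ∀ (c : Partial) {v} → c v ≡ nothing → ∀ a → uniq (cnt (c [ v ↦ a ]) v) ≡ uniq (cnt c v)
  uniq-self c {v} cv a = uniq-nonadj c cv a (~-irrefl v)

  Slack : Partial → Fin n → Set
  Slack c x = costAt c x ≡ 0

  module _ {c : Partial} (good : Good c) where

    slack-h : ∀ {x v} → x ~ v → c v ≡ nothing → suc h ≤ uniq (cnt c x) → Slack c x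
    slack-h {x} x~v cv = cost≡0-h (free c x) (cnt c x) (blank-nbr≤free c x~v cv) (okAt good x)

    slack-g : ∀ {x u w} → u ≢ w → x ~ u → c u ≡ nothing → x ~ w → c w ≡ nothing → suc g ≤ uniq (cnt c x) → Slack c x
    slack-g {x} u≢w x~u cu x~w cw =
      cost≡0-g (free c x) (cnt c x) (blank-nbr≤free c x~u cu) (okAt good x) (two-blank-nbrs≤free c u≢w x~u cu x~w cw)

    rich⇒1+h≤uniq : ∀ {x v} → x ~ v → c v ≡ nothing → Rich c x → suc h ≤ uniq (cnt c x)
    rich⇒1+h≤uniq {x} x~v cv rich = linear (suc h) (uniq (cnt c x)) 0 (+-mono-≤ rich (total<D c x~v cv))
      (regroup h (uniq (cnt c x)) (total (cnt c x)) D)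
      where
      regroup : ∀ h u t D → suc h + (u + t + D) + 0 ≡ u + (D + h + suc t)
      regroup = solve-∀

    rich⇒slack : ∀ {x v} → x ~ v → c v ≡ nothing → Rich c x → Slack c x
    rich⇒slack x~v cv rich = slack-h x~v cv (rich⇒1+h≤uniq x~v cv rich)

  σ-blank : ∀ (c : Partial) {x} → c x ≡ nothing → 1 ≤ σ c x
  σ-blank c {x} cx = ≤-trans (≤-reflexive (sym (cong blank cx))) (m≤m+n (blank (c x)) _)

  σ-slack : ∀ (c : Partial) {x} → Slack c x → h ≤ σ c x
  σ-slack c {x} slack =
    ≤-trans (≤-reflexive (cong (h ∸_) (sym slack))) (m≤n+m (h ∸ costAt c x) (blank (c x)))

  σ-slack≥1 : ∀ (c : Partial) {x} → Slack c x → 1 ≤ σ c x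
  σ-slack≥1 c slack = ≤-trans 1≤h (σ-slack c slack)

  σ-blank-slack : ∀ (c : Partial) {x} → c x ≡ nothing → Slack c x → suc h ≤ σ c x
  σ-blank-slack c {x} cx slack = ≤-reflexive (sym (cong₂ (λ b s → b + (h ∸ s)) (cong blank cx) slack))

  σ≤gain : ∀ (c : Partial) {v x} → v ~ x → σ c x ≤ gain c v
  σ≤gain c {v} {x} v~x = subst (_≤ gain c v) (A*≡ v~x) (term≤sum (λ x → A v x * σ c x) x)

  σ+σ≤gain : ∀ (c : Partial) {v x y} → x ≢ y → v ~ x → v ~ y → σ c x + σ c y ≤ gain c v
  σ+σ≤gain c {v} x≢y v~x v~y = subst (_≤ gain c v) (cong₂ _+_ (A*≡ v~x) (A*≡ v~y))
    (two-terms≤sum (λ x → A v x * σ c x) x≢y)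

  σ+σ+σ≤gain : ∀ (c : Partial) {v x y z} → x ≢ y → x ≢ z → y ≢ z → v ~ x → v ~ y → v ~ z →
    σ c x + (σ c y + σ c z) ≤ gain c v
  σ+σ+σ≤gain c {v} x≢y x≢z y≢z v~x v~y v~z = subst (_≤ gain c v)
    (cong₂ _+_ (A*≡ v~x) (cong₂ _+_ (A*≡ v~y) (A*≡ v~z))) (three-terms≤sum (λ u → A v u * σ c u) x≢y x≢z y≢z)

  module _ {c : Partial} (good : Good c) {v : Fin n} (cv : c v ≡ nothing) where

    colour-gain : 2 ≤ gain c v → Extendable c v
    colour-gain le = colour good cv (≤-trans le (m≤n+m _ _))

    colour-two : ∀ {x y} → x ≢ y → v ~ x → v ~ y → 1 ≤ σ c x → 1 ≤ σ c y → Extendable c v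
    colour-two x≢y v~x v~y p q = colour-gain (≤-trans (+-mono-≤ p q) (σ+σ≤gain c x≢y v~x v~y))

    colour-one : ∀ {x} → v ~ x → 2 ≤ σ c x → Extendable c v
    colour-one v~x p = colour-gain (≤-trans p (σ≤gain c v~x))

    colour-rep : ∀ {x} → 1 ≤ rep (cnt c v) → v ~ x → 1 ≤ σ c x → Extendable c v
    colour-rep 1≤rep v~x p = colour good cv (+-mono-≤ 1≤rep (≤-trans p (σ≤gain c v~x)))

    colour-2rep : 2 ≤ rep (cnt c v) → Extendable c v
    colour-2rep le = colour good cv (≤-trans le (m≤m+n _ _))

  open import Data.List.Membership.DecPropositional (_≟_ {n}) using (_∈?_) public

  -- `kept` protects the vertices that are to stay blank. Entries of `vs` may already be coloured in
  -- `c`.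
  record Fill (c : Partial) (vs : List (Fin n)) : Set where
    constructor fill
    field
      {result} : Partial
      good     : Good result
      filled   : ∀ {u} → u ∈ vs → result u ≢ nothing
      kept     : ∀ {u} → u ∉ vs → result u ≡ c u

  fill-[] : ∀ {c} → Good c → Fill c []
  fill-[] good = fill good (λ ()) (λ _ → refl)

  fill-∷ : ∀ {c v} a {vs} → Fill (c [ v ↦ a ]) vs → Fill c (v ∷ vs)
  fill-∷ {c} {v} a {vs} (fill {c′} good filled kept) = fill good filled′ kept′
    where
    filled′ : ∀ {u} → u ∈ v ∷ vs → c′ u ≢ nothing
    filled′ {u} u∈ with u ∈? vs | u∈
    ... | yes u∈vs | _          = filled u∈vs
    ... | no u∉vs  | there u∈vs = contradiction u∈vs u∉vs
    ... | no u∉vs  | here refl  = λ eq → case-just (trans (sym (update-self c v a)) (trans (sym (kept u∉vs)) eq))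
      where
      case-just : just a ≡ nothing → ⊥
      case-just ()
    kept′ : ∀ {u} → u ∉ v ∷ vs → c′ u ≡ c u
    kept′ u∉ = trans (kept (u∉ ∘ there)) (update-other c a (λ { refl → u∉ (here refl) }))

  fill-step : ∀ {c v vs} → Extendable c v →
    (∀ a → Good (c [ v ↦ a ]) → Fill (c [ v ↦ a ]) vs) → Fill c (v ∷ vs)
  fill-step (a , good) rest = fill-∷ a (rest a good)

  fill-one : ∀ {c v} → Extendable c v → Fill c (v ∷ [])
  fill-one (a , good) = fill-∷ a (fill-[] good)

  -- Resumes after an intermediate phase `c′` that has coloured part of `ws`.
  fill-⊆ : ∀ {c c′ vs ws} → (∀ {u} → u ∉ ws → c′ u ≡ c u) → (∀ {u} → u ∈ vs → u ∈ ws) →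
    (∀ {u} → u ∈ ws → u ∈ vs ⊎ c′ u ≢ nothing) → Fill c′ vs → Fill c ws
  fill-⊆ {c} {c′} {vs} {ws} kept₀ vs⊆ws cover (fill {r} good filled kept) =
    fill good filled′ (λ u∉ws → trans (kept (u∉ws ∘ vs⊆ws)) (kept₀ u∉ws))
    where
    filled′ : ∀ {u} → u ∈ ws → r u ≢ nothing
    filled′ {u} u∈ws with u ∈? vs | cover u∈ws
    ... | yes u∈vs | _            = filled u∈vs
    ... | no u∉vs  | inj₁ u∈vs    = contradiction u∈vs u∉vs
    ... | no u∉vs  | inj₂ c′u     = λ ru → c′u (trans (sym (kept u∉vs)) ru)

  fill-skip : ∀ {c v vs} → c v ≢ nothing → Fill c vs → Fill c (v ∷ vs)
  fill-skip cv = fill-⊆ (λ _ → refl) there (λ { (here refl) → inj₂ cv ; (there u∈) → inj₁ u∈ })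

  fill-↭ : ∀ {c vs ws} → vs ↭ ws → Fill c vs → Fill c ws
  fill-↭ vs↭ws (fill good filled kept) =
    fill good (filled ∘ ∈-resp-↭ (↭-sym vs↭ws)) (λ u∉ws → kept (u∉ws ∘ ∈-resp-↭ vs↭ws))

  fill-swap : ∀ {c v w} → Fill c (v ∷ w ∷ []) → Fill c (w ∷ v ∷ [])
  fill-swap = fill-↭ (↭-swap _ _ ↭-refl)

  still-blank : ∀ (c : Partial) {v} a {u} → v ≢ u → c u ≡ nothing → (c [ v ↦ a ]) u ≡ nothing
  still-blank c a v≢u cu = trans (update-other c a v≢u) cu

  -- `z` stays blank and saves a colour for `v`. An end with more than `h` unique colours blocks
  -- nothing for the other end, also after it has itself been coloured; a repetition saves a colour
  -- directly. The order of the two ends is chosen so that each collects two savings.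
  fill-edge : ∀ {c v w z} → Good c → c v ≡ nothing → c w ≡ nothing → c z ≡ nothing → v ~ w → v ~ z → z ≢ w →
    (suc h ≤ uniq (cnt c v) × (suc h ≤ uniq (cnt c w) ⊎ 1 ≤ rep (cnt c w))) ⊎ (1 ≤ rep (cnt c v) × 1 ≤ rep (cnt c w)) →
    Fill c (v ∷ w ∷ [])
  fill-edge {c} {v} {w} {z} good cv cw cz v~w v~z z≢w (inj₁ (uv , inj₁ uw)) = fill-swap (fill-step
    (colour-one good cw (~-sym v~w) (≤-trans (s≤s 1≤h) (σ-blank-slack c cv (slack-h good v~w cw uv))))
    λ a good₁ → let c₁v = still-blank c a (~⇒≢ (~-sym v~w)) cv in fill-one
    (colour-two good₁ c₁v z≢w v~z v~w (σ-blank _ (still-blank c a (z≢w ∘ sym) cz))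
      (σ-slack≥1 _ (slack-h good₁ (~-sym v~w) c₁v (subst (suc h ≤_) (sym (uniq-self c cw a)) uw)))))
  fill-edge {c} {v} {w} {z} good cv cw cz v~w v~z z≢w (inj₁ (uv , inj₂ rw)) = fill-step
    (colour-two good cv z≢w v~z v~w (σ-blank c cz) (σ-blank c cw))
    λ a good₁ → let c₁w = still-blank c a (~⇒≢ v~w) cw in fill-one
    (colour-rep good₁ c₁w (≤-trans rw (rep-⊑ (⊑-update c a cv) w)) (~-sym v~w)
      (σ-slack≥1 _ (slack-h good₁ v~w c₁w (subst (suc h ≤_) (sym (uniq-self c cv a)) uv))))
  fill-edge {c} {v} {w} {z} good cv cw cz v~w v~z z≢w (inj₂ (rv , rw)) = fill-swap (fill-step
    (colour-rep good cw rw (~-sym v~w) (σ-blank c cv))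
    λ a good₁ → let c₁v = still-blank c a (~⇒≢ (~-sym v~w)) cv in fill-one
    (colour-rep good₁ c₁v (≤-trans rv (rep-⊑ (⊑-update c a cw) v)) v~z (σ-blank _ (still-blank c a (z≢w ∘ sym) cz))))

  free≤gain : ∀ c v → free c v ≤ gain c v
  free≤gain c v = sum-mono (λ x → *-monoʳ-≤ (A v x) (m≤m+n (blank (c x)) _))

  -- Induction on the set left blank

  VertexSet : Set
  VertexSet = Fin n → Bool

  opaque
    add : Fin n → VertexSet → VertexSet
    add v U u = does (v ≟ u) ∨ U u

    add-self : ∀ v U → add v U v ≡ true
    add-self v U with v ≟ v
    ... | yes _  = refl
    ... | no v≢v = contradiction refl v≢v

    add-other : ∀ {v} U {u} → v ≢ u → add v U u ≡ U u
    add-other {v} U {u} v≢u with v ≟ u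
    ... | yes v≡u = contradiction v≡u v≢u
    ... | no _    = refl

    add-⊇ : ∀ v U {u} → U u ≡ true → add v U u ≡ true
    add-⊇ v U {u} Uu with v ≟ u
    ... | yes _ = refl
    ... | no _  = Uu

  addAll : List (Fin n) → VertexSet → VertexSet
  addAll []       U = U
  addAll (v ∷ vs) U = add v (addAll vs U)

  addAll-∈ : ∀ {vs} U {u} → u ∈ vs → addAll vs U u ≡ true
  addAll-∈ {v ∷ vs} U (here refl)  = add-self v (addAll vs U)
  addAll-∈ {v ∷ vs} U (there u∈vs) = add-⊇ v (addAll vs U) (addAll-∈ U u∈vs)

  addAll-⊇ : ∀ vs U {u} → U u ≡ true → addAll vs U u ≡ true
  addAll-⊇ []       U Uu = Uu
  addAll-⊇ (v ∷ vs) U Uu = add-⊇ v (addAll vs U) (addAll-⊇ vs U Uu)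

  addAll-∉ : ∀ vs U {u} → u ∉ vs → addAll vs U u ≡ U u
  addAll-∉ []       U u∉ = refl
  addAll-∉ (v ∷ vs) U u∉ = trans (add-other (addAll vs U) (λ { refl → u∉ (here refl) })) (addAll-∉ vs U (u∉ ∘ there))

  -- `U` is the set to be left uncoloured, so these neighbours are blank throughout.
  outside : VertexSet → Fin n → ℕ
  outside U w = sum λ y → A w y * ⟦ U y ⟧

  outside-add : ∀ U {v} w → U v ≡ false → outside (add v U) w ≡ outside U w + A w v
  outside-add U {v} w Uv = begin
    outside (add v U) w                   ≡⟨ +-identityʳ _ ⟨
    outside (add v U) w + 0               ≡⟨ cong (outside (add v U) w +_) (trans (cong (λ b → A w v * ⟦ b ⟧) Uv) (*-zeroʳ (A w v))) ⟨
    outside (add v U) w + A w v * ⟦ U v ⟧ ≡⟨ sum-update _ _ v (λ u v≢u → cong (λ b → A w u * ⟦ b ⟧) (add-other U v≢u)) ⟩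
    outside U w + A w v * ⟦ add v U v ⟧   ≡⟨ cong (outside U w +_) (trans (cong (λ b → A w v * ⟦ b ⟧) (add-self v U)) (*-identityʳ (A w v))) ⟩
    outside U w + A w v                   ∎
    where open ≡-Reasoning

  outside≥1 : ∀ U {w z} → w ~ z → U z ≡ true → 1 ≤ outside U w
  outside≥1 U {w} {z} w~z Uz = subst (_≤ outside U w) (trans (A*≡ w~z) (cong ⟦_⟧ Uz)) (term≤sum (λ y → A w y * ⟦ U y ⟧) z)

  inner-nbr : ∀ U w p → 2 + outside U w ≤ deg w → ∃ λ u → w ~ u × U u ≡ false × u ≢ p
  inner-nbr U w p le with any? (λ u → (w ~? u) ×-dec ((U u ≟ᵇ false) ×-dec ¬? (u ≟ p)))
  ... | yes found = found
  ... | no ¬found = contradiction (≤-trans le (≤-trans (sum-mono pointwise)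
                      (≤-reflexive (trans (∑-distrib-+ (λ y → A w y * ⟦ U y ⟧) (δ p))
                        (trans (cong (outside U w +_) (sum-δ₁ p)) (+-comm _ 1))))))
                      1+n≰n
    where
    pointwise : ∀ u → A w u ≤ A w u * ⟦ U u ⟧ + δ p u
    pointwise u with w ~? u | U u in Uu | p ≟ u
    ... | no w≁u  | _     | _        = ≤-trans (≤-reflexive (A≡0 w≁u)) z≤n
    ... | yes w~u | true  | _        = ≤-trans (≤-reflexive (sym (*-identityʳ (A w u)))) (m≤m+n (A w u * 1) _)
    ... | yes w~u | false | yes refl = ≤-trans (⟦⟧≤1 (adj G w u)) (m≤n+m 1 _)
    ... | yes w~u | false | no p≢u   = contradiction (u , w~u , Uu , p≢u ∘ sym) ¬found

  BlankOn : Partial → VertexSet → Set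
  BlankOn c U = ∀ u → blank (c u) ≡ ⟦ U u ⟧

  module _ {c : Partial} {U : VertexSet} (blankOn : BlankOn c U) where

    blank-in : ∀ {u} → U u ≡ true → c u ≡ nothing
    blank-in {u} Uu with c u | trans (blankOn u) (cong ⟦_⟧ Uu)
    ... | nothing | _ = refl

    blank-only-in : ∀ {u} → c u ≡ nothing → U u ≡ true
    blank-only-in {u} cu with U u | trans (sym (blankOn u)) (cong blank cu)
    ... | true | _ = refl

    free≡outside : ∀ w → free c w ≡ outside U w
    free≡outside w = sum-cong-≗ (λ y → cong (A w y *_) (blankOn y))

  Colourable : VertexSet → Set
  Colourable U = ∃ λ c → Good c × BlankOn c U

  complete : ∀ {U vs c} → BlankOn c (addAll vs U) → All (λ v → U v ≡ false) vs → Fill c vs → Colourable U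
  complete {U} {vs} {c} blankOn vs∉U (fill {c′} good filled kept) = c′ , good , blankOn′
    where
    blankOn′ : BlankOn c′ U
    blankOn′ u with u ∈? vs
    ... | no u∉vs  = trans (cong blank (kept u∉vs)) (trans (blankOn u) (cong ⟦_⟧ (addAll-∉ vs U u∉vs)))
    ... | yes u∈vs = trans (not-blank (filled u∈vs)) (sym (cong ⟦_⟧ (lookup vs∉U u∈vs)))
      where
      not-blank : ∀ {m : Maybe (Fin k)} → m ≢ nothing → blank m ≡ 0
      not-blank {nothing} m≢ = contradiction refl m≢
      not-blank {just _}  _  = refl

  remaining : VertexSet → ℕ
  remaining U = sum λ u → ⟦ not (U u) ⟧

  remaining-addAll : ∀ U v vs → U v ≡ false → remaining (addAll (v ∷ vs) U) < remaining U
  remaining-addAll U v vs Uv = begin-strict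
    remaining W                     <⟨ n<1+n _ ⟩
    suc (remaining W)               ≡⟨ +-comm 1 _ ⟩
    remaining W + 1                 ≡⟨ cong (remaining W +_) (sum-δ₁ v) ⟨
    remaining W + sum (δ v)         ≡⟨ ∑-distrib-+ (λ u → ⟦ not (W u) ⟧) (δ v) ⟨
    sum (λ u → ⟦ not (W u) ⟧ + δ v u)  ≤⟨ sum-mono pointwise ⟩
    remaining U                     ∎
    where
    open ≤-Reasoning
    W : VertexSet
    W = addAll (v ∷ vs) U
    pointwise : ∀ u → ⟦ not (W u) ⟧ + δ v u ≤ ⟦ not (U u) ⟧
    pointwise u with v ≟ u
    ... | yes refl rewrite Uv | add-self v (addAll vs U) = ≤-refl
    ... | no _ with U u in Uu
    ...   | true  rewrite add-⊇ v (addAll vs U) (addAll-⊇ vs U Uu) = z≤n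
    ...   | false = ≤-trans (≤-reflexive (+-identityʳ _)) (⟦⟧≤1 _)

  -- The induction runs towards larger `U`, down to the empty colouring when `U` is everything. `H`
  -- is an invariant that a step may use but must re-establish for the enlarged set.
  colourable-by-induction : (H : VertexSet → Set) →
    (∀ U v → U v ≡ false → H U → (∀ v vs → U v ≡ false → H (addAll (v ∷ vs) U) → Colourable (addAll (v ∷ vs) U)) → Colourable U) →
    ∀ U → H U → Colourable U
  colourable-by-induction H step U HU = go U (<-wellFounded (remaining U)) HU
    where
    go : ∀ U → Acc _<_ (remaining U) → H U → Colourable U
    go U (acc rs) HU with any? (λ v → U v ≟ᵇ false)
    ... | yes (v , Uv) = step U v Uv HU (λ v vs Uv → go _ (rs (remaining-addAll U v vs Uv)))
    ... | no all-in = c₀ , record { proper = λ _ () ; okAt = okAt′ } , blankOn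
      where
      c₀ : Partial
      c₀ _ = nothing
      okAt′ : ∀ x → OkAt c₀ x
      okAt′ x = ≤-trans (need≤total (free c₀ x) (total (cnt c₀ x))) (≤-trans (≤-reflexive none) z≤n)
        where
        none : total (cnt c₀ x) ≡ 0
        none = sum-zero {k} {cnt c₀ x} (λ i → sum-zero {n} {λ u → A x u * 0} (λ u → *-zeroʳ (A x u)))
      blankOn : BlankOn c₀ U
      blankOn u with U u in Uu
      ... | true  = refl
      ... | false = contradiction (u , Uu) all-in

  -- Walks, induced paths and degrees along them

  data Walk : Fin n → List (Fin n) → Fin n → Set where
    edge : ∀ {a b} → a ~ b → Walk a [] b
    step : ∀ {a w ws b} → a ~ w → Walk w ws b → Walk a (w ∷ ws) b

  join : ∀ {a ws m ws′ b} → Walk a ws m → Walk m ws′ b → Walk a (ws ++ m ∷ ws′) b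
  join (edge a~m)   q = step a~m q
  join (step a~w p) q = step a~w (join p q)

  split : ∀ {a ws b x} → x ∈ ws → Walk a ws b →
    ∃₂ λ us vs → ws ≡ us ++ x ∷ vs × Walk a us x × Walk x vs b
  split (here refl) (step a~x p) = [] , _ , refl , edge a~x , p
  split (there x∈) (step {w = w} a~w p) with split x∈ p
  ... | us , vs , refl , p₁ , p₂ = w ∷ us , vs , refl , step a~w p₁ , p₂

  Far : Fin n → Fin n → Set
  Far x z = ¬ x ~ z × x ≢ z

  -- A chordless path that grows at `x`; the end `y` stays fixed as its root.
  data Induced : Fin n → List (Fin n) → Fin n → Set where
    edge : ∀ {x y} → x ~ y → Induced x [] y
    step : ∀ {x w ws y} → x ~ w → All (Far x) ws → Far x y → Induced w ws y → Induced x (w ∷ ws) y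

  induced⇒walk : ∀ {x ws y} → Induced x ws y → Walk x ws y
  induced⇒walk (edge x~y)       = edge x~y
  induced⇒walk (step x~w _ _ p) = step x~w (induced⇒walk p)

  induced⇒unique : ∀ {x ws y} → Induced x ws y → Unique (y ∷ x ∷ ws)
  induced⇒unique (edge x~y) = (~⇒≢ (~-sym x~y) ∷ []) ∷ [] ∷ []
  induced⇒unique (step x~w far (_ , x≢y) p) with induced⇒unique p
  ... | y≢ ∷ uniq-w = ((x≢y ∘ sym) ∷ y≢) ∷ (~⇒≢ x~w ∷ All.map proj₂ far) ∷ uniq-w

  nbrsIn : Fin n → List (Fin n) → ℕ
  nbrsIn w []       = 0
  nbrsIn w (s ∷ ss) = A w s + nbrsIn w ss

  nbrsIn-far : ∀ {x ws} → All (Far x) ws → nbrsIn x ws ≡ 0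
  nbrsIn-far []                = refl
  nbrsIn-far ((x≁w , _) ∷ far) = cong₂ _+_ (A≡0 x≁w) (nbrsIn-far far)

  nbrsIn-insert : ∀ w y x ws → nbrsIn w (y ∷ x ∷ ws) ≡ A w x + nbrsIn w (y ∷ ws)
  nbrsIn-insert w y x ws = regroup (A w y) (A w x) (nbrsIn w ws)
    where
    regroup : ∀ a b c → a + (b + c) ≡ b + (a + c)
    regroup = solve-∀

  record PathDegrees (x : Fin n) (ws : List (Fin n)) (y : Fin n) : Set where
    field
      at-x  : nbrsIn x (y ∷ x ∷ ws) ≡ 1
      at-y  : nbrsIn y (y ∷ x ∷ ws) ≡ 1
      at-ws : All (λ w → nbrsIn w (y ∷ x ∷ ws) ≡ 2) ws

  insert-vertex : ∀ {y x d} ws w → A w x ≡ d → ∀ {e} → nbrsIn w (y ∷ ws) ≡ e → nbrsIn w (y ∷ x ∷ ws) ≡ d + e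
  insert-vertex {y} {x} ws w d≡ e≡ = trans (nbrsIn-insert w y x ws) (cong₂ _+_ d≡ e≡)

  A≡0-far : ∀ {x w} → Far x w → A w x ≡ 0
  A≡0-far (x≁w , _) = A≡0 (x≁w ∘ ~-sym)

  A≡1-sym : ∀ {x w} → x ~ w → A w x ≡ 1
  A≡1-sym x~w = A≡1 (~-sym x~w)

  path-degrees : ∀ {x ws y} → Induced x ws y → PathDegrees x ws y
  path-degrees {x} {_} {y} (edge x~y) = record
    { at-x  = cong₂ _+_ (A≡1 x~y) (cong (_+ 0) (A-diag x))
    ; at-y  = cong₂ _+_ (A-diag y) (cong (_+ 0) (A≡1-sym x~y))
    ; at-ws = []
    }
  path-degrees {x} {w ∷ ws} {y} (step x~w far far-y p) = record
    { at-x  = insert-vertex (w ∷ ws) x (A-diag x) (cong₂ _+_ (A≡0 (proj₁ far-y)) (cong₂ _+_ (A≡1 x~w) (nbrsIn-far far)))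
    ; at-y  = insert-vertex (w ∷ ws) y (A≡0-far far-y) (PathDegrees.at-y ih)
    ; at-ws = insert-vertex (w ∷ ws) w (A≡1-sym x~w) (PathDegrees.at-x ih)
            ∷ All.zipWith (λ { {v} (far-v , d) → insert-vertex (w ∷ ws) v (A≡0-far far-v) d }) (far , PathDegrees.at-ws ih)
    }
    where
    ih : PathDegrees w ws y
    ih = path-degrees p

  cycle-degrees : ∀ {u x ws y} → Induced x ws y → u ~ x → u ~ y → All (Far u) ws →
    All (λ w → nbrsIn w (y ∷ u ∷ x ∷ ws) ≡ 2) (y ∷ u ∷ x ∷ ws)
  cycle-degrees {u} {x} {ws} {y} p u~x u~y far =
      insert-vertex (x ∷ ws) y (A≡1-sym u~y) (PathDegrees.at-y pd)
    ∷ insert-vertex (x ∷ ws) u (A-diag u) (cong₂ _+_ (A≡1 u~y) (cong₂ _+_ (A≡1 u~x) (nbrsIn-far far)))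
    ∷ insert-vertex (x ∷ ws) x (A≡1-sym u~x) (PathDegrees.at-x pd)
    ∷ All.zipWith (λ { {v} (far-v , d) → insert-vertex (x ∷ ws) v (A≡0-far far-v) d }) (far , PathDegrees.at-ws pd)
    where
    pd : PathDegrees x ws y
    pd = path-degrees p

  -- The path is cut at the neighbour of `u` closest to `y`, so `u` has no chord to what remains.
  shorten : ∀ {u x ws y} → u ∉ y ∷ x ∷ ws → Induced x ws y → Any.Any (u ~_) (x ∷ ws) →
    ∃ λ ws′ → Induced u ws′ y × (∀ {w} → w ∈ ws′ → w ∈ x ∷ ws)
  shorten {u} {y = y} u∉ p near with u ~? y
  ... | yes u~y = [] , edge u~y , λ ()
  ... | no u≁y = go u∉ p near
    where
    head-case : ∀ {x ws} → u ∉ y ∷ x ∷ ws → Induced x ws y → u ~ x → ¬ Any.Any (u ~_) ws → Induced u (x ∷ ws) y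
    head-case u∉ p u~x none = step u~x
      (All.tabulate λ { {z} z∈ → (λ u~z → none (Any.map (λ { refl → u~z }) z∈)) , λ { refl → u∉ (there (there z∈)) } })
      (u≁y , λ { refl → u∉ (here refl) }) p
    go : ∀ {x ws} → u ∉ y ∷ x ∷ ws → Induced x ws y → Any.Any (u ~_) (x ∷ ws) →
      ∃ λ ws′ → Induced u ws′ y × (∀ {w} → w ∈ ws′ → w ∈ x ∷ ws)
    go {x} u∉ (edge x~y) (here u~x) = x ∷ [] , head-case u∉ (edge x~y) u~x (λ ()) , id
    go {x} {w ∷ ws} u∉ p@(step _ _ _ q) near with Any.any? (u ~?_) (w ∷ ws) | near
    ... | no none | here u~x   = x ∷ w ∷ ws , head-case u∉ p u~x none , id
    ... | no none | there some = contradiction some none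
    ... | yes some | _ with go (u∉ ∘ λ { (here e) → here e ; (there z∈) → there (there z∈) }) q some
    ...   | ws′ , r , sub = ws′ , r , there ∘ sub

  -- The cut is at the neighbour of `u` closest to `x` along the path. If `u` is adjacent to `x`,
  -- the cycle closed in this way has no chord at `u`.
  first-nbr : ∀ {x ws y} u → Induced x ws y →
    (All (λ z → ¬ u ~ z) ws × ¬ u ~ y) ⊎
    (∃₂ λ us v → Induced x us v × All (λ z → ¬ u ~ z) us × u ~ v × (∀ {w} → w ∈ us → w ∈ ws) × (v ≡ y ⊎ v ∈ ws))
  first-nbr {y = y} u (edge x~y) with u ~? y
  ... | yes u~y = inj₂ ([] , y , edge x~y , [] , u~y , (λ ()) , inj₁ refl)
  ... | no u≁y  = inj₁ ([] , u≁y)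
  first-nbr u (step {x} {w} {ws} x~w far far-y p) with u ~? w
  ... | yes u~w = inj₂ ([] , w , edge x~w , [] , u~w , (λ ()) , inj₂ (here refl))
  ... | no u≁w with first-nbr u p
  ...   | inj₁ (none , u≁y) = inj₁ (u≁w ∷ none , u≁y)
  ...   | inj₂ (us , v , q , none , u~v , sub , v-place) =
    inj₂ (w ∷ us , v , step x~w (All.tabulate (lookup far ∘ sub)) (far-v v-place) q , u≁w ∷ none , u~v
         , (λ { (here e) → here e ; (there z∈) → there (sub z∈) }) , place v-place)
    where
    far-v : v ≡ _ ⊎ v ∈ ws → Far x v
    far-v (inj₁ refl) = far-y
    far-v (inj₂ v∈)   = lookup far v∈
    place : v ≡ _ ⊎ v ∈ ws → v ≡ _ ⊎ v ∈ w ∷ ws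
    place (inj₁ e)  = inj₁ e
    place (inj₂ v∈) = inj₂ (there v∈)

  -- When exactly `U` and the duplicate-free list `vs` are blank, this says that `w` has two blank
  -- neighbours.
  Balanced : VertexSet → List (Fin n) → Fin n → Set
  Balanced U vs w = outside U w + nbrsIn w vs ≡ 2

  Avoids : VertexSet → List (Fin n) → Set
  Avoids U = All (λ v → U v ≡ false)

  record Cycle (U : VertexSet) : Set where
    field
      {z u x}  : Fin n
      {ws}     : List (Fin n)
      walk     : Walk z (u ∷ x ∷ ws) z
      unique   : Unique (z ∷ u ∷ x ∷ ws)
      avoids   : Avoids U (z ∷ u ∷ x ∷ ws)
      balanced : All (Balanced U (z ∷ u ∷ x ∷ ws)) (z ∷ u ∷ x ∷ ws)

  -- By balancedness, the second uncoloured neighbour of w is either in U or z itself, so this covers both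
  -- paths joining two boundary vertices and cycles through exactly one boundary vertex.
  record Rooted (U : VertexSet) : Set where
    field
      {z w}    : Fin n
      {ws}     : List (Fin n)
      walk     : Walk w ws z
      unique   : Unique (z ∷ w ∷ ws)
      avoids   : Avoids U (z ∷ w ∷ ws)
      root     : outside U z ≡ 1
      balanced : All (Balanced U (z ∷ w ∷ ws)) (w ∷ ws)

  -- Search for a cycle or a rooted path

  module _ (U : VertexSet) (branching : ∀ v → U v ≡ false → 2 + outside U v ≤ deg v)
           (thin : ∀ v → U v ≡ false → outside U v ≤ 1) where

    -- The search starts at a vertex with a neighbour in `U` if there is one. Hence, whenever a
    -- second such vertex turns up, the root is one as well.
    Root : Fin n → Set
    Root y = outside U y ≡ 1 ⊎ (∀ v → U v ≡ false → outside U v ≡ 0)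

    private
      0or1 : ∀ v → U v ≡ false → outside U v ≡ 0 ⊎ outside U v ≡ 1
      0or1 v Uv with outside U v | thin v Uv
      ... | 0 | _ = inj₁ refl
      ... | 1 | _ = inj₂ refl
      ... | suc (suc _) | s≤s ()

      root-outside : ∀ {y u} → Root y → U u ≡ false → outside U u ≡ 1 → outside U y ≡ 1
      root-outside (inj₁ y≡1)  _  _   = y≡1
      root-outside (inj₂ none) Uu u≡1 with trans (sym u≡1) (none _ Uu)
      ... | ()

      balance : ∀ vs {w a b} → outside U w ≡ a → nbrsIn w vs ≡ b → a + b ≡ 2 → Balanced U vs w
      balance vs o≡ n≡ eq = trans (cong₂ _+_ o≡ n≡) eq

    rooted : ∀ {u ws y} → Induced u ws y → Avoids U (y ∷ u ∷ ws) → outside U u ≡ 1 → outside U y ≡ 1 →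
      All (λ v → outside U v ≡ 0) ws → Rooted U
    rooted {u} {ws} p avoids u≡1 y≡1 ws≡0 = record
      { walk     = induced⇒walk p
      ; unique   = induced⇒unique p
      ; avoids   = avoids
      ; root     = y≡1
      ; balanced = balance (_ ∷ u ∷ ws) u≡1 (PathDegrees.at-x pd) refl
                 ∷ All.zipWith (λ { (v≡0 , d) → balance (_ ∷ u ∷ ws) v≡0 d refl }) (ws≡0 , PathDegrees.at-ws pd)
      }
      where
      pd : PathDegrees u ws _
      pd = path-degrees p

    -- Only `v` may have a neighbour in `U`. If it has one, it becomes the root; otherwise the cycle
    -- is balanced everywhere.
    close : ∀ {u x us v} → Induced x us v → u ~ x → u ~ v → All (Far u) us → u ≢ x → u ≢ v →
      Avoids U (v ∷ u ∷ x ∷ us) → All (λ w → outside U w ≡ 0) (u ∷ x ∷ us) → Cycle U ⊎ Rooted U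
    close {u} {x} {us} {v} p u~x u~v far u≢x u≢v avoids@(Uv ∷ _) outside≡0 = by-cases (0or1 v Uv)
      where
      S : List (Fin n)
      S = v ∷ u ∷ x ∷ us
      unique : Unique S
      unique with induced⇒unique p
      ... | v≢ ∷ uniq-x = ((u≢v ∘ sym) ∷ v≢) ∷ (u≢x ∷ All.map proj₂ far) ∷ uniq-x
      walk : Walk u (x ∷ us) v
      walk = step u~x (induced⇒walk p)
      balanced : All (Balanced U S) (u ∷ x ∷ us)
      balanced = All.zipWith (λ { (w≡0 , d) → balance S w≡0 d refl }) (outside≡0 , All.tail (cycle-degrees p u~x u~v far))
      by-cases : outside U v ≡ 0 ⊎ outside U v ≡ 1 → Cycle U ⊎ Rooted U
      by-cases (inj₁ v≡0) = inj₁ (record { walk = step (~-sym u~v) walk ; unique = unique ; avoids = avoids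
                                         ; balanced = balance S v≡0 (All.head (cycle-degrees p u~x u~v far)) refl ∷ balanced })
      by-cases (inj₂ v≡1) = inj₂ (record { walk = walk ; unique = unique ; avoids = avoids
                                         ; root = v≡1 ; balanced = balanced })

    -- The next vertex `u` touches `U`, which gives a path between two boundary vertices, or sees an
    -- earlier vertex of the path, which closes a cycle, or lengthens the path. `W` lies within `U`
    -- and the path and supplies the termination measure.
    grow : ∀ {x ws y} W → Acc _<_ (remaining W) → (∀ t → W t ≡ true → U t ≡ true ⊎ t ∈ y ∷ x ∷ ws) →
      Induced x ws y → Avoids U (y ∷ x ∷ ws) → All (λ v → outside U v ≡ 0) (x ∷ ws) → Root y → Cycle U ⊎ Rooted U
    grow {x} {ws} {y} W (acc rs) W⊆ p avoids@(Uy ∷ Ux ∷ Uws) outside≡0 rooty = extend (inner-nbr U x (previous p) (branching x Ux))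
      where
      previous : ∀ {x ws} → Induced x ws y → Fin n
      previous (edge _)               = y
      previous (step {w = w} _ _ _ _) = w
      new : ∀ {x ws u} (p : Induced x ws y) → x ~ u → u ≢ previous p → u ∉ y ∷ x ∷ ws
      new p x~u u≢prev (there (here refl)) = ~-irrefl _ x~u
      new (edge _) x~u u≢prev (here refl) = u≢prev refl
      new (step _ _ far-y _) x~u u≢prev (here refl) = proj₁ far-y x~u
      new (step _ _ _ _) x~u u≢prev (there (there (here refl))) = u≢prev refl
      new (step _ far _ _) x~u u≢prev (there (there (there u∈))) = proj₁ (lookup far u∈) x~u
      extend : (∃ λ u → x ~ u × U u ≡ false × u ≢ previous p) → Cycle U ⊎ Rooted U
      extend (u , x~u , Uu , u≢prev) with new p x~u u≢prev | 0or1 u Uu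
      ... | u∉ | inj₂ u≡1 = inj₂ (boundary (shorten u∉ p (here (~-sym x~u))))
        where
        boundary : (∃ λ ws′ → Induced u ws′ y × (∀ {w} → w ∈ ws′ → w ∈ x ∷ ws)) → Rooted U
        boundary (ws′ , q , sub) = rooted q (Uy ∷ Uu ∷ All.tabulate (λ w∈ → lookup (Ux ∷ Uws) (sub w∈))) u≡1
          (root-outside rooty Uu u≡1) (All.tabulate (λ w∈ → lookup outside≡0 (sub w∈)))
      ... | u∉ | inj₁ u≡0 = by-first (first-nbr u p)
        where
        far-from : ∀ {zs} → (∀ {w} → w ∈ zs → w ∈ ws) → All (λ z → ¬ u ~ z) zs → All (Far u) zs
        far-from sub none = All.tabulate (λ { {w} w∈ → lookup none w∈ , λ { refl → u∉ (there (there (sub w∈))) } })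
        by-first : _ → Cycle U ⊎ Rooted U
        by-first (inj₁ (none , u≁y)) = grow (add u W) (rs (remaining-addAll W u [] Wu)) W′⊆
          (step (~-sym x~u) (far-from id none) (u≁y , λ { refl → u∉ (here refl) }) p)
          (Uy ∷ Uu ∷ Ux ∷ Uws) (u≡0 ∷ outside≡0) rooty
          where
          Wu : W u ≡ false
          Wu with W u in eq
          ... | false = refl
          ... | true with W⊆ u eq
          ...   | inj₁ Uu′ with trans (sym Uu′) Uu
          ...     | ()
          Wu | true | inj₂ u∈ = contradiction u∈ u∉
          W′⊆ : ∀ t → add u W t ≡ true → U t ≡ true ⊎ t ∈ y ∷ u ∷ x ∷ ws
          W′⊆ t eq with u ≟ t
          ... | yes refl = inj₂ (there (here refl))
          ... | no u≢t with W⊆ t (trans (sym (add-other W u≢t)) eq)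
          ...   | inj₁ Ut = inj₁ Ut
          ...   | inj₂ (here e)   = inj₂ (here e)
          ...   | inj₂ (there t∈) = inj₂ (there (there t∈))
        by-first (inj₂ (us , v , q , none , u~v , sub , v-place)) =
          close q (~-sym x~u) u~v (far-from sub none) (λ { refl → u∉ (there (here refl)) })
            (λ { refl → ~-irrefl _ u~v }) (Uv v-place ∷ Uu ∷ Ux ∷ All.tabulate (λ w∈ → lookup Uws (sub w∈)))
            (u≡0 ∷ All.head outside≡0 ∷ All.tabulate (λ w∈ → lookup (All.tail outside≡0) (sub w∈)))
          where
          Uv : v ≡ y ⊎ v ∈ ws → U v ≡ false
          Uv (inj₁ refl) = Uy
          Uv (inj₂ v∈)   = lookup Uws v∈

    start : ∀ y → U y ≡ false → Root y → Cycle U ⊎ Rooted U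
    start y Uy rooty with inner-nbr U y y (branching y Uy)
    ... | u , y~u , Uu , _ with 0or1 u Uu
    ...   | inj₂ u≡1 = inj₂ (rooted (edge (~-sym y~u)) (Uy ∷ Uu ∷ []) u≡1 (root-outside rooty Uu u≡1) [])
    ...   | inj₁ u≡0 = grow (addAll (y ∷ u ∷ []) U) (<-wellFounded _) W⊆ (edge (~-sym y~u)) (Uy ∷ Uu ∷ []) (u≡0 ∷ []) rooty
      where
      W⊆ : ∀ t → addAll (y ∷ u ∷ []) U t ≡ true → U t ≡ true ⊎ t ∈ y ∷ u ∷ []
      W⊆ t eq with t ∈? (y ∷ u ∷ [])
      ... | yes t∈ = inj₂ t∈
      ... | no t∉  = inj₁ (trans (sym (addAll-∉ (y ∷ u ∷ []) U t∉)) eq)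

    cycle-or-rooted : ∀ v → U v ≡ false → Cycle U ⊎ Rooted U
    cycle-or-rooted v Uv with any? (λ y → (U y ≟ᵇ false) ×-dec (outside U y ≟ⁿ 1))
    ... | yes (y , Uy , y≡1) = start y Uy (inj₁ y≡1)
    ... | no none = start v Uv (inj₂ λ y Uy → [ id , (λ y≡1 → contradiction (y , Uy , y≡1) none) ]′ (0or1 y Uy))

  outside-addAll : ∀ {U vs} → Unique vs → Avoids U vs → ∀ w → outside (addAll vs U) w ≡ outside U w + nbrsIn w vs
  outside-addAll [] [] w = sym (+-identityʳ _)
  outside-addAll {U} {v ∷ vs} (v≢ ∷ uniq-vs) (Uv ∷ avoids) w = begin
    outside (add v (addAll vs U)) w         ≡⟨ outside-add (addAll vs U) w (trans (addAll-∉ vs U (λ v∈ → lookup v≢ v∈ refl)) Uv) ⟩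
    outside (addAll vs U) w + A w v         ≡⟨ cong (_+ A w v) (outside-addAll uniq-vs avoids w) ⟩
    outside U w + nbrsIn w vs + A w v       ≡⟨ regroup (outside U w) (nbrsIn w vs) (A w v) ⟩
    outside U w + (A w v + nbrsIn w vs)     ∎
    where
    open ≡-Reasoning
    regroup : ∀ a b c → a + b + c ≡ a + (c + b)
    regroup = solve-∀

  free-⊑ : ∀ {c c′} → c ⊑ c′ → ∀ x → free c′ x ≤ free c x
  free-⊑ {c} {c′} p x = sum-mono (λ u → *-monoʳ-≤ (A x u) (pointwise u))
    where
    pointwise : ∀ u → blank (c′ u) ≤ blank (c u)
    pointwise u with p u
    ... | inj₁ cu   = ≤-trans (blank≤1 (c′ u)) (≤-reflexive (sym (cong blank cu)))
      where
      blank≤1 : ∀ (m : Maybe (Fin k)) → blank m ≤ 1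
      blank≤1 nothing  = ≤-refl
      blank≤1 (just _) = z≤n
    ... | inj₂ same = ≤-reflexive (cong blank same)

  free-drops : ∀ (c : Partial) {v} → c v ≡ nothing → ∀ a {x f} → x ~ v → free c x ≤ suc f → free (c [ v ↦ a ]) x ≤ f
  free-drops c cv a x~v le = ≤-trans (≤-reflexive (free-update-adj c cv a x~v)) (pred-mono-≤ le)

  -- Without repetitions `uniq = total ≥ D - f`, so `uniq + total ≥ 2D - 2f ≥ D + h`.
  rep-or-rich : ∀ (c : Partial) {x} f → h + (f + f) ≤ D → deg x ≡ D → free c x ≤ f → 1 ≤ rep (cnt c x) ⊎ Rich c x
  rep-or-rich c {x} f room deg≡ few with rep (cnt c x) in eq
  ... | suc _ = inj₁ (s≤s z≤n)
  ... | zero  = inj₂ (subst (λ u → D + h ≤ u + t) (sym (rep≡0⇒uniq≡total (cnt c x) eq))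
      (linear (D + h) (t + t) 0 (+-mono-≤ room (+-mono-≤ D≤ D≤)) (regroup h f D t)))
    where
    t : ℕ
    t = total (cnt c x)
    D≤ : D ≤ t + f
    D≤ = ≤-trans (≤-reflexive (trans (sym deg≡) (sym (total+free≡deg c x)))) (+-monoʳ-≤ t few)
    regroup : ∀ h f D t → D + h + (D + (t + f + (t + f))) + 0 ≡ t + t + (h + (f + f) + (D + D))
    regroup = solve-∀

  last-nbr : ∀ {w ws z} → Walk w ws z → ∃ λ ℓ → ℓ ∈ w ∷ ws × ℓ ~ z
  last-nbr (edge w~z)   = _ , here refl , w~z
  last-nbr (step _ p) with last-nbr p
  ... | ℓ , ℓ∈ , ℓ~z = ℓ , there ℓ∈ , ℓ~z

  colour-fresh : ∀ {c v} → Good c → c v ≡ nothing → ∀ x → 2 + total (cnt c x) ≤ gain c v →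
    ∃ λ a → cnt c x a ≡ 0 × Good (c [ v ↦ a ])
  colour-fresh {c} {v} good cv x le = colour-avoiding good cv (cnt c x) (≤-trans le (m≤n+m (gain c v) (rep (cnt c v))))

  fill-step-fresh : ∀ {c v vs} x → (∃ λ a → cnt c x a ≡ 0 × Good (c [ v ↦ a ])) →
    (∀ a → cnt c x a ≡ 0 → Good (c [ v ↦ a ]) → Fill (c [ v ↦ a ]) vs) → Fill c (v ∷ vs)
  fill-step-fresh x (a , fresh , good) rest = fill-∷ a (rest a fresh good)

  module _ {c : Partial} (good : Good c) {u z w : Fin n} (cu : c u ≡ nothing) (cz : c z ≡ nothing)
           (u~z : u ~ z) (w~z : w ~ z) (w≢u : w ≢ u) (rich-z : Rich c z) where

    -- `z` goes first, paid by `w` and the blank `u`; then the repetition at `u` and the rich `z`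
    -- pay for `u`.
    last-edge-rep : Slack c w → 1 ≤ rep (cnt c u) → Fill c (u ∷ z ∷ [])
    last-edge-rep slack-w rep-u = fill-swap (fill-step
      (colour-two good cz w≢u (~-sym w~z) (~-sym u~z) (σ-slack≥1 c slack-w) (σ-blank c cu))
      λ a good₁ → let c₁u = still-blank c a (~⇒≢ (~-sym u~z)) cu in fill-one
      (colour-rep good₁ c₁u (≤-trans rep-u (rep-⊑ (⊑-update c a cz) u)) u~z
        (σ-slack≥1 _ (rich⇒slack good₁ (~-sym u~z) c₁u (Rich-⊑ (⊑-update c a cz) rich-z)))))

    -- Here the blank and slack `z` pays for `u` by itself, after which `w` and `u` block nothing
    -- for `z`.
    last-edge-rich : Rich c w → Rich c u → Fill c (u ∷ z ∷ [])
    last-edge-rich rich-w rich-u = fill-step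
      (colour-one good cu u~z (≤-trans (s≤s 1≤h) (σ-blank-slack c cz (rich⇒slack good (~-sym u~z) cu rich-z))))
      λ a good₁ → let c₁z = still-blank c a (~⇒≢ u~z) cz in fill-one
      (colour-two good₁ c₁z w≢u (~-sym w~z) (~-sym u~z)
        (σ-slack≥1 _ (rich⇒slack good₁ w~z c₁z (Rich-⊑ (⊑-update c a cu) rich-w)))
        (σ-slack≥1 _ (rich⇒slack good₁ u~z c₁z (Rich-⊑ (⊑-update c a cu) rich-u))))

  -- Cycles when D = g + 3: a vertex with exactly two uncoloured neighbours sees g + 1 distinct colours.
  module Tight (D≡ : 3 + g ≡ D) where

    -- The potential of `Rich` at a lower level: two blank neighbours give `total ≤ g + 1`, which
    -- forces `uniq ≥ g + 1`.
    Base : Partial → Fin n → Set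
    Base c x = suc g + suc g ≤ uniq (cnt c x) + total (cnt c x)

    Base-⊑ : ∀ {c c′} → c ⊑ c′ → ∀ {x} → Base c x → Base c′ x
    Base-⊑ p {x} base = ≤-trans base (uniq+total-mono (cnt-⊑ p x))

    h+2≤D : h + 2 ≤ D
    h+2≤D = subst (h + 2 ≤_) D≡ (≤-trans (+-monoˡ-≤ 2 h≤1+g) (≤-reflexive (+-comm (suc g) 2)))

    total≤1+g : ∀ (c : Partial) {x} → 2 ≤ free c x → total (cnt c x) ≤ suc g
    total≤1+g c {x} 2≤f = +-cancelʳ-≤ 2 (total (cnt c x)) (suc g) (begin
      total (cnt c x) + 2         ≤⟨ +-monoʳ-≤ (total (cnt c x)) 2≤f ⟩
      total (cnt c x) + free c x  ≡⟨ total+free≡deg c x ⟩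
      deg x                       ≤⟨ deg≤D x ⟩
      D                           ≡⟨ D≡ ⟨
      2 + suc g                   ≡⟨ +-comm 2 (suc g) ⟩
      suc g + 2                   ∎)
      where open ≤-Reasoning

    -- Among `g + 1` occurrences the demand `g` leaves at most one that is not unique, and exactly
    -- one is impossible.
    base : ∀ {c x} → Good c → deg x ≡ D → free c x ≡ 2 → Base c x
    base {c} {x} good deg≡ free≡ = ≤-reflexive (sym (cong₂ _+_ (trans uniq≡total total≡) total≡))
      where
      total≡ : total (cnt c x) ≡ suc g
      total≡ = +-cancelʳ-≡ 2 (total (cnt c x)) (suc g) (trans (cong (total (cnt c x) +_) (sym free≡))
        (trans (total+free≡deg c x) (trans deg≡ (trans (sym D≡) (+-comm 2 (suc g))))))
      g≤uniq : g ≤ uniq (cnt c x)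
      g≤uniq = ≤-trans (≤-reflexive (sym (trans (cong₂ need free≡ total≡) (m≥n⇒m⊓n≡n (n≤1+n g))))) (okAt good x)
      uniq≡total : uniq (cnt c x) ≡ total (cnt c x)
      uniq≡total = total≤1+uniq⇒uniq≡total (cnt c x) (subst (_≤ suc (uniq (cnt c x))) (sym total≡) (s≤s g≤uniq))

    module _ {c : Partial} (good : Good c) {x u w : Fin n} (u≢w : u ≢ w) (x~u : x ~ u) (cu : c u ≡ nothing)
             (x~w : x ~ w) (cw : c w ≡ nothing) (base-x : Base c x) where

      -- After the next neighbour is coloured another one is still blank, so the demand remains `g`.
      base-slack : Slack c x
      base-slack = slack-g good u≢w x~u cu x~w cw (+-cancelʳ-≤ (suc g) (suc g) _ (≤-trans base-x
        (+-monoʳ-≤ (uniq (cnt c x)) (total≤1+g c (two-blank-nbrs≤free c u≢w x~u cu x~w cw)))))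

    -- A fresh colour raises the potential by two, to 2g + 4 = D + (g + 1).
    base-fresh⇒rich : ∀ (c : Partial) {v} (cv : c v ≡ nothing) a {x} → x ~ v → Base c x → cnt c x a ≡ 0 → Rich (c [ v ↦ a ]) x
    base-fresh⇒rich c {v} cv a {x} x~v base-x fresh = begin
      D + h                                          ≤⟨ +-monoʳ-≤ D h≤1+g ⟩
      D + suc g                                      ≡⟨ cong (_+ suc g) (sym D≡) ⟩
      3 + g + suc g                                  ≡⟨ regroup g ⟩
      2 + (suc g + suc g)                            ≤⟨ s≤s (s≤s base-x) ⟩
      2 + (uniq (cnt c x) + total (cnt c x))         ≡⟨ cong suc (+-suc (uniq (cnt c x)) (total (cnt c x))) ⟨
      suc (uniq (cnt c x)) + suc (total (cnt c x))   ≡⟨ cong₂ _+_ (uniq-fresh c cv a x~v fresh) (total-adj c cv a x~v) ⟨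
      uniq (cnt (c [ v ↦ a ]) x) + total (cnt (c [ v ↦ a ]) x) ∎
      where
      open ≤-Reasoning
      regroup : ∀ g → 3 + g + suc g ≡ 2 + (suc g + suc g)
      regroup = solve-∀

    -- The blank vertex ahead is slack and pays for each step by itself. Only the last edge has none
    -- ahead; there the rich `z` and its rich neighbour `v` off the walk take over.
    run : ∀ {c w ws z v} → Good c → Walk w ws z → Unique (z ∷ w ∷ ws) → c z ≡ nothing → All (λ x → c x ≡ nothing) (w ∷ ws) →
      All (λ x → Base c x × free c x ≤ 2 × deg x ≡ D) ws → free c w ≤ 1 → deg w ≡ D →
      Rich c z → Rich c v → v ~ z → All (v ≢_) (w ∷ ws) → Fill c (w ∷ ws ++ z ∷ [])
    run {c} {w} good (edge w~z) _ cz (cw ∷ []) [] few deg≡ rich-z rich-v v~z (v≢w ∷ [])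
      = [ last-edge-rep good cw cz w~z v~z v≢w rich-z (rich⇒slack good v~z cz rich-v)
        , last-edge-rich good cw cz w~z v~z v≢w rich-z rich-v ]′ (rep-or-rich c 1 h+2≤D deg≡ few)
    run {c} {w} {x ∷ ws} {z} good (step w~x p) ((z≢w ∷ z≢) ∷ (w≢ ∷ uniq-x)) cz (cw ∷ cx ∷ cws) ((base-x , few-x , deg-x) ∷ rest)
        few deg≡ rich-z rich-v v~z (v≢w ∷ v≢) = fill-step
      (colour-one good cw w~x (≤-trans (s≤s 1≤h) (σ-blank-slack c cx (slack-x p z≢w w≢ cws))))
      λ a good₁ → run good₁ p (z≢ ∷ uniq-x) (still-blank c a (z≢w ∘ sym) cz)
        (All.zipWith (λ (w≢y , cy) → still-blank c a w≢y cy) (w≢ , cx ∷ cws))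
        (All.map (λ (b , f , d) → Base-⊑ (⊑-update c a cw) b , ≤-trans (free-⊑ (⊑-update c a cw) _) f , d) rest)
        (free-drops c cw a (~-sym w~x) few-x) deg-x (Rich-⊑ (⊑-update c a cw) rich-z) (Rich-⊑ (⊑-update c a cw) rich-v) v~z v≢
      where
      slack-x : ∀ {ws} → Walk x ws z → z ≢ w → All (w ≢_) (x ∷ ws) → All (λ y → c y ≡ nothing) ws → Slack c x
      slack-x (edge x~z)   z≢w w≢ cws = base-slack good (z≢w ∘ sym) (~-sym w~x) cw x~z cz base-x
      slack-x (step x~y _) z≢w (_ ∷ w≢y ∷ _) (cy ∷ _) = base-slack good w≢y (~-sym w~x) cw x~y cy base-x

    module _ (g+2≤2h : 2 + g ≤ h + h) where

      -- Budget for `u`: two blank slack neighbours save `h + 1` each, against 2 and the at most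
      -- `g + 1` colours to be avoided.
      enough₁ : 2 + suc g ≤ suc h + suc h
      enough₁ = begin
        3 + g              ≤⟨ +-monoʳ-≤ 3 g≤h ⟩
        3 + h              ≡⟨ cong (λ x → 2 + x) (+-comm 1 h) ⟩
        2 + (h + 1)        ≤⟨ +-monoʳ-≤ 2 (+-monoʳ-≤ h 1≤h) ⟩
        2 + (h + h)        ≡⟨ cong suc (+-suc h h) ⟨
        suc h + suc h      ∎
        where open ≤-Reasoning

      -- Budget for `x`: `u` is coloured by now and saves only `h`.
      enough₂ : 2 + suc g ≤ h + suc h
      enough₂ = ≤-trans (s≤s g+2≤2h) (≤-reflexive (sym (+-suc h h)))

      fill-cycle : ∀ {c z u x ws} → Good c → Walk z (u ∷ x ∷ ws) z → Unique (z ∷ u ∷ x ∷ ws) →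
        All (λ w → c w ≡ nothing) (z ∷ u ∷ x ∷ ws) → All (λ w → free c w ≡ 2) (z ∷ u ∷ x ∷ ws) →
        All (λ w → deg w ≡ D) (z ∷ u ∷ x ∷ ws) → Fill c (u ∷ x ∷ ws ++ z ∷ [])
      fill-cycle {c} {z} {u} {x} {ws} good (step z~u (step u~x p)) ((z≢u ∷ z≢x ∷ z≢ws) ∷ ((u≢x ∷ u≢ws) ∷ uniq-x))
        (cz ∷ cu ∷ cx ∷ cws) (free-z ∷ free-u ∷ free-x ∷ free-ws) (deg-z ∷ deg-u ∷ deg-x ∷ deg-ws) =
        fill-step-fresh z (colour-fresh good cu z surplus₁) after-u
        where
        last : ∃ λ ℓ → ℓ ∈ x ∷ ws × ℓ ~ z
        last = last-nbr p
        base-z : Base c z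
        base-z = base good deg-z free-z
        base-u : Base c u
        base-u = base good deg-u free-u
        base-x : Base c x
        base-x = base good deg-x free-x
        slack-z : Slack c z
        slack-z with last
        ... | ℓ , ℓ∈ , ℓ~z = base-slack good (lookup (u≢x ∷ u≢ws) ℓ∈) z~u cu (~-sym ℓ~z) (lookup (cx ∷ cws) ℓ∈) base-z
        slack-x : ∀ {ws} → Walk x ws z → All (u ≢_) ws → All (λ w → c w ≡ nothing) ws → Slack c x
        slack-x (edge x~z) _ _ = base-slack good (z≢u ∘ sym) (~-sym u~x) cu x~z cz base-x
        slack-x (step x~y _) (u≢y ∷ _) (cy ∷ _) = base-slack good u≢y (~-sym u~x) cu x~y cy base-x
        surplus₁ : 2 + total (cnt c z) ≤ gain c u
        surplus₁ = ≤-trans (+-monoʳ-≤ 2 (total≤1+g c (≤-reflexive (sym free-z)))) (≤-trans enough₁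
          (≤-trans (+-mono-≤ (σ-blank-slack c cz slack-z) (σ-blank-slack c cx (slack-x p u≢ws cws)))
            (σ+σ≤gain c z≢x (~-sym z~u) u~x)))
        after-u : ∀ a → cnt c z a ≡ 0 → Good (c [ u ↦ a ]) → Fill (c [ u ↦ a ]) (x ∷ ws ++ z ∷ [])
        after-u a fresh good₁ = continue p u≢ws z≢ws cws free-ws deg-ws uniq-x
          where
          c₁ : Partial
          c₁ = c [ u ↦ a ]
          ext₁ : c ⊑ c₁
          ext₁ = ⊑-update c a cu
          rich-z : Rich c₁ z
          rich-z = base-fresh⇒rich c cu a z~u base-z fresh
          c₁z : c₁ z ≡ nothing
          c₁z = still-blank c a (z≢u ∘ sym) cz
          c₁x : c₁ x ≡ nothing
          c₁x = still-blank c a u≢x cx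
          base-u₁ : Base c₁ u
          base-u₁ = Base-⊑ ext₁ base-u
          slack-u₁ : Slack c₁ u
          slack-u₁ = base-slack good₁ (z≢x ∘ sym) u~x c₁x (~-sym z~u) c₁z base-u₁
          few-u₁ : 2 + total (cnt c₁ u) ≤ 2 + suc g
          few-u₁ = +-monoʳ-≤ 2 (total≤1+g c₁ (two-blank-nbrs≤free c₁ (z≢x ∘ sym) u~x c₁x (~-sym z~u) c₁z))
          few-x₁ : free c₁ x ≤ 1
          few-x₁ = free-drops c cu a (~-sym u~x) (≤-reflexive free-x)
          continue : ∀ {ws} → Walk x ws z → All (u ≢_) ws → All (z ≢_) ws → All (λ w → c w ≡ nothing) ws →
            All (λ w → free c w ≡ 2) ws → All (λ w → deg w ≡ D) ws → Unique (x ∷ ws) → Fill c₁ (x ∷ ws ++ z ∷ [])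
          -- A triangle: the vertex ahead of `x` is `z` itself. If `x` is rich, `z` plays the part
          -- of the blank slack neighbour.
          continue (edge x~z) _ _ _ _ _ _ =
            [ last-edge-rep good₁ c₁x c₁z x~z (~-sym z~u) u≢x rich-z slack-u₁ , (λ rich-x → fill-step-fresh u (colour-fresh good₁ c₁x u (≤-trans few-u₁ (≤-trans enough₂ (≤-trans
                (+-mono-≤ (σ-slack c₁ slack-u₁) (σ-blank-slack c₁ c₁z (rich⇒slack good₁ (~-sym x~z) c₁x rich-z)))
                (σ+σ≤gain c₁ (z≢u ∘ sym) (~-sym u~x) x~z)))))
              λ b fresh-u good₂ → let c₂z = still-blank c₁ b (z≢x ∘ sym) c₁z in fill-one
              (colour-two good₂ c₂z u≢x z~u (~-sym x~z)
                (σ-slack≥1 _ (rich⇒slack good₂ (~-sym z~u) c₂z (base-fresh⇒rich c₁ c₁x b u~x base-u₁ fresh-u)))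
                (σ-slack≥1 _ (rich⇒slack good₂ x~z c₂z (Rich-⊑ (⊑-update c₁ b c₁x) rich-x))))) ]′
            (rep-or-rich c₁ 1 h+2≤D deg-x few-x₁)
          continue {y ∷ ws} (step x~y p) (u≢y ∷ u≢ws) (z≢y ∷ z≢ws) (cy ∷ cws) (free-y ∷ free-ws) (deg-y ∷ deg-ws) ((x≢y ∷ x≢ws) ∷ uniq-y) =
            fill-step-fresh u (colour-fresh good₁ c₁x u (≤-trans few-u₁ (≤-trans enough₂ (≤-trans
                (+-mono-≤ (σ-slack c₁ slack-u₁) (σ-blank-slack c₁ c₁y (slack-y p x≢ws (cws₁ u≢ws cws))))
                (σ+σ≤gain c₁ u≢y (~-sym u~x) x~y)))))
              λ b fresh-u good₂ → let ext₂ = ⊑-update c₁ b c₁x ; ext = ⊑-trans ext₁ ext₂ in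
              run good₂ p ((z≢y ∷ z≢ws) ∷ uniq-y) (still-blank c₁ b (z≢x ∘ sym) c₁z)
                (still-blank c₁ b x≢y c₁y ∷ All.zipWith (λ (x≢w , c₁w) → still-blank c₁ b x≢w c₁w) (x≢ws , cws₁ u≢ws cws))
                (All.zipWith (λ (f , d) → Base-⊑ ext (base good d f) , ≤-trans (free-⊑ ext _) (≤-reflexive f) , d) (free-ws , deg-ws))
                (free-drops c₁ c₁x b (~-sym x~y) (≤-trans (free-⊑ ext₁ y) (≤-reflexive free-y))) deg-y
                (Rich-⊑ ext₂ rich-z) (base-fresh⇒rich c₁ c₁x b u~x base-u₁ fresh-u) (~-sym z~u) (u≢y ∷ u≢ws)
            where
            c₁y : c₁ y ≡ nothing
            c₁y = still-blank c a u≢y cy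
            cws₁ : ∀ {ws} → All (u ≢_) ws → All (λ w → c w ≡ nothing) ws → All (λ w → c₁ w ≡ nothing) ws
            cws₁ u≢ cs = All.zipWith (λ (u≢w , cw) → still-blank c a u≢w cw) (u≢ , cs)
            base-y : Base c₁ y
            base-y = Base-⊑ ext₁ (base good deg-y free-y)
            slack-y : ∀ {ws} → Walk y ws z → All (x ≢_) ws → All (λ w → c₁ w ≡ nothing) ws → Slack c₁ y
            slack-y (edge y~z) _ _ = base-slack good₁ (z≢x ∘ sym) (~-sym x~y) c₁x y~z c₁z base-y
            slack-y (step y~w _) (x≢w ∷ _) (c₁w ∷ _) = base-slack good₁ x≢w (~-sym x~y) c₁x y~w c₁w base-y

  -- Sets without boundary and the cycles in their complement

  Closed : VertexSet → Set
  Closed U = ∀ {u v} → U u ≡ false → u ~ v → U v ≡ false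

  false≢true : ∀ {b} → b ≡ false → b ≢ true
  false≢true refl ()

  Boundary : VertexSet → Set
  Boundary U = ∃₂ λ w z → U w ≡ false × U z ≡ true × w ~ z

  closed-or-boundary : ∀ U → Closed U ⊎ Boundary U
  closed-or-boundary U with any? (λ w → any? (λ z → (U w ≟ᵇ false) ×-dec ((U z ≟ᵇ true) ×-dec (w ~? z))))
  ... | yes (w , z , found) = inj₂ (w , z , found)
  ... | no none = inj₁ closed
    where
    closed : Closed U
    closed {u} {v} Uu u~v with U v in Uv
    ... | false = refl
    ... | true  = contradiction (u , v , Uu , Uv , u~v) none

  closed⇒outside≡0 : ∀ {U} → Closed U → ∀ {w} → U w ≡ false → outside U w ≡ 0
  closed⇒outside≡0 {U} closed {w} Uw = sum-zero pointwise
    where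
    pointwise : ∀ y → A w y * ⟦ U y ⟧ ≡ 0
    pointwise y with w ~? y
    ... | yes w~y = trans (cong (λ b → A w y * ⟦ b ⟧) (closed Uw w~y)) (*-zeroʳ (A w y))
    ... | no w≁y  = cong (_* ⟦ U y ⟧) (A≡0 w≁y)

  nbrsIn≥1 : ∀ {w} vs → 1 ≤ nbrsIn w vs → ∃ λ v → v ∈ vs × w ~ v
  nbrsIn≥1 {w} (v ∷ vs) le with w ~? v
  ... | yes w~v = v , here refl , w~v
  ... | no w≁v with nbrsIn≥1 vs (subst (λ a → 1 ≤ a + nbrsIn w vs) (A≡0 w≁v) le)
  ...   | x , x∈ , w~x = x , there x∈ , w~x

  free≡ : ∀ {c U vs} → BlankOn c (addAll vs U) → Unique vs → Avoids U vs → ∀ w → free c w ≡ outside U w + nbrsIn w vs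
  free≡ blankOn unique avoids w = trans (free≡outside blankOn w) (outside-addAll unique avoids w)

  all-blank : ∀ {c U vs} → BlankOn c (addAll vs U) → All (λ v → c v ≡ nothing) vs
  all-blank {U = U} {vs} blankOn = All.tabulate (λ v∈ → blank-in blankOn (addAll-∈ {vs} U v∈))

  low? : ∀ (U : VertexSet) → Dec (∃ λ v → U v ≡ false × deg v < D)
  low? U = any? (λ v → (U v ≟ᵇ false) ×-dec (deg v <? D))

  all-full : ∀ {U : VertexSet} → ¬ (∃ λ v → U v ≡ false × deg v < D) → ∀ {v} → U v ≡ false → deg v ≡ D
  all-full none {v} Uv = ≤-antisym (deg≤D v) (≮⇒≥ (λ lt → none (v , Uv , lt)))

  -- Guarantees the invariant `Connected` of the case `D = h + 2` once `vs` has joined the blank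
  -- set.
  Paired : List (Fin n) → Set
  Paired vs = ∀ {s} → s ∈ vs → ∃ λ t → t ∈ vs × s ~ t

  module _ (D≡ : 3 + g ≡ D) {U : VertexSet} (closed : Closed U) (full : ∀ {v} → U v ≡ false → deg v ≡ D)
           (IH : ∀ v vs → Avoids U (v ∷ vs) → Paired (v ∷ vs) → Colourable (addAll (v ∷ vs) U)) where

    open Tight D≡

    closed⇒cycle : ∀ v → U v ≡ false → Cycle U
    closed⇒cycle v Uv = [ id , no-root ]′ (cycle-or-rooted U branching (λ v Uv → ≤-trans (≤-reflexive (none Uv)) z≤n) v Uv)
      where
      none : ∀ {w} → U w ≡ false → outside U w ≡ 0
      none = closed⇒outside≡0 closed
      branching : ∀ v → U v ≡ false → 2 + outside U v ≤ deg v
      branching v Uv = ≤-trans (≤-reflexive (cong (2 +_) (none Uv)))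
        (≤-trans (s≤s (s≤s z≤n)) (≤-reflexive (trans D≡ (sym (full Uv)))))
      no-root : Rooted U → Cycle U
      no-root r with trans (sym (Rooted.root r)) (none (All.head (Rooted.avoids r)))
      ... | ()

    colour-closed : 2 + g ≤ h + h → ∀ v → U v ≡ false → Colourable U
    colour-closed g+2≤2h v Uv = by-cycle (closed⇒cycle v Uv)
      where
      by-cycle : Cycle U → Colourable U
      by-cycle cyc = finish (IH z (u ∷ x ∷ ws) avoids paired)
        where
        open Cycle cyc
        S : List (Fin n)
        S = z ∷ u ∷ x ∷ ws
        nbrs≡2 : ∀ {w} → w ∈ S → nbrsIn w S ≡ 2
        nbrs≡2 {w} w∈ = trans (cong (_+ nbrsIn w S) (sym (closed⇒outside≡0 closed (lookup avoids w∈)))) (lookup balanced w∈)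
        paired : Paired S
        paired w∈ = nbrsIn≥1 S (≤-trans (s≤s z≤n) (≤-reflexive (sym (nbrs≡2 w∈))))
        finish : Colourable (addAll S U) → Colourable U
        finish (c , good , blankOn) = complete blankOn avoids (fill-↭ (↭-sym (∷↭∷ʳ z (u ∷ x ∷ ws)))
          (fill-cycle g+2≤2h good walk unique (all-blank {U = U} blankOn)
            (All.map (λ {w} b → trans (free≡ blankOn unique avoids w) b) balanced) (All.map full avoids)))

  colour-low-vertex : ∀ {U v} → U v ≡ false → deg v < D → Colourable (add v U) → Colourable U
  colour-low-vertex {U} {v} Uv low (c , good , blankOn) = complete {vs = v ∷ []} blankOn (Uv ∷ [])
    (fill-one (colour-low good (blank-in blankOn (add-self v U)) low))

  -- Maximum degree h + 2

  module Relaxed (D≡ : 3 + g ≡ D) (h≡ : suc g ≡ h) where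

    open Tight D≡

    -- Not connectivity of a graph: a blank vertex that has a neighbour outside `U` must also keep
    -- one inside, so that its demand stays at `h - 1` when the former is coloured.
    Connected : VertexSet → Set
    Connected U = ∀ {u w} → U u ≡ true → U w ≡ false → u ~ w → ∃ λ z → U z ≡ true × u ~ z

    -- With two blank neighbours `z` blocks at most `g = h - 1` colours, and being blank it has no
    -- own colour to forbid.
    σ≥2 : ∀ {c z} → Good c → c z ≡ nothing → 2 ≤ free c z → 2 ≤ σ c z
    σ≥2 {c} {z} good cz 2≤f = ≤-trans (s≤s (m<n⇒0<n∸m (≤-trans (s≤s
        (cost≤g (free c z) (cnt c z) (≤-trans (s≤s z≤n) 2≤f) (okAt good z) 2≤f)) (≤-reflexive h≡))))
      (≤-reflexive (cong (_+ (h ∸ costAt c z)) (sym (cong blank cz))))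

    closed⇒connected : ∀ {U vs} → Closed U → Avoids U vs → Paired vs → Connected (addAll vs U)
    closed⇒connected {U} {vs} closed avoids paired {u} {w} Uu Uw u~w with u ∈? vs
    ... | yes u∈ = let (t , t∈ , u~t) = paired u∈ in t , addAll-∈ {vs} U t∈ , u~t
    ... | no u∉  = contradiction (trans (sym (addAll-∉ vs U u∉)) Uu) (false≢true (closed outside-w (~-sym u~w)))
      where
      outside-w : U w ≡ false
      outside-w with U w in eq
      ... | false = refl
      ... | true  = contradiction (addAll-⊇ vs U eq) (false≢true Uw)

    -- By the invariant `z` has a second blank neighbour `t`, so `z` alone pays for `w`, which can
    -- be coloured last.
    colour-boundary : ∀ {U w z} → Connected U → U w ≡ false → U z ≡ true → w ~ z →
      (Connected (add w U) → Colourable (add w U)) → Colourable U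
    colour-boundary {U} {w} {z} connected Uw Uz w~z IH = finish (IH connected′) (connected Uz Uw (~-sym w~z))
      where
      connected′ : Connected (add w U)
      connected′ {u} {y} Wu Wy u~y with w ≟ u
      ... | yes refl = z , add-⊇ w U Uz , w~z
      ... | no w≢u with connected (trans (sym (add-other U w≢u)) Wu) (trans (sym (add-other U w≢y)) Wy) u~y
        where
        w≢y : w ≢ y
        w≢y refl = contradiction (add-self w U) (false≢true Wy)
      ...   | t , Ut , u~t = t , add-⊇ w U Ut , u~t
      finish : Colourable (add w U) → (∃ λ t → U t ≡ true × z ~ t) → Colourable U
      finish (c , good , blankOn) (t , Ut , z~t) = complete {vs = w ∷ []} blankOn (Uw ∷ [])
        (fill-one (colour-one good cw w~z (σ≥2 good (blank-in blankOn (add-⊇ w U Uz))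
          (two-blank-nbrs≤free c w≢t (~-sym w~z) cw z~t (blank-in blankOn (add-⊇ w U Ut))))))
        where
        cw : c w ≡ nothing
        cw = blank-in blankOn (add-self w U)
        w≢t : w ≢ t
        w≢t refl = false≢true Uw Ut

    -- The low `v` can always be coloured last and serves `w` as a blank neighbour until then. The
    -- order of `w` and `x` depends on whether `x` is low, adjacent to `v`, repeated or rich.
    fill-low-path : ∀ {c v w x} → Good c → c v ≡ nothing → c w ≡ nothing → c x ≡ nothing → v ~ w → w ~ x → v ≢ x →
      deg v < D → deg w ≡ D → free c w ≡ 2 → free c x ≡ A x v + 1 → Fill c (v ∷ w ∷ x ∷ [])
    fill-low-path {c} {v} {w} {x} good cv cw cx v~w w~x v≢x low deg-w free-w free-x =
      fill-↭ (↭-sym (∷↭∷ʳ v (w ∷ x ∷ []))) (by-cases (deg x <? D) (x ~? v))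
      where
      base-w : Base c w
      base-w = base good deg-w free-w
      slack-w : Slack c w
      slack-w = base-slack good v≢x (~-sym v~w) cv w~x cx base-w
      w-first : (∀ a → Good (c [ w ↦ a ]) → ∃ λ b → Good ((c [ w ↦ a ]) [ x ↦ b ])) → Fill c (w ∷ x ∷ v ∷ [])
      w-first colour-x = fill-step (colour-two good cw v≢x (~-sym v~w) w~x (σ-blank c cv) (σ-blank c cx))
        λ a good₁ → fill-step (colour-x a good₁)
        λ b good₂ → fill-one (colour-low good₂
          (still-blank (c [ w ↦ a ]) b (v≢x ∘ sym) (still-blank c a (~⇒≢ (~-sym v~w)) cv)) low)
      x-first : (∀ a → Good (c [ x ↦ a ]) → Slack (c [ x ↦ a ]) x) → Fill c (w ∷ x ∷ v ∷ [])
      x-first slack-x = fill-↭ (↭-swap x w ↭-refl) (fill-step (colour-one good cx (~-sym w~x)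
          (≤-trans (s≤s 1≤h) (σ-blank-slack c cw slack-w)))
        λ a good₁ → let c₁v = still-blank c a (v≢x ∘ sym) cv ; c₁w = still-blank c a (~⇒≢ (~-sym w~x)) cw in fill-step
          (colour-two good₁ c₁w v≢x (~-sym v~w) w~x (σ-blank _ c₁v) (σ-slack≥1 _ (slack-x a good₁)))
        λ b good₂ → fill-one (colour-low good₂ (still-blank (c [ x ↦ a ]) b (~⇒≢ (~-sym v~w)) c₁v) low))
      by-cases : Dec (deg x < D) → Dec (x ~ v) → Fill c (w ∷ x ∷ v ∷ [])
      by-cases (yes low-x) _ = w-first λ a good₁ → colour-low good₁ (still-blank c a (~⇒≢ w~x) cx) low-x
      by-cases (no ¬low) (yes x~v) = x-first λ a good₁ → base-slack good₁ (~⇒≢ v~w) x~v (still-blank c a (v≢x ∘ sym) cv)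
          (~-sym w~x) (still-blank c a (~⇒≢ (~-sym w~x)) cw) (Base-⊑ (⊑-update c a cx) base-x)
        where
        base-x : Base c x
        base-x = base good (≤-antisym (deg≤D x) (≮⇒≥ ¬low)) (trans free-x (cong (_+ 1) (A≡1 x~v)))
      by-cases (no ¬low) (no x≁v) = [ repeated , rich ]′ (rep-or-rich c 1 h+2≤D (≤-antisym (deg≤D x) (≮⇒≥ ¬low))
          (≤-reflexive (trans free-x (cong (_+ 1) (A≡0 x≁v)))))
        where
        repeated : 1 ≤ rep (cnt c x) → Fill c (w ∷ x ∷ v ∷ [])
        repeated rep-x = w-first λ a good₁ → let c₁v = still-blank c a (~⇒≢ (~-sym v~w)) cv ; c₁x = still-blank c a (~⇒≢ w~x) cx in
          colour-rep good₁ c₁x (≤-trans rep-x (rep-⊑ (⊑-update c a cw) x)) (~-sym w~x)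
            (σ-slack≥1 _ (base-slack good₁ v≢x (~-sym v~w) c₁v w~x c₁x (Base-⊑ (⊑-update c a cw) base-w)))
        rich : Rich c x → Fill c (w ∷ x ∷ v ∷ [])
        rich rich-x = x-first λ a good₁ → rich⇒slack good₁ (~-sym w~x) (still-blank c a (~⇒≢ (~-sym w~x)) cw)
          (Rich-⊑ (⊑-update c a cx) rich-x)

    reduce : ∀ U v → U v ≡ false → Connected U →
      (∀ v vs → U v ≡ false → Connected (addAll (v ∷ vs) U) → Colourable (addAll (v ∷ vs) U)) → Colourable U
    reduce U v₀ Uv₀ connected IH = [ closed-case , boundary ]′ (closed-or-boundary U)
      where
      boundary : Boundary U → Colourable U
      boundary (w , z , Uw , Uz , w~z) = colour-boundary connected Uw Uz w~z (IH w [] Uw)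
      closed-case : Closed U → Colourable U
      closed-case closed = by-low (low? U)
        where
        IH′ : ∀ v vs → Avoids U (v ∷ vs) → Paired (v ∷ vs) → Colourable (addAll (v ∷ vs) U)
        IH′ v vs avoids paired = IH v vs (All.head avoids) (closed⇒connected closed avoids paired)
        at-low : ∀ v → U v ≡ false → deg v < D → Dec (∃ λ w → v ~ w) → Colourable U
        at-low v Uv low (no isolated) = colour-low-vertex Uv low (IH v [] Uv connected′)
          where
          connected′ : Connected (add v U)
          connected′ {u} {w} Wu Ww u~w with v ≟ u
          ... | yes refl = contradiction (w , u~w) isolated
          ... | no v≢u = contradiction (trans (sym (add-other U v≢u)) Wu) (false≢true (closed outside-w (~-sym u~w)))
            where
            outside-w : U w ≡ false
            outside-w with U w in eq
            ... | false = refl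
            ... | true  = contradiction (add-⊇ v U eq) (false≢true Ww)
        -- Adding `v` alone would break `Connected`, as `w` would be a neighbour outside with none
        -- inside.
        at-low v Uv low (yes (w , v~w)) = by-degree (deg w <? D)
          where
          Uw : U w ≡ false
          Uw = closed Uv v~w
          by-degree : Dec (deg w < D) → Colourable U
          by-degree (yes low-w) = finish (IH′ v (w ∷ []) (Uv ∷ Uw ∷ [])
              (λ { (here refl) → w , there (here refl) , v~w ; (there (here refl)) → v , here refl , ~-sym v~w }))
            where
            finish : Colourable (addAll (v ∷ w ∷ []) U) → Colourable U
            finish (c , good , blankOn) with all-blank {U = U} {v ∷ w ∷ []} blankOn
            ... | cv ∷ cw ∷ [] = complete {vs = v ∷ w ∷ []} blankOn (Uv ∷ Uw ∷ []) (fill-step (colour-low good cv low)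
                    λ a good₁ → fill-one (colour-low good₁ (still-blank c a (~⇒≢ v~w) cw) low-w))
          -- For a full `w` the blank `v` is only guaranteed to save one colour. A second blank
          -- neighbour `x` makes `w` see `g + 1` distinct colours.
          by-degree (no ¬low) = with-third (inner-nbr U w v (≤-trans (≤-reflexive (cong (2 +_) (closed⇒outside≡0 closed Uw)))
              (≤-trans (s≤s (s≤s z≤n)) (≤-reflexive (trans D≡ (sym deg-w))))))
            where
            deg-w : deg w ≡ D
            deg-w = ≤-antisym (deg≤D w) (≮⇒≥ ¬low)
            with-third : (∃ λ x → w ~ x × U x ≡ false × x ≢ v) → Colourable U
            with-third (x , w~x , Ux , x≢v) = finish (IH′ v (w ∷ x ∷ []) avoids
                (λ { (here refl) → w , there (here refl) , v~w ; (there (here refl)) → v , here refl , ~-sym v~w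
                   ; (there (there (here refl))) → w , there (here refl) , ~-sym w~x }))
              where
              avoids : Avoids U (v ∷ w ∷ x ∷ [])
              avoids = Uv ∷ Uw ∷ Ux ∷ []
              unique : Unique (v ∷ w ∷ x ∷ [])
              unique = (~⇒≢ v~w ∷ (x≢v ∘ sym) ∷ []) ∷ (~⇒≢ w~x ∷ []) ∷ [] ∷ []
              finish : Colourable (addAll (v ∷ w ∷ x ∷ []) U) → Colourable U
              finish (c , good , blankOn) with all-blank {U = U} {v ∷ w ∷ x ∷ []} blankOn
              ... | cv ∷ cw ∷ cx ∷ [] = complete {vs = v ∷ w ∷ x ∷ []} blankOn avoids
                      (fill-low-path good cv cw cx v~w w~x (x≢v ∘ sym) low deg-w
                        (trans (free≡ blankOn unique avoids w) (cong₂ _+_ (closed⇒outside≡0 closed Uw)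
                          (cong₂ _+_ (A≡1 (~-sym v~w)) (cong₂ _+_ (A-diag w) (cong (_+ 0) (A≡1 w~x))))))
                        (trans (free≡ blankOn unique avoids x) (cong₂ _+_ (closed⇒outside≡0 closed Ux)
                          (cong (A x v +_) (cong₂ _+_ (A≡1 (~-sym w~x)) (cong (_+ 0) (A-diag x)))))))
        by-low : Dec (∃ λ v → U v ≡ false × deg v < D) → Colourable U
        by-low (yes (v , Uv , low)) = at-low v Uv low (any? (v ~?_))
        by-low (no none) = colour-closed D≡ closed (all-full {U} none) IH′ enough-colours v₀ Uv₀
          where
          enough-colours : 2 + g ≤ h + h
          enough-colours = subst (λ x → suc x ≤ h + h) (sym h≡) (+-monoˡ-≤ h 1≤h)

    colourable : Colourable (λ _ → false)
    colourable = colourable-by-induction Connected reduce (λ _ → false) (λ ())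

-- When D ≥ h + 4, a vertex with at most two uncoloured neighbours sees a repeated colour or is rich.
module Roomy {n : ℕ} {G : Graph n} {k h g D : ℕ} (setting : Colourings.Setting G k h g D) (room : h + 4 ≤ D) where

  open PartialColourings setting public

  -- Rich vertices first, then along the walk

  Unique-↭ : ∀ {vs ws : List (Fin n)} → vs ↭ ws → Unique vs → Unique ws
  Unique-↭ p = Permutation.Unique-resp-↭ (setoid (Fin n)) (↭⇒↭ₛ p)

  RichOnly : Partial → Partial → Set
  RichOnly c₀ c = ∀ x → c₀ x ≡ nothing → c x ≡ nothing ⊎ Rich c x

  -- A neighbour blank at the start of the phase is still blank or has become rich; either way it
  -- saves a colour.
  free≤gain-rich : ∀ {c₀ c v} → Good c → RichOnly c₀ c → c v ≡ nothing → free c₀ v ≤ gain c v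
  free≤gain-rich {c₀} {c} {v} good only cv = sum-mono pointwise
    where
    saves : ∀ x → v ~ x → blank (c₀ x) ≤ σ c x
    saves x v~x with c₀ x in c₀x
    ... | just _  = z≤n
    ... | nothing with only x c₀x
    ...   | inj₁ cx   = σ-blank c cx
    ...   | inj₂ rich = σ-slack≥1 c (rich⇒slack good (~-sym v~x) cv rich)
    pointwise : ∀ x → A v x * blank (c₀ x) ≤ A v x * σ c x
    pointwise x with v ~? x
    ... | yes v~x = *-monoʳ-≤ (A v x) (saves x v~x)
    ... | no v≁x  = ≤-reflexive (trans (cong (_* blank (c₀ x)) (A≡0 v≁x)) (sym (cong (_* σ c x) (A≡0 v≁x))))

  record RichPhase (c₀ c : Partial) (vs : List (Fin n)) : Set where
    field
      {c′}    : Partial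
      good    : Good c′
      extends : c ⊑ c′
      only    : RichOnly c₀ c′
      kept    : ∀ {u} → u ∉ vs → c′ u ≡ c u
      done    : ∀ {u} → u ∈ vs → Rich c u → c′ u ≢ nothing

  -- The two neighbours blank at the start pay for each rich vertex, whatever the order. Vertices
  -- rich at the outset all get coloured, so the blank ones left over in a cycle or rooted path have
  -- a repetition.
  rich-phase : ∀ {c₀} c vs → Good c → RichOnly c₀ c → All (λ v → 2 ≤ free c₀ v) vs → RichPhase c₀ c vs
  rich-phase c [] good only [] = record
    { good = good ; extends = λ u → inj₂ refl ; only = only ; kept = λ _ → refl ; done = λ () }
  rich-phase {c₀} c (v ∷ vs) good only (2≤free ∷ 2≤frees) = by-cases (c v) refl (D + h ≤? uniq (cnt c v) + total (cnt c v))
    where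
    skip : (Rich c v → c v ≢ nothing) → RichPhase c₀ c vs → RichPhase c₀ c (v ∷ vs)
    skip colouredv r = record
      { good = good′ ; extends = extends ; only = only′ ; kept = λ u∉ → kept (u∉ ∘ there)
      ; done = λ { (here refl) rich c′v → still rich (extends v) c′v ; (there u∈) → done u∈ } }
      where
      open RichPhase r renaming (good to good′; only to only′)
      still : Rich c v → c v ≡ nothing ⊎ c′ v ≡ c v → c′ v ≢ nothing
      still rich (inj₁ cv)   _   = colouredv rich cv
      still rich (inj₂ same) c′v = colouredv rich (trans (sym same) c′v)
    use : c v ≡ nothing → Rich c v → Extendable c v → RichPhase c₀ c (v ∷ vs)
    use cv rich (a , good₁) = record
      { good = good′ ; extends = ⊑-trans ext extends ; only = only′
      ; kept = λ u∉ → trans (kept (u∉ ∘ there)) (update-other c a (λ { refl → u∉ (here refl) }))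
      ; done = λ { (here refl) _ c′v → coloured (extends v) c′v ; (there u∈) rich-u → done u∈ (Rich-⊑ ext rich-u) } }
      where
      ext : c ⊑ (c [ v ↦ a ])
      ext = ⊑-update c a cv
      only₁ : RichOnly c₀ (c [ v ↦ a ])
      only₁ x c₀x with v ≟ x | only x c₀x
      ... | yes refl | _           = inj₂ (Rich-⊑ ext rich)
      ... | no v≢x   | inj₁ cx     = inj₁ (still-blank c a v≢x cx)
      ... | no _     | inj₂ rich-x = inj₂ (Rich-⊑ ext rich-x)
      open RichPhase (rich-phase (c [ v ↦ a ]) vs good₁ only₁ 2≤frees) renaming (good to good′; only to only′)
      coloured : (c [ v ↦ a ]) v ≡ nothing ⊎ c′ v ≡ (c [ v ↦ a ]) v → c′ v ≢ nothing
      coloured (inj₁ c₁v) _ with trans (sym c₁v) (update-self c v a)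
      ... | ()
      coloured (inj₂ same) c′v with trans (sym c′v) (trans same (update-self c v a))
      ... | ()
    by-cases : (m : Maybe (Fin k)) → c v ≡ m → Dec (Rich c v) → RichPhase c₀ c (v ∷ vs)
    by-cases (just _) cv _ = skip (λ _ cv′ → just≢nothing (trans (sym cv) cv′)) (rich-phase c vs good only 2≤frees)
      where
      just≢nothing : ∀ {a : Fin k} → just a ≢ nothing
      just≢nothing ()
    by-cases nothing cv (no ¬rich) = skip (λ rich → contradiction rich ¬rich) (rich-phase c vs good only 2≤frees)
    by-cases nothing cv (yes rich) = use cv rich (colour-gain good cv (≤-trans 2≤free (free≤gain-rich good only cv)))

  -- The two states after the rich phase; in either, the vertex saves a colour for a blank
  -- neighbour.
  Fine : Partial → Fin n → Set
  Fine c w = (c w ≡ nothing × 1 ≤ rep (cnt c w)) ⊎ (c w ≢ nothing × Rich c w)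

  fine-update : ∀ (c : Partial) {v} (cv : c v ≡ nothing) a {w} → v ≢ w → Fine c w → Fine (c [ v ↦ a ]) w
  fine-update c cv a {w} v≢w (inj₁ (cw , rep-w))  = inj₁ (still-blank c a v≢w cw , ≤-trans rep-w (rep-⊑ (⊑-update c a cv) w))
  fine-update c cv a {w} v≢w (inj₂ (cw , rich-w)) =
    inj₂ (cw ∘ trans (sym (update-other c a v≢w)) , Rich-⊑ (⊑-update c a cv) rich-w)

  fine-saves : ∀ {c v x} → Good c → v ~ x → c v ≡ nothing → Fine c x → 1 ≤ σ c x
  fine-saves {c} good v~x cv (inj₁ (cx , _))   = σ-blank c cx
  fine-saves {c} good v~x cv (inj₂ (_ , rich)) = σ-slack≥1 c (rich⇒slack good (~-sym v~x) cv rich)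

  -- A blank vertex is paid by its own repetition and by its successor, blank or rich. The last
  -- vertex has no successor on the walk, so it is left to `finish`; `P` carries what `finish`
  -- needs.
  walk-phase : ∀ (P : Partial → List (Fin n) → Set) {t E} →
    (∀ {c c′ w ws} → c ⊑ c′ → (∀ {u} → w ≢ u → c′ u ≡ c u) → c′ w ≢ nothing → P c (w ∷ ws) → P c′ ws) →
    (∀ {c w} → Good c → P c (w ∷ []) → Fine c w → w ~ t → Fill c (w ∷ E)) →
    ∀ {c w ws} → Good c → Walk w ws t → Unique (w ∷ ws) → All (Fine c) (w ∷ ws) → P c (w ∷ ws) → Fill c (w ∷ ws ++ E)
  walk-phase P next finish good (edge w~t) _ (fine ∷ []) Pc = finish good Pc fine w~t
  walk-phase P next finish {c} {w} good (step w~x p) (w≢ ∷ uniq-x) (inj₂ (cw , _) ∷ fines) Pc =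
    fill-skip cw (walk-phase P next finish good p uniq-x fines (next (λ u → inj₂ refl) (λ _ → refl) cw Pc))
  walk-phase P next finish {c} {w} good (step w~x p) (w≢ ∷ uniq-x) (inj₁ (cw , rep-w) ∷ fine-x ∷ fines) Pc = fill-step
    (colour-rep good cw rep-w w~x (fine-saves good w~x cw fine-x))
    λ a good₁ → walk-phase P next finish good₁ p uniq-x
      (All.zipWith (λ (w≢y , fine-y) → fine-update c cw a w≢y fine-y) (w≢ , fine-x ∷ fines))
      (next (⊑-update c a cw) (update-other c a) (λ c₁w → just≢nothing (trans (sym (update-self c w a)) c₁w)) Pc)
    where
    just≢nothing : ∀ {a : Fin k} → just a ≢ nothing
    just≢nothing ()

  fine-after : ∀ {c₀ vs} (r : RichPhase c₀ c₀ vs) → ∀ {v} → v ∈ vs → c₀ v ≡ nothing → 1 ≤ rep (cnt c₀ v) ⊎ Rich c₀ v →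
    Fine (RichPhase.c′ r) v
  fine-after {c₀} r {v} v∈ c₀v kind = by-cases (RichPhase.c′ r v) refl kind (only v c₀v)
    where
    open RichPhase r hiding (c′)
    c′ : Partial
    c′ = RichPhase.c′ r
    just≢nothing : ∀ {m : Maybe (Fin k)} {a} → m ≡ just a → m ≢ nothing
    just≢nothing refl ()
    by-cases : ∀ m → c′ v ≡ m → 1 ≤ rep (cnt c₀ v) ⊎ Rich c₀ v → c′ v ≡ nothing ⊎ Rich c′ v → Fine c′ v
    by-cases nothing c′v (inj₁ rep-v)  _ = inj₁ (c′v , ≤-trans rep-v (rep-⊑ extends v))
    by-cases nothing c′v (inj₂ rich-v) _ = contradiction c′v (done v∈ rich-v)
    by-cases (just _) c′v _ (inj₁ c′v′)  = contradiction c′v′ (just≢nothing c′v)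
    by-cases (just _) c′v _ (inj₂ rich)  = inj₂ (just≢nothing c′v , rich)

  module _ {U : VertexSet} where

    -- `z` is withheld from the rich phase and settled together with the last vertex of the walk,
    -- where the blank `y` saves a colour for it.
    fill-rooted : ∀ {c z w ws y} → Good c → Walk w ws z → Unique (z ∷ w ∷ ws) → BlankOn c (addAll (z ∷ w ∷ ws) U) →
      deg z ≡ D → outside U z ≡ 1 → z ~ y → U y ≡ true → y ∉ z ∷ w ∷ ws →
      All (λ v → deg v ≡ D × free c v ≡ 2) (w ∷ ws) → Fill c (z ∷ w ∷ ws)
    fill-rooted {c} {z} {w} {ws} {y} good p (z≢ ∷ uniq-w) blankOn deg-z one-outside z~y Uy y∉ facts =
      fill-⊆ (λ u∉ → kept (u∉ ∘ there)) reorder (λ u∈ → inj₁ (reorder′ u∈))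
        (walk-phase P next finish good₁ p uniq-w (All.tabulate fine) (c₁z , c₁y , (λ z∈ → lookup z≢ z∈ refl) , y∉ ∘ there , pending))
      where
      L : List (Fin n)
      L = w ∷ ws
      phase : RichPhase c c L
      phase = rich-phase c L good (λ x cx → inj₁ cx) (All.map (λ (_ , f) → ≤-reflexive (sym f)) facts)
      open RichPhase phase using (kept; extends) renaming (c′ to c₁; good to good₁)
      fine : ∀ {v} → v ∈ L → Fine c₁ v
      fine v∈ = fine-after phase v∈ (blank-in blankOn (addAll-∈ {z ∷ L} U (there v∈)))
        (rep-or-rich c 2 room (proj₁ (lookup facts v∈)) (≤-reflexive (proj₂ (lookup facts v∈))))
      c₁z : c₁ z ≡ nothing
      c₁z = trans (kept (λ z∈ → lookup z≢ z∈ refl)) (blank-in blankOn (addAll-∈ {z ∷ L} U (here refl)))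
      c₁y : c₁ y ≡ nothing
      c₁y = trans (kept (y∉ ∘ there)) (blank-in blankOn (addAll-⊇ (z ∷ L) U Uy))
      P : Partial → List (Fin n) → Set
      P c vs = c z ≡ nothing × c y ≡ nothing × z ∉ vs × y ∉ vs × (∀ u → c u ≡ nothing → U u ≡ true ⊎ u ≡ z ⊎ u ∈ vs)
      pending : ∀ u → c₁ u ≡ nothing → U u ≡ true ⊎ u ≡ z ⊎ u ∈ L
      pending u c₁u with u ∈? (z ∷ L)
      ... | yes (here u≡z)  = inj₂ (inj₁ u≡z)
      ... | yes (there u∈)  = inj₂ (inj₂ u∈)
      ... | no u∉ = inj₁ (trans (sym (addAll-∉ (z ∷ L) U u∉)) (blank-only-in blankOn (trans (sym (kept (u∉ ∘ there))) c₁u)))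
      next : ∀ {c c′ w ws} → c ⊑ c′ → (∀ {u} → w ≢ u → c′ u ≡ c u) → c′ w ≢ nothing → P c (w ∷ ws) → P c′ ws
      next {c} {c′} {w} {ws} ext same c′w (cz , cy , z∉ , y∉ , pend) =
        keep z∉ cz , keep y∉ cy , z∉ ∘ there , y∉ ∘ there , pend′
        where
        keep : ∀ {u} → u ∉ w ∷ ws → c u ≡ nothing → c′ u ≡ nothing
        keep u∉ cu = trans (same (λ { refl → u∉ (here refl) })) cu
        still : ∀ {u} → U u ≡ true ⊎ u ≡ z ⊎ u ∈ w ∷ ws → c′ u ≡ nothing → U u ≡ true ⊎ u ≡ z ⊎ u ∈ ws
        still (inj₁ Uu) _ = inj₁ Uu
        still (inj₂ (inj₁ u≡z)) _ = inj₂ (inj₁ u≡z)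
        still (inj₂ (inj₂ (here refl))) c′u = contradiction c′u c′w
        still (inj₂ (inj₂ (there u∈))) _ = inj₂ (inj₂ u∈)
        pend′ : ∀ u → c′ u ≡ nothing → U u ≡ true ⊎ u ≡ z ⊎ u ∈ ws
        pend′ u c′u = still (pend u (trans (sym (same (λ { refl → c′w c′u }))) c′u)) c′u
      finish : ∀ {c w} → Good c → P c (w ∷ []) → Fine c w → w ~ z → Fill c (w ∷ z ∷ [])
      finish {c} {w} good (cz , cy , z∉ , y∉ , pend) fine w~z = by-cases fine
        where
        y≢w : y ≢ w
        y≢w refl = y∉ (here refl)
        -- A root on a cycle starts with three blank neighbours, but on arrival only `w` and the one
        -- in `U` are left.
        few : free c z ≤ 2
        few = ≤-trans (sum-mono pointwise) (≤-reflexive (trans (∑-distrib-+ (λ u → A z u * ⟦ U u ⟧) (δ w))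
          (cong₂ _+_ one-outside (sum-δ₁ w))))
          where
          covered : ∀ u → U u ≡ true ⊎ u ≡ z ⊎ u ∈ w ∷ [] → A z u * 1 ≤ A z u * ⟦ U u ⟧ + δ w u
          covered u (inj₁ Uu) = ≤-trans (≤-reflexive (cong (λ b → A z u * ⟦ b ⟧) (sym Uu))) (m≤m+n _ (δ w u))
          covered u (inj₂ (inj₁ refl)) = ≤-trans (≤-reflexive (cong (_* 1) (A-diag z))) z≤n
          covered u (inj₂ (inj₂ (here refl))) = ≤-trans (≤-reflexive (*-identityʳ (A z u)))
            (≤-trans (⟦⟧≤1 (adj G z u)) (≤-trans (≤-reflexive (sym (δ-refl u))) (m≤n+m (δ u u) (A z u * ⟦ U u ⟧))))
          pointwise : ∀ u → A z u * blank (c u) ≤ A z u * ⟦ U u ⟧ + δ w u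
          pointwise u with c u in cu
          ... | just _  = ≤-trans (≤-reflexive (*-zeroʳ (A z u))) z≤n
          ... | nothing = covered u (pend u cu)
        by-cases : Fine c w → Fill c (w ∷ z ∷ [])
        by-cases (inj₂ (cw , rich-w)) = fill-skip cw (fill-one
          (colour-two good cz y≢w z~y (~-sym w~z) (σ-blank c cy) (σ-slack≥1 c (rich⇒slack good w~z cz rich-w))))
        by-cases (inj₁ (cw , rep-w)) = fill-swap (fill-edge good cz cw cy (~-sym w~z) z~y y≢w
          ([ (λ rep-z → inj₂ (rep-z , rep-w)) , (λ rich-z → inj₁ (rich⇒1+h≤uniq good (~-sym w~z) cw rich-z , inj₂ rep-w)) ]′
            (rep-or-rich c 2 room deg-z few)))
      reorder : ∀ {u} → u ∈ L ++ z ∷ [] → u ∈ z ∷ L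
      reorder = ∈-resp-↭ (↭-sym (∷↭∷ʳ z L))
      reorder′ : ∀ {u} → u ∈ z ∷ L → u ∈ L ++ z ∷ []
      reorder′ = ∈-resp-↭ (∷↭∷ʳ z L)

  -- `t` is coloured in the rich phase; being rich, it pays for the last vertex before the walk
  -- returns to it.
  fill-cycle-at : ∀ {c t w ws} → Good c → Walk t (w ∷ ws) t → Unique (t ∷ w ∷ ws) → Rich c t →
    All (λ v → c v ≡ nothing × deg v ≡ D × free c v ≡ 2) (t ∷ w ∷ ws) → Fill c (t ∷ w ∷ ws)
  fill-cycle-at {c} {t} {w} {ws} good (step _ p) (_ ∷ uniq-w) rich-t facts =
    fill-⊆ kept subset cover
      (walk-phase (λ c _ → Rich c t) (λ ext _ _ → Rich-⊑ ext) finish good₁ p uniq-w (All.tabulate (fine ∘ there)) (Rich-⊑ extends rich-t))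
    where
    S : List (Fin n)
    S = t ∷ w ∷ ws
    phase : RichPhase c c S
    phase = rich-phase c S good (λ x cx → inj₁ cx) (All.map (λ (_ , _ , f) → ≤-reflexive (sym f)) facts)
    open RichPhase phase using (kept; extends; done) renaming (c′ to c₁; good to good₁)
    fine : ∀ {v} → v ∈ S → Fine c₁ v
    fine v∈ = let (cv , deg-v , free-v) = lookup facts v∈ in
      fine-after phase v∈ cv (rep-or-rich c 2 room deg-v (≤-reflexive free-v))
    finish : ∀ {c w} → Good c → Rich c t → Fine c w → w ~ t → Fill c (w ∷ [])
    finish good rich (inj₂ (cw , _)) w~t = fill-skip cw (fill-[] good)
    finish {c} good rich (inj₁ (cw , rep-w)) w~t =
      fill-one (colour-rep good cw rep-w w~t (σ-slack≥1 c (rich⇒slack good (~-sym w~t) cw rich)))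
    subset : ∀ {u} → u ∈ w ∷ ws ++ [] → u ∈ S
    subset {u} u∈ = there (subst (u ∈_) (++-identityʳ (w ∷ ws)) u∈)
    cover : ∀ {u} → u ∈ S → u ∈ w ∷ ws ++ [] ⊎ c₁ u ≢ nothing
    cover (here refl) = inj₂ (done (here refl) rich-t)
    cover {u} (there u∈)  = inj₁ (subst (u ∈_) (sym (++-identityʳ (w ∷ ws))) u∈)

  -- If neither vertex sees two repetitions, then w sees at least D - 3 > h unique colours.
  last-edge-reps : ∀ {c w z} → Good c → c w ≡ nothing → c z ≡ nothing → w ~ z → deg w ≡ D → free c w ≤ 1 →
    1 ≤ rep (cnt c w) → 1 ≤ rep (cnt c z) → Fill c (w ∷ z ∷ [])
  last-edge-reps {c} {w} {z} good cw cz w~z deg-w few rep-w rep-z = by-cases (2 ≤? rep (cnt c z)) (2 ≤? rep (cnt c w))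
    where
    by-cases : Dec (2 ≤ rep (cnt c z)) → Dec (2 ≤ rep (cnt c w)) → Fill c (w ∷ z ∷ [])
    by-cases (yes two) _ = fill-step (colour-rep good cw rep-w w~z (σ-blank c cz))
      λ a good₁ → fill-one (colour-2rep good₁ (still-blank c a (~⇒≢ w~z) cz) (≤-trans two (rep-⊑ (⊑-update c a cw) z)))
    by-cases (no _) (yes two) = fill-swap (fill-step (colour-rep good cz rep-z (~-sym w~z) (σ-blank c cw))
      λ a good₁ → fill-one (colour-2rep good₁ (still-blank c a (~⇒≢ (~-sym w~z)) cw) (≤-trans two (rep-⊑ (⊑-update c a cz) w))))
    by-cases (no _) (no ¬two) = fill-step (colour-rep good cw rep-w w~z (σ-blank c cz))
      λ a good₁ → let c₁z = still-blank c a (~⇒≢ w~z) cz in fill-one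
      (colour-rep good₁ c₁z (≤-trans rep-z (rep-⊑ (⊑-update c a cw) z)) (~-sym w~z)
        (σ-slack≥1 _ (slack-h good₁ w~z c₁z (subst (suc h ≤_) (sym (uniq-self c cw a)) many))))
      where
      q t r : ℕ
      q = uniq (cnt c w)
      t = total (cnt c w)
      r = rep (cnt c w)
      r≤1 : r ≤ 1
      r≤1 = ≤-pred (≰⇒> ¬two)
      D≤t+1 : D ≤ t + 1
      D≤t+1 = ≤-trans (≤-reflexive (trans (sym deg-w) (sym (total+free≡deg c w)))) (+-monoʳ-≤ t few)
      regroup : ∀ h q t r D → suc h + (q + (r + r) + (t + 1 + D + (1 + 1))) + 0 ≡ q + (t + (D + (h + 4) + (r + r)))
      regroup = solve-∀
      many : suc h ≤ q
      many = linear (suc h) q 0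
        (≤-trans (+-mono-≤ (total≤uniq+2rep (cnt c w)) (+-mono-≤ (+-mono-≤ D≤t+1 room) (+-mono-≤ r≤1 r≤1)))
          ≤-refl) (regroup h q t r D)

  walk-reps : ∀ {c w ws z} → Good c → Walk w ws z → Unique (z ∷ w ∷ ws) → c z ≡ nothing → 1 ≤ rep (cnt c z) →
    All (λ v → c v ≡ nothing × 1 ≤ rep (cnt c v) × deg v ≡ D × free c v ≤ 2) (w ∷ ws) → free c w ≤ 1 → Fill c (w ∷ ws ++ z ∷ [])
  walk-reps good (edge w~z) _ cz rep-z ((cw , rep-w , deg-w , _) ∷ []) few = last-edge-reps good cw cz w~z deg-w few rep-w rep-z
  walk-reps {c} {w} {x ∷ ws} {z} good (step w~x p) ((z≢w ∷ z≢) ∷ (w≢ ∷ uniq-x)) cz rep-z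
    ((cw , rep-w , _) ∷ fact-x@(cx , _ , _ , few-x) ∷ facts) _ = fill-step (colour-rep good cw rep-w w~x (σ-blank c cx))
    λ a good₁ → walk-reps good₁ p (z≢ ∷ uniq-x) (still-blank c a (z≢w ∘ sym) cz) (≤-trans rep-z (rep-⊑ (⊑-update c a cw) z))
      (All.zipWith (λ { {v} (w≢v , cv , rep-v , deg-v , few-v) → still-blank c a w≢v cv , ≤-trans rep-v (rep-⊑ (⊑-update c a cw) v)
        , deg-v , ≤-trans (free-⊑ (⊑-update c a cw) v) few-v }) (w≢ , fact-x ∷ facts))
      (free-drops c cw a (~-sym w~x) few-x)

  -- A rich vertex is rotated to the front. If there is none, every vertex has a repetition, which
  -- together with the blank successor pays for all but the last edge.
  fill-cycle : ∀ {c z u x ws} → Good c → Walk z (u ∷ x ∷ ws) z → Unique (z ∷ u ∷ x ∷ ws) →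
    All (λ v → c v ≡ nothing × deg v ≡ D × free c v ≡ 2) (z ∷ u ∷ x ∷ ws) → Fill c (z ∷ u ∷ x ∷ ws)
  fill-cycle {c} {z} {u} {x} {ws} good p unique facts =
    by-cases (Any.any? (λ v → D + h ≤? uniq (cnt c v) + total (cnt c v)) S)
    where
    S : List (Fin n)
    S = z ∷ u ∷ x ∷ ws
    by-cases : Dec (Any.Any (Rich c) S) → Fill c S
    by-cases (yes (here rich-z)) = fill-cycle-at good p unique rich-z facts
    by-cases (yes (there some)) = rotate (split (proj₁ (proj₂ (find some))) p)
      where
      t : Fin n
      t = proj₁ (find some)
      rotate : (∃₂ λ us vs → u ∷ x ∷ ws ≡ us ++ t ∷ vs × Walk z us t × Walk t vs z) → Fill c S
      rotate (us , vs , eq , p₁ , p₂) = fill-↭ (↭-sym S↭) (fill-at (vs ++ z ∷ us) (join p₂ p₁) (Unique-↭ S↭ unique) (All-resp-↭ S↭ facts))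
        where
        S↭ : S ↭ t ∷ vs ++ z ∷ us
        S↭ = subst (λ l → z ∷ l ↭ t ∷ vs ++ z ∷ us) (sym eq) (++-comm (z ∷ us) (t ∷ vs))
        fill-at : ∀ L → Walk t L t → Unique (t ∷ L) → All (λ v → c v ≡ nothing × deg v ≡ D × free c v ≡ 2) (t ∷ L) → Fill c (t ∷ L)
        fill-at [] (edge t~t) = contradiction t~t (~-irrefl t)
        fill-at (_ ∷ _) q uniq-t facts-t = fill-cycle-at good q uniq-t (proj₂ (proj₂ (find some))) facts-t
    by-cases (no none) = all-reps p unique facts
      where
      rep-all : ∀ {v} → v ∈ S → 1 ≤ rep (cnt c v)
      rep-all v∈ = let (_ , deg-v , free-v) = lookup facts v∈ in
        [ id , (λ rich-v → contradiction (Any.map (λ { refl → rich-v }) v∈) none) ]′ (rep-or-rich c 2 room deg-v (≤-reflexive free-v))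
      all-reps : Walk z (u ∷ x ∷ ws) z → Unique S → All (λ v → c v ≡ nothing × deg v ≡ D × free c v ≡ 2) S → Fill c S
      all-reps (step _ (step u~x q)) ((z≢u ∷ z≢) ∷ (u≢ ∷ uniq-x)) ((cz , _) ∷ (cu , _) ∷ facts-x@((cx , _ , free-x) ∷ _)) =
        fill-↭ (↭-sym (∷↭∷ʳ z (u ∷ x ∷ ws))) (fill-step (colour-rep good cu (rep-all (there (here refl))) u~x (σ-blank c cx))
        λ a good₁ → walk-reps good₁ q (z≢ ∷ uniq-x) (still-blank c a (z≢u ∘ sym) cz)
          (≤-trans (rep-all (here refl)) (rep-⊑ (⊑-update c a cu) z))
          (All.tabulate (λ { {v} v∈ → let (cv , deg-v , free-v) = lookup facts-x v∈ in still-blank c a (lookup u≢ v∈) cv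
            , ≤-trans (rep-all (there (there v∈))) (rep-⊑ (⊑-update c a cu) v) , deg-v
            , ≤-trans (free-⊑ (⊑-update c a cu) v) (≤-reflexive free-v) }))
          (free-drops c cu a (~-sym u~x) (≤-reflexive free-x)))

-- For h = 1 and D = 4 the surplus 2h falls short of the g + 2 needed by Tight.fill-cycle.
module Quartic {n : ℕ} {G : Graph n} {k : ℕ} (setting : Colourings.Setting G k 1 1 4)
               (T : Fin n → Set) (closed : ∀ {u v} → T u → adj G u v ≡ true → T v) where

  open PartialColourings setting public
  open Tight refl public

  -- Three consecutive vertices for h = 1, D = 4

  valid? : ∀ (c : Partial) v a → Dec (Valid c v a)
  valid? c v a = (cnt c v a ≟ⁿ 0) ×-dec all? (λ x → (v ~? x) →-dec (bad (free c x) (cnt c x) a ≟ⁿ 0))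

  -- By `base` such a vertex sees two unique colours, one above the demand. The premise
  -- `2 ≤ free c y` makes the condition stable under extension.
  Two : Partial → Set
  Two c = ∀ y → T y → 2 ≤ free c y → free c y ≡ 2 × deg y ≡ 4

  Two-⊑ : ∀ {c c′} → c ⊑ c′ → Two c → Two c′
  Two-⊑ ext two y ty 2≤f with two y ty (≤-trans 2≤f (free-⊑ ext y))
  ... | free≡2 , deg≡4 = ≤-antisym (≤-trans (free-⊑ ext y) (≤-reflexive free≡2)) 2≤f , deg≡4

  uniq≥2 : ∀ {c y} → Good c → free c y ≡ 2 → deg y ≡ 4 → 2 ≤ uniq (cnt c y)
  uniq≥2 {c} {y} good free≡2 deg≡4 = +-cancelʳ-≤ 2 2 _ (≤-trans (base good deg≡4 free≡2)
    (+-monoʳ-≤ (uniq (cnt c y)) (total≤1+g c (≤-reflexive (sym free≡2)))))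

  two⇒uniq : ∀ {c y} → Good c → Two c → T y → 2 ≤ free c y → 2 ≤ uniq (cnt c y)
  two⇒uniq good two ty 2≤f with two _ ty 2≤f
  ... | free≡2 , deg≡4 = uniq≥2 good free≡2 deg≡4

  need≤ : ∀ j m {q} → 1 ≤ q → need j m ≤ q
  need≤ j m 1≤q = ≤-trans (need≤h j m) 1≤q

  -- The common neighbours of v and x forbid nothing at x before v is coloured.
  valid-before : ∀ {c v x e d} → Good c → (∀ y → y ~ v → y ~ x → 2 ≤ uniq (cnt c y)) → (cv : c v ≡ nothing) →
    Valid (c [ v ↦ e ]) x d → Valid c x d
  valid-before {c} {v} {x} {e} {d} good common cv (absent , harmless) =
    n≤0⇒n≡0 (≤-trans (cnt-mono c cv e x d) (≤-reflexive absent)) , harmless′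
    where
    bump-cong : ∀ {f f′ : Fin k → ℕ} → (∀ i → f i ≡ f′ i) → ∀ i → bump d f i ≡ bump d f′ i
    bump-cong eq i = cong (_+ δ d i) (eq i)
    harmless′ : ∀ y → x ~ y → bad (free c y) (cnt c y) d ≡ 0
    harmless′ y x~y with y ~? v
    ... | yes y~v = Ok⇒bad≡0 (free c y) (cnt c y) d (need≤ (pred (free c y)) (total (bump d (cnt c y)))
                      (≤-pred (≤-trans (common y y~v (~-sym x~y)) (uniq≤1+uniq-bump d (cnt c y)))))
    ... | no y≁v = Ok⇒bad≡0 (free c y) (cnt c y) d (OkAt-cong
                      (cong pred (sym (free-update-nonadj c cv e y≁v))) (bump-cong (λ i → sym (cnt-update-nonadj c cv e y≁v i)))
                      (bad≡0⇒Ok (free (c [ v ↦ e ]) y) (cnt (c [ v ↦ e ]) y) d (harmless y x~y)))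

  common-uniq : ∀ {c v x} → Good c → Two c → T v → v ≢ x → c v ≡ nothing → c x ≡ nothing →
    ∀ y → y ~ v → y ~ x → 2 ≤ uniq (cnt c y)
  common-uniq {c} good two tv v≢x cv cx y y~v y~x = two⇒uniq good two (closed tv (~-sym y~v)) (two-blank-nbrs≤free c v≢x y~v cv y~x cx)

  -- Two further occurrences of `α` can only take away the uniqueness of `α` itself.
  uniq-bump-twice : ∀ α (f : Fin k → ℕ) → 2 ≤ uniq f → 1 ≤ uniq (bump α (bump α f))
  uniq-bump-twice α f 2≤u = linear 1 _ (2∸one (f α)) (+-mono-≤ 2≤u (≤-reflexive both)) (identity (f α) (uniq f) _)
    where
    2∸one : ℕ → ℕ
    2∸one x = 1 ∸ one x
    u₂+one : uniq (bump α (bump α f)) + one (suc (f α)) ≡ uniq (bump α f)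
    u₂+one = trans (cong (λ x → uniq (bump α (bump α f)) + one x) (sym (bump-self α f)))
      (trans (uniq-bump α (bump α f)) (trans (cong (λ x → uniq (bump α f) + one (suc x)) (bump-self α f)) (+-identityʳ _)))
    both : uniq f + one (suc (f α)) ≡ uniq (bump α (bump α f)) + one (suc (f α)) + one (f α)
    both = trans (sym (uniq-bump α f)) (cong (_+ one (f α)) (sym u₂+one))
    identity : ∀ x u w → 1 + (u + (w + one (suc x) + one x)) + 2∸one x ≡ w + (2 + (u + one (suc x)))
    identity 0 = case₀
      where
      case₀ : ∀ u w → 1 + (u + (w + 1 + 0)) + 1 ≡ w + (2 + (u + 1))
      case₀ = solve-∀
    identity 1 = case₁
      where
      case₁ : ∀ u w → 1 + (u + (w + 0 + 1)) + 0 ≡ w + (2 + (u + 0))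
      case₁ = solve-∀
    identity (suc (suc _)) = case₂
      where
      case₂ : ∀ u w → 1 + (u + (w + 0 + 0)) + 1 ≡ w + (2 + (u + 0))
      case₂ = solve-∀

  -- A common neighbour of `v` and `x` has two unique colours, at most one of which is `α`, and one
  -- suffices for `h = 1`.
  valid-twice : ∀ {c v x α} → Good c → Two c → T v → v ≢ x → ¬ x ~ v → (cv : c v ≡ nothing) → c x ≡ nothing →
    Valid c x α → Valid (c [ v ↦ α ]) x α
  valid-twice {c} {v} {x} {α} good two tv v≢x x≁v cv cx (absent , harmless) = trans (cnt-update-nonadj c cv α x≁v α) absent , harmless′
    where
    c₁ : Partial
    c₁ = c [ v ↦ α ]
    harmless′ : ∀ y → x ~ y → bad (free c₁ y) (cnt c₁ y) α ≡ 0
    harmless′ y x~y with y ~? v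
    ... | yes y~v = Ok⇒bad≡0 (free c₁ y) (cnt c₁ y) α (need≤ (pred (free c₁ y)) (total (bump α (cnt c₁ y)))
          (subst (1 ≤_) (uniq-cong (λ i → cong (_+ δ α i) (sym (cnt-update-adj c cv α y~v i))))
            (uniq-bump-twice α (cnt c y) (common-uniq good two tv v≢x cv cx y y~v (~-sym x~y)))))
    ... | no y≁v = Ok⇒bad≡0 (free c₁ y) (cnt c₁ y) α (OkAt-cong
          (cong pred (free-update-nonadj c cv α y≁v)) (λ i → cong (_+ δ α i) (cnt-update-nonadj c cv α y≁v i))
          (bad≡0⇒Ok (free c y) (cnt c y) α (harmless y x~y)))

  rep-twice : ∀ α (f : Fin k → ℕ) → 1 ≤ f α → 2 ≤ rep (bump α (bump α f))
  rep-twice α f 1≤fα = ≤-trans (≤-trans (s≤s 1≤fα) (≤-reflexive (sym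
    (cong pred (trans (bump-self α (bump α f)) (cong suc (bump-self α f)))))))
    (term≤sum (pred ∘ bump α (bump α f)) α)

  module _ {c : Partial} (good : Good c) {v w x : Fin n} (v~w : v ~ w) (w~x : w ~ x) (v≢x : v ≢ x) (v≁x : ¬ v ~ x)
           (cv : c v ≡ nothing) (cw : c w ≡ nothing) (cx : c x ≡ nothing) (uniq-w : 2 ≤ uniq (cnt c w)) where

    private
      x≁v : ¬ x ~ v
      x≁v = v≁x ∘ ~-sym

      slack-w : Slack c w
      slack-w = slack-h good (~-sym v~w) cv uniq-w

    first-end : ∃ λ a → Valid c v a
    first-end = choose good cv (≤-trans (σ-blank-slack c cw slack-w) (≤-trans (σ≤gain c v~w) (m≤n+m _ _)))

    -- Once `v` is coloured, either `w` still has two unique colours and helps to pay for `x`, or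
    -- `w` has gained a repetition for itself and can wait until the end.
    fill-mixed : 2 ≤ uniq (cnt c v) → 1 ≤ rep (cnt c x) → Fill c (v ∷ w ∷ x ∷ [])
    fill-mixed uniq-v rep-x = fill-step (colour-one good cv v~w (σ-blank-slack c cw slack-w)) after-v
      where
      after-v : ∀ a → Good (c [ v ↦ a ]) → Fill (c [ v ↦ a ]) (w ∷ x ∷ [])
      after-v a good₁ = by-cases (2 ≤? uniq (cnt c₁ w))
        where
        c₁ : Partial
        c₁ = c [ v ↦ a ]
        c₁w : c₁ w ≡ nothing
        c₁w = still-blank c a (~⇒≢ v~w) cw
        c₁x : c₁ x ≡ nothing
        c₁x = still-blank c a v≢x cx
        uniq-v₁ : 2 ≤ uniq (cnt c₁ v)
        uniq-v₁ = subst (2 ≤_) (sym (uniq-self c cv a)) uniq-v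
        rep-x₁ : 1 ≤ rep (cnt c₁ x)
        rep-x₁ = ≤-trans rep-x (rep-⊑ (⊑-update c a cv) x)
        by-cases : Dec (2 ≤ uniq (cnt c₁ w)) → Fill c₁ (w ∷ x ∷ [])
        by-cases (yes uniq-w₁) = fill-step
          (colour-two good₁ c₁w v≢x (~-sym v~w) w~x (σ-slack≥1 c₁ (slack-h good₁ v~w c₁w uniq-v₁)) (σ-blank c₁ c₁x))
          λ b good₂ → let c₂x = still-blank c₁ b (~⇒≢ w~x) c₁x in fill-one
          (colour-rep good₂ c₂x (≤-trans rep-x₁ (rep-⊑ (⊑-update c₁ b c₁w) x)) (~-sym w~x)
            (σ-slack≥1 _ (slack-h good₂ w~x c₂x (subst (2 ≤_) (sym (uniq-self c₁ c₁w b)) uniq-w₁))))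
        by-cases (no few) = fill-swap (fill-step
          (colour-rep good₁ c₁x rep-x₁ (~-sym w~x) (σ-blank c₁ c₁w))
          λ b good₂ → let c₂w = still-blank c₁ b (~⇒≢ (~-sym w~x)) c₁w in fill-one
          (colour-rep good₂ c₂w (≤-trans rep-w₁ (rep-⊑ (⊑-update c₁ b c₁x) w)) (~-sym v~w)
            (σ-slack≥1 _ (slack-h good₂ v~w c₂w (subst (2 ≤_) (sym (uniq-nonadj c₁ c₁x b v≁x)) uniq-v₁)))))
          where
          -- Three or more occurrences with at most one unique.
          rep-w₁ : 1 ≤ rep (cnt c₁ w)
          rep-w₁ = *-cancelˡ-≤ 2 (linear 2 (2 * rep (cnt c₁ w)) 0
            (+-mono-≤ (≤-trans (≤-reflexive (sym (total-adj c cv a (~-sym v~w)))) (total≤uniq+2rep (cnt c₁ w)))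
              (+-mono-≤ (≤-trans uniq-w (uniq≤total (cnt c w))) (≤-pred (≰⇒> few))))
            (identity (total (cnt c w)) (uniq (cnt c₁ w)) (rep (cnt c₁ w))))
            where
            identity : ∀ t u r → 2 + (u + (r + r) + (t + 1)) + 0 ≡ 2 * r + (suc t + (2 + u))
            identity = solve-∀

    -- A fresh colour at `v` preserves the unique colours of `w`, which pay for `x`; then `v` and
    -- `x` pay for `w`.
    fill-distinct-ends : 2 ≤ uniq (cnt c v) → 2 ≤ uniq (cnt c x) → ∀ {a} → Valid c v a → cnt c w a ≡ 0 → Fill c (v ∷ x ∷ w ∷ [])
    fill-distinct-ends uniq-v uniq-x {a} valid-a fresh = fill-∷ a (fill-step
      (colour-one good₁ c₁x (~-sym w~x) (σ-blank-slack c₁ c₁w (slack-h good₁ w~x c₁x uniq-w₁)))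
      λ b good₂ → let c₂w = still-blank c₁ b (~⇒≢ (~-sym w~x)) c₁w in fill-one
      (colour-two good₂ c₂w v≢x (~-sym v~w) w~x
        (σ-slack≥1 _ (slack-h good₂ v~w c₂w (subst (2 ≤_) (sym (trans (uniq-nonadj c₁ c₁x b v≁x) (uniq-self c cv a))) uniq-v)))
        (σ-slack≥1 _ (slack-h good₂ (~-sym w~x) c₂w
          (subst (2 ≤_) (sym (trans (uniq-self c₁ c₁x b) (uniq-nonadj c cv a x≁v))) uniq-x)))))
      where
      c₁ : Partial
      c₁ = c [ v ↦ a ]
      good₁ : Good c₁
      good₁ = valid⇒good good cv valid-a
      c₁w : c₁ w ≡ nothing
      c₁w = still-blank c a (~⇒≢ v~w) cw
      c₁x : c₁ x ≡ nothing
      c₁x = still-blank c a v≢x cx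
      uniq-w₁ : 2 ≤ uniq (cnt c₁ w)
      uniq-w₁ = ≤-trans uniq-w (uniq≤uniq-fresh c cv a (~-sym v~w) fresh)

    -- A colour valid for `v` after `w` was valid before as well, hence unseen at `w`. So `w` keeps
    -- two unique colours and adds the second saving to the repetition at each end.
    fill-repeated-ends : Two c → T w → 1 ≤ rep (cnt c v) → 1 ≤ rep (cnt c x) → (∀ a → Valid c v a → cnt c w a ≡ 0) →
      Fill c (w ∷ v ∷ x ∷ [])
    fill-repeated-ends two tw rep-v rep-x fresh = fill-step
      (colour-two good cw v≢x (~-sym v~w) w~x (σ-blank c cv) (σ-blank c cx)) after-w
      where
      after-w : ∀ a → Good (c [ w ↦ a ]) → Fill (c [ w ↦ a ]) (v ∷ x ∷ [])
      after-w a good₁ = after-v (choose good₁ c₁v (+-mono-≤ (≤-trans rep-v (rep-⊑ (⊑-update c a cw) v))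
          (≤-trans (σ-slack≥1 c₁ (slack-h good₁ (~-sym v~w) c₁v uniq-w₁)) (σ≤gain c₁ v~w))))
        where
        c₁ : Partial
        c₁ = c [ w ↦ a ]
        c₁v : c₁ v ≡ nothing
        c₁v = still-blank c a (~⇒≢ (~-sym v~w)) cv
        c₁x : c₁ x ≡ nothing
        c₁x = still-blank c a (~⇒≢ w~x) cx
        uniq-w₁ : 2 ≤ uniq (cnt c₁ w)
        uniq-w₁ = subst (2 ≤_) (sym (uniq-self c cw a)) uniq-w
        after-v : (∃ λ b → Valid c₁ v b) → Fill c₁ (v ∷ x ∷ [])
        after-v (b , valid-b) = fill-∷ b (fill-one
          (colour-rep good₂ c₂x (≤-trans rep-x (rep-⊑ (⊑-trans (⊑-update c a cw) (⊑-update c₁ b c₁v)) x)) (~-sym w~x)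
            (σ-slack≥1 _ (slack-h good₂ w~x c₂x uniq-w₂))))
          where
          good₂ : Good (c₁ [ v ↦ b ])
          good₂ = valid⇒good good₁ c₁v valid-b
          c₂x : (c₁ [ v ↦ b ]) x ≡ nothing
          c₂x = still-blank c₁ b v≢x c₁x
          unseen : cnt c₁ w b ≡ 0
          unseen = trans (cnt-update-nonadj c cw a (~-irrefl w) b) (fresh b
            (valid-before good (common-uniq good two tw (~⇒≢ (~-sym v~w)) cw cv) cw valid-b))
          uniq-w₂ : 2 ≤ uniq (cnt (c₁ [ v ↦ b ]) w)
          uniq-w₂ = ≤-trans uniq-w₁ (uniq≤uniq-fresh c₁ c₁v b (~-sym v~w) unseen)

    -- `α` now occurs three times around `w`: two repetitions, enough by themselves.
    fill-same-ends : Two c → T w → ∀ {α} → Valid c v α → Valid c x α → 1 ≤ cnt c w α → Fill c (v ∷ x ∷ w ∷ [])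
    fill-same-ends two tw {α} valid-v valid-x seen = fill-∷ α (fill-∷ α (fill-one
      (colour-2rep (valid⇒good good₁ c₁x valid-x₁) (still-blank c₁ α (~⇒≢ (~-sym w~x)) (still-blank c α (~⇒≢ v~w) cw))
        (subst (2 ≤_) (sym (rep-cong counts)) (rep-twice α (cnt c w) seen)))))
      where
      c₁ : Partial
      c₁ = c [ v ↦ α ]
      good₁ : Good c₁
      good₁ = valid⇒good good cv valid-v
      c₁x : c₁ x ≡ nothing
      c₁x = still-blank c α v≢x cx
      valid-x₁ : Valid c₁ x α
      valid-x₁ = valid-twice good two (closed tw (~-sym v~w)) v≢x x≁v cv cx valid-x
      counts : ∀ i → cnt (c₁ [ x ↦ α ]) w i ≡ bump α (bump α (cnt c w)) i
      counts i = trans (cnt-update-adj c₁ c₁x α w~x i) (cong (_+ δ α i) (cnt-update-adj c cv α (~-sym v~w) i))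

  fill-from : ∀ {c v a vs ws} → (v ∷ vs) ↭ ws → Fill (c [ v ↦ a ]) vs → Fill c ws
  fill-from {a = a} vs↭ws f = fill-↭ vs↭ws (fill-∷ a f)

  others : (Fin k → ℕ) → Fin k → Fin k → ℕ
  others f α i = pos (f i) ∸ δ α i

  others-sum : ∀ f α → 1 ≤ f α → suc (sum (others f α)) ≡ dist f
  others-sum f α 1≤fα = trans (+-comm 1 _) (trans (cong (sum (others f α) +_) (sym (sum-δ₁ α)))
    (trans (sym (∑-distrib-+ (others f α) (δ α))) (sum-cong-≗ pointwise)))
    where
    pos≡1 : ∀ {x} → 1 ≤ x → pos x ≡ 1
    pos≡1 (s≤s _) = refl
    pointwise : ∀ i → others f α i + δ α i ≡ pos (f i)
    pointwise i with α ≟ i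
    ... | yes refl = m∸n+n≡m (≤-reflexive (sym (pos≡1 1≤fα)))
    ... | no _     = +-identityʳ _

  others≡0 : ∀ f α i → others f α i ≡ 0 → f i ≡ 0 ⊎ α ≡ i
  others≡0 f α i eq with α ≟ i
  ... | yes α≡i = inj₂ α≡i
  ... | no _ with f i
  ...   | zero = inj₁ refl

  -- A surplus of 3 allows avoiding the at most one other colour at `w`. The valid colour found is
  -- seen at `w`, so it must be `α`.
  forced : ∀ {c x w α} → Good c → c x ≡ nothing → total (cnt c w) ≤ 2 → 1 ≤ cnt c w α → 3 ≤ rep (cnt c x) + gain c x →
    (∀ a → Valid c x a → cnt c w a ≢ 0) → Valid c x α
  forced {c} {x} {w} {α} good cx few seen surplus occupied = is-forced (choose-avoiding good cx (others (cnt c w) α) surplus′)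
    where
    surplus′ : 2 + sum (others (cnt c w) α) ≤ rep (cnt c x) + gain c x
    surplus′ = ≤-trans (s≤s (≤-trans (≤-reflexive (others-sum (cnt c w) α seen)) (≤-trans (dist≤total (cnt c w)) few))) surplus
    is-forced : (∃ λ b → others (cnt c w) α b ≡ 0 × Valid c x b) → Valid c x α
    is-forced (b , avoided , valid-b) =
      [ (λ unseen → contradiction unseen (occupied b valid-b)) , (λ { refl → valid-b }) ]′ (others≡0 (cnt c w) α b avoided)

  module _ (c : Partial) (v w : Fin n) where

    find-fresh : (∃ λ a → Valid c v a × cnt c w a ≡ 0) ⊎ (∀ a → Valid c v a → cnt c w a ≢ 0)
    find-fresh = by-cases (any? (λ a → valid? c v a ×-dec (cnt c w a ≟ⁿ 0)))
      where
      by-cases : Dec (∃ λ a → Valid c v a × cnt c w a ≡ 0) →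
        (∃ λ a → Valid c v a × cnt c w a ≡ 0) ⊎ (∀ a → Valid c v a → cnt c w a ≢ 0)
      by-cases (yes found) = inj₁ found
      by-cases (no none)   = inj₂ λ a valid-a unseen → none (a , valid-a , unseen)

    find-seen : (∃ λ a → Valid c v a × cnt c w a ≢ 0) ⊎ (∀ a → Valid c v a → cnt c w a ≡ 0)
    find-seen = by-cases (any? (λ a → valid? c v a ×-dec ¬? (cnt c w a ≟ⁿ 0)))
      where
      by-cases : Dec (∃ λ a → Valid c v a × cnt c w a ≢ 0) →
        (∃ λ a → Valid c v a × cnt c w a ≢ 0) ⊎ (∀ a → Valid c v a → cnt c w a ≡ 0)
      by-cases (yes found) = inj₁ found
      by-cases (no none)   = inj₂ λ a valid-a → decidable-stable (cnt c w a ≟ⁿ 0) λ seen → none (a , valid-a , seen)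

  -- Paths and cycles on four vertices

  record Path (c : Partial) (v₁ v₂ v₃ v₄ : Fin n) : Set where
    field
      good  : Good c
      two   : Two c
      t₁    : T v₁
      e₁₂   : v₁ ~ v₂
      e₂₃   : v₂ ~ v₃
      e₃₄   : v₃ ~ v₄
      n₁₃   : ¬ v₁ ~ v₃
      n₂₄   : ¬ v₂ ~ v₄
      d₁₃   : v₁ ≢ v₃
      d₂₄   : v₂ ≢ v₄
      d₁₄   : v₁ ≢ v₄
      b₁    : c v₁ ≡ nothing
      b₂    : c v₂ ≡ nothing
      b₃    : c v₃ ≡ nothing
      b₄    : c v₄ ≡ nothing

    t₂ : T v₂
    t₂ = closed t₁ e₁₂

    t₃ : T v₃
    t₃ = closed t₂ e₂₃

    t₄ : T v₄
    t₄ = closed t₃ e₃₄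

    u₂ : 2 ≤ uniq (cnt c v₂)
    u₂ = two⇒uniq good two t₂ (two-blank-nbrs≤free c d₁₃ (~-sym e₁₂) b₁ e₂₃ b₃)

    u₃ : 2 ≤ uniq (cnt c v₃)
    u₃ = two⇒uniq good two t₃ (two-blank-nbrs≤free c d₂₄ (~-sym e₂₃) b₂ e₃₄ b₄)

    module First {e : Fin k} (valid-e : Valid c v₁ e) where

      c₁ : Partial
      c₁ = c [ v₁ ↦ e ]
      good₁ : Good c₁
      good₁ = valid⇒good good b₁ valid-e
      ext₁ : c ⊑ c₁
      ext₁ = ⊑-update c e b₁
      two₁ : Two c₁
      two₁ = Two-⊑ ext₁ two
      b₂′ : c₁ v₂ ≡ nothing
      b₂′ = still-blank c e (~⇒≢ e₁₂) b₂
      b₃′ : c₁ v₃ ≡ nothing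
      b₃′ = still-blank c e d₁₃ b₃
      b₄′ : c₁ v₄ ≡ nothing
      b₄′ = still-blank c e d₁₄ b₄
      u₃′ : 2 ≤ uniq (cnt c₁ v₃)
      u₃′ = subst (2 ≤_) (sym (uniq-nonadj c b₁ e (n₁₃ ∘ ~-sym))) u₃
      u₂-fresh : cnt c v₂ e ≡ 0 → 2 ≤ uniq (cnt c₁ v₂)
      u₂-fresh unseen = ≤-trans u₂ (uniq≤uniq-fresh c b₁ e (~-sym e₁₂) unseen)
      r₂-seen : cnt c v₂ e ≢ 0 → 1 ≤ rep (cnt c₁ v₂)
      r₂-seen seen = rep-repeated c b₁ e (~-sym e₁₂) (n≢0⇒n>0 seen)

  reverse-path : ∀ {c v₁ v₂ v₃ v₄} → Path c v₁ v₂ v₃ v₄ → Path c v₄ v₃ v₂ v₁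
  reverse-path p = record
    { good = good ; two = two ; t₁ = t₄ ; e₁₂ = ~-sym e₃₄ ; e₂₃ = ~-sym e₂₃ ; e₃₄ = ~-sym e₁₂
    ; n₁₃ = n₂₄ ∘ ~-sym ; n₂₄ = n₁₃ ∘ ~-sym ; d₁₃ = d₂₄ ∘ sym ; d₂₄ = d₁₃ ∘ sym ; d₁₄ = d₁₄ ∘ sym
    ; b₁ = b₄ ; b₂ = b₃ ; b₃ = b₂ ; b₄ = b₁ }
    where open Path p

  perm : ∀ {v₁ v₂ v₃ v₄ : Fin n} → v₁ ∷ v₄ ∷ v₃ ∷ v₂ ∷ [] ↭ v₁ ∷ v₂ ∷ v₃ ∷ v₄ ∷ []
  perm = ↭-prep _ (↭-reverse (_ ∷ _ ∷ _ ∷ []))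

  reverse-perm : ∀ {v₁ v₂ v₃ v₄ : Fin n} → v₄ ∷ v₃ ∷ v₂ ∷ v₁ ∷ [] ↭ v₁ ∷ v₂ ∷ v₃ ∷ v₄ ∷ []
  reverse-perm = ↭-reverse (_ ∷ _ ∷ _ ∷ _ ∷ [])

  module _ {c : Partial} {v₁ v₂ v₃ v₄ : Fin n} (p : Path c v₁ v₂ v₃ v₄) (n₁₄ : ¬ v₁ ~ v₄) where

    open Path p

    private
      module P′ = Path (reverse-path p)

      Filling : Set
      Filling = Fill c (v₁ ∷ v₂ ∷ v₃ ∷ v₄ ∷ [])

    -- Repeating a colour at `v₂` puts `v₄`, `v₃`, `v₂` in the position of `fill-mixed`.
    fill-path-seen : 2 ≤ uniq (cnt c v₄) → ∀ {e} → Valid c v₁ e → cnt c v₂ e ≢ 0 → Filling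
    fill-path-seen u₄ {e} valid-e seen = fill-from perm
      (fill-mixed good₁ (~-sym e₃₄) (~-sym e₂₃) (d₂₄ ∘ sym) (n₂₄ ∘ ~-sym) b₄′ b₃′ b₂′ u₃′
        (subst (2 ≤_) (sym (uniq-nonadj c b₁ e (n₁₄ ∘ ~-sym))) u₄) (r₂-seen seen))
      where open First valid-e

    -- If `e` is seen at `v₂`, or `d` at `v₃`, the repetition created there serves `fill-mixed` or
    -- `fill-repeated-ends` on three vertices; otherwise `fill-distinct-ends` applies.
    fill-path-distinct : 2 ≤ uniq (cnt c v₄) → 1 ≤ rep (cnt c v₁) ⊎ 2 ≤ uniq (cnt c v₁) → Filling
    fill-path-distinct u₄ kind₁ = after-choice (first-end good e₁₂ e₂₃ d₁₃ n₁₃ b₁ b₂ b₃ u₂)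
      where
      after-choice : (∃ λ e → Valid c v₁ e) → Filling
      after-choice (e , valid-e) = seen? (cnt c v₂ e ≟ⁿ 0)
        where
        open First valid-e
        seen? : Dec (cnt c v₂ e ≡ 0) → Filling
        seen? (no seen)    = fill-path-seen u₄ valid-e seen
        seen? (yes unseen) = last-choice (first-end good₁ (~-sym e₃₄) (~-sym e₂₃) (d₂₄ ∘ sym) (n₂₄ ∘ ~-sym) b₄′ b₃′ b₂′ u₃′)
          where
          last-choice : (∃ λ d → Valid c₁ v₄ d) → Filling
          last-choice (d , valid-d) = seen₃? (cnt c₁ v₃ d ≟ⁿ 0)
            where
            -- If `d` is seen at `v₃`, `v₄` takes it while `v₁` is still blank.
            valid-d₀ : Valid c v₄ d
            valid-d₀ = valid-before good (common-uniq good two t₁ d₁₄ b₁ b₄) b₁ valid-d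
            module F = P′.First valid-d₀
            u₂′ : 2 ≤ uniq (cnt F.c₁ v₂)
            u₂′ = F.u₃′
            seen₃? : Dec (cnt c₁ v₃ d ≡ 0) → Filling
            seen₃? (yes unseen₃) = fill-from (↭-prep v₁ (↭-trans (↭-swap v₄ v₂ ↭-refl) (↭-prep v₂ (↭-swap v₄ v₃ ↭-refl))))
              (fill-distinct-ends good₁ (~-sym e₃₄) (~-sym e₂₃) (d₂₄ ∘ sym) (n₂₄ ∘ ~-sym) b₄′ b₃′ b₂′ u₃′
                (subst (2 ≤_) (sym (uniq-nonadj c b₁ e (n₁₄ ∘ ~-sym))) u₄) (u₂-fresh unseen) valid-d unseen₃)
            seen₃? (no seen₃) = by-kind kind₁
              where
              seen₃′ : cnt c v₃ d ≢ 0
              seen₃′ = seen₃ ∘ trans (cnt-update-nonadj c b₁ e (n₁₃ ∘ ~-sym) d)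
              by-kind : 1 ≤ rep (cnt c v₁) ⊎ 2 ≤ uniq (cnt c v₁) → Filling
              by-kind (inj₂ u₁) = fill-from (∷↭∷ʳ v₄ (v₁ ∷ v₂ ∷ v₃ ∷ []))
                (fill-mixed F.good₁ e₁₂ e₂₃ d₁₃ n₁₃ F.b₄′ F.b₃′ F.b₂′ u₂′
                  (subst (2 ≤_) (sym (uniq-nonadj c b₄ d n₁₄)) u₁) (F.r₂-seen seen₃′))
              by-kind (inj₁ r₁) = [ (λ (e′ , valid-e′ , seen′) → fill-path-seen u₄ valid-e′ seen′) , none ]′ (find-seen c v₁ v₂)
                where
                none : (∀ a → Valid c v₁ a → cnt c v₂ a ≡ 0) → Filling
                none unseen-all = fill-from (↭-trans (∷↭∷ʳ v₄ (v₂ ∷ v₁ ∷ v₃ ∷ [])) (↭-swap v₂ v₁ ↭-refl))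
                  (fill-repeated-ends F.good₁ e₁₂ e₂₃ d₁₃ n₁₃ F.b₄′ F.b₃′ F.b₂′ u₂′ F.two₁ t₂
                    (≤-trans r₁ (rep-⊑ F.ext₁ v₁)) (F.r₂-seen seen₃′)
                    (λ a valid-a → trans (cnt-update-nonadj c b₄ d n₂₄ a)
                      (unseen-all a (valid-before good (common-uniq good two t₄ (d₁₄ ∘ sym) b₄ b₁) b₄ valid-a))))

    -- A fresh choice at an end reduces to `fill-mixed`. Otherwise `v₂` gets a repetition from `v₁`;
    -- and if `v₂` can take a colour seen at `v₃`, that colour is forced to be valid for `v₄` as
    -- well.
    fill-path-repeated : 1 ≤ rep (cnt c v₁) → 1 ≤ rep (cnt c v₄) → Filling
    fill-path-repeated r₁ r₄ = [ fresh₁ , (λ seen₁ → [ fresh₄ , both seen₁ ]′ (find-fresh c v₄ v₃)) ]′ (find-fresh c v₁ v₂)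
      where
      fresh₁ : (∃ λ e → Valid c v₁ e × cnt c v₂ e ≡ 0) → Filling
      fresh₁ (e , valid-e , unseen) = fill-∷ e
        (fill-mixed good₁ e₂₃ e₃₄ d₂₄ n₂₄ b₂′ b₃′ b₄′ u₃′ (u₂-fresh unseen) (≤-trans r₄ (rep-⊑ ext₁ v₄)))
        where open First valid-e
      fresh₄ : (∃ λ d → Valid c v₄ d × cnt c v₃ d ≡ 0) → Filling
      fresh₄ (d , valid-d , unseen) = fill-from reverse-perm
        (fill-mixed F.good₁ (~-sym e₂₃) (~-sym e₁₂) (d₁₃ ∘ sym) (n₁₃ ∘ ~-sym) F.b₂′ F.b₃′ F.b₄′ F.u₃′
          (F.u₂-fresh unseen) (≤-trans r₁ (rep-⊑ F.ext₁ v₁)))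
        where module F = P′.First valid-d
      both : (∀ e → Valid c v₁ e → cnt c v₂ e ≢ 0) → (∀ d → Valid c v₄ d → cnt c v₃ d ≢ 0) → Filling
      both seen₁ seen₄ = after-choice (first-end good e₁₂ e₂₃ d₁₃ n₁₃ b₁ b₂ b₃ u₂)
        where
        after-choice : (∃ λ e → Valid c v₁ e) → Filling
        after-choice (e , valid-e) = [ same , distinct ]′ (find-seen c₁ v₂ v₃)
          where
          open First valid-e
          r₂ : 1 ≤ rep (cnt c₁ v₂)
          r₂ = r₂-seen (seen₁ e valid-e)
          r₄′ : 1 ≤ rep (cnt c₁ v₄)
          r₄′ = ≤-trans r₄ (rep-⊑ ext₁ v₄)
          same : (∃ λ α → Valid c₁ v₂ α × cnt c₁ v₃ α ≢ 0) → Filling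
          same (α , valid-α , seen) = fill-from (↭-prep v₁ (↭-prep v₂ (↭-swap v₄ v₃ ↭-refl)))
            (fill-same-ends good₁ e₂₃ e₃₄ d₂₄ n₂₄ b₂′ b₃′ b₄′ u₃′ two₁ t₃ valid-α
              (forced good₁ b₄′ (total≤1+g c₁ (two-blank-nbrs≤free c₁ d₂₄ (~-sym e₂₃) b₂′ e₃₄ b₄′)) (n≢0⇒n>0 seen)
                (+-mono-≤ r₄′ (≤-trans (σ-blank-slack c₁ b₃′ (slack-h good₁ e₃₄ b₄′ u₃′)) (σ≤gain c₁ (~-sym e₃₄))))
                (λ a valid-a unseen → seen₄ a (valid-before good (common-uniq good two t₁ d₁₄ b₁ b₄) b₁ valid-a)
                  (trans (sym (cnt-update-nonadj c b₁ e (n₁₃ ∘ ~-sym) a)) unseen)))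
              (n≢0⇒n>0 seen))
          distinct : (∀ a → Valid c₁ v₂ a → cnt c₁ v₃ a ≡ 0) → Filling
          distinct unseen = fill-from (↭-prep v₁ (↭-swap v₃ v₂ ↭-refl))
            (fill-repeated-ends good₁ e₂₃ e₃₄ d₂₄ n₂₄ b₂′ b₃′ b₄′ u₃′ two₁ t₃ r₂ r₄′ unseen)

  fill-path : ∀ {c v₁ v₂ v₃ v₄} → Path c v₁ v₂ v₃ v₄ → ¬ v₁ ~ v₄ → 1 ≤ rep (cnt c v₁) ⊎ 2 ≤ uniq (cnt c v₁) →
    1 ≤ rep (cnt c v₄) ⊎ 2 ≤ uniq (cnt c v₄) → Fill c (v₁ ∷ v₂ ∷ v₃ ∷ v₄ ∷ [])
  fill-path p n₁₄ kind₁ (inj₂ u₄) = fill-path-distinct p n₁₄ u₄ kind₁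
  fill-path p n₁₄ (inj₂ u₁) kind₄ = fill-↭ reverse-perm (fill-path-distinct (reverse-path p) (n₁₄ ∘ ~-sym) u₁ kind₄)
  fill-path p n₁₄ (inj₁ r₁) (inj₁ r₄) = fill-path-repeated p n₁₄ r₁ r₄

  -- The savings 2 + 2 from `v₂` and `v₄` let `v₁` avoid the two colours at `v₄`, which keeps its
  -- unique colours. If neither `v₂` nor `v₄` has a choice fresh at `v₃`, both can take the same
  -- colour.
  fill-square : ∀ {c v₁ v₂ v₃ v₄} → Path c v₁ v₂ v₃ v₄ → v₁ ~ v₄ → Fill c (v₁ ∷ v₂ ∷ v₃ ∷ v₄ ∷ [])
  fill-square {c} {v₁} {v₂} {v₃} {v₄} p e₁₄ = after-choice (choose-avoiding good b₁ (cnt c v₄) surplus)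
    where
    open Path p
    S : List (Fin n)
    S = v₁ ∷ v₂ ∷ v₃ ∷ v₄ ∷ []
    free₄ : 2 ≤ free c v₄
    free₄ = two-blank-nbrs≤free c d₁₃ (~-sym e₁₄) b₁ (~-sym e₃₄) b₃
    u₁ : 2 ≤ uniq (cnt c v₁)
    u₁ = two⇒uniq good two t₁ (two-blank-nbrs≤free c d₂₄ e₁₂ b₂ e₁₄ b₄)
    u₄ : 2 ≤ uniq (cnt c v₄)
    u₄ = two⇒uniq good two t₄ free₄
    surplus : 2 + sum (cnt c v₄) ≤ rep (cnt c v₁) + gain c v₁
    surplus = ≤-trans (+-monoʳ-≤ 2 (total≤1+g c free₄)) (≤-trans
      (+-mono-≤ (σ-blank-slack c b₂ (slack-h good (~-sym e₁₂) b₁ u₂)) (σ-blank-slack c b₄ (slack-h good (~-sym e₁₄) b₁ u₄)))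
      (≤-trans (σ+σ≤gain c d₂₄ e₁₂ e₁₄) (m≤n+m _ (rep (cnt c v₁)))))
    after-choice : (∃ λ e → cnt c v₄ e ≡ 0 × Valid c v₁ e) → Fill c S
    after-choice (e , unseen₄ , valid-e) = seen? (cnt c v₂ e ≟ⁿ 0)
      where
      open First valid-e
      u₄′ : 2 ≤ uniq (cnt c₁ v₄)
      u₄′ = ≤-trans u₄ (uniq≤uniq-fresh c b₁ e (~-sym e₁₄) unseen₄)
      seen? : Dec (cnt c v₂ e ≡ 0) → Fill c S
      seen? (no seen) = fill-from perm
        (fill-mixed good₁ (~-sym e₃₄) (~-sym e₂₃) (d₂₄ ∘ sym) (n₂₄ ∘ ~-sym) b₄′ b₃′ b₂′ u₃′ u₄′ (r₂-seen seen))
      seen? (yes unseen₂) = [ fresh₂ , (λ seen₂ → [ fresh₄ , both seen₂ ]′ (find-fresh c₁ v₄ v₃)) ]′ (find-fresh c₁ v₂ v₃)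
        where
        u₂′ : 2 ≤ uniq (cnt c₁ v₂)
        u₂′ = u₂-fresh unseen₂
        fresh₂ : (∃ λ a → Valid c₁ v₂ a × cnt c₁ v₃ a ≡ 0) → Fill c S
        fresh₂ (a , valid-a , unseen) = fill-from (↭-prep v₁ (↭-prep v₂ (↭-swap v₄ v₃ ↭-refl)))
          (fill-distinct-ends good₁ e₂₃ e₃₄ d₂₄ n₂₄ b₂′ b₃′ b₄′ u₃′ u₂′ u₄′ valid-a unseen)
        fresh₄ : (∃ λ a → Valid c₁ v₄ a × cnt c₁ v₃ a ≡ 0) → Fill c S
        fresh₄ (a , valid-a , unseen) = fill-from (↭-prep v₁ (∷↭∷ʳ v₄ (v₂ ∷ v₃ ∷ [])))
          (fill-distinct-ends good₁ (~-sym e₃₄) (~-sym e₂₃) (d₂₄ ∘ sym) (n₂₄ ∘ ~-sym) b₄′ b₃′ b₂′ u₃′ u₄′ u₂′ valid-a unseen)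
        both : (∀ a → Valid c₁ v₂ a → cnt c₁ v₃ a ≢ 0) → (∀ a → Valid c₁ v₄ a → cnt c₁ v₃ a ≢ 0) → Fill c S
        both seen₂ seen₄ = same (first-end good₁ e₂₃ e₃₄ d₂₄ n₂₄ b₂′ b₃′ b₄′ u₃′)
          where
          same : (∃ λ α → Valid c₁ v₂ α) → Fill c S
          same (α , valid-α) = fill-from (↭-prep v₁ (↭-prep v₂ (↭-swap v₄ v₃ ↭-refl)))
            (fill-same-ends good₁ e₂₃ e₃₄ d₂₄ n₂₄ b₂′ b₃′ b₄′ u₃′ two₁ t₃ valid-α
              (forced good₁ b₄′ (total≤1+g c₁ (two-blank-nbrs≤free c₁ d₂₄ (~-sym e₂₃) b₂′ e₃₄ b₄′)) seen-α
                (≤-trans (+-mono-≤ (σ-slack≥1 c₁ slack₁) (σ-blank-slack c₁ b₃′ (slack-h good₁ e₃₄ b₄′ u₃′)))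
                  (≤-trans (σ+σ≤gain c₁ d₁₃ (~-sym e₁₄) (~-sym e₃₄)) (m≤n+m _ (rep (cnt c₁ v₄)))))
                seen₄)
              seen-α)
            where
            seen-α : 1 ≤ cnt c₁ v₃ α
            seen-α = n≢0⇒n>0 (seen₂ α valid-α)
            slack₁ : Slack c₁ v₁
            slack₁ = slack-h good₁ e₁₄ b₄′ (subst (2 ≤_) (sym (uniq-self c b₁ e)) u₁)

  -- Triangles

  module _ {c : Partial} (good : Good c) {v₁ v₂ v₃ : Fin n} (e₁₂ : v₁ ~ v₂) (e₂₃ : v₂ ~ v₃) (e₁₃ : v₁ ~ v₃)
           (b₁ : c v₁ ≡ nothing) (b₂ : c v₂ ≡ nothing) (b₃ : c v₃ ≡ nothing)
           (u₁ : 2 ≤ uniq (cnt c v₁)) (u₂ : 2 ≤ uniq (cnt c v₂)) where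

    -- The repetition lands on `v₃`, which is coloured last; `v₁` and `v₂` still have two unique
    -- colours to pay with.
    fill-triangle-seen : ∀ {e} → Valid c v₁ e → cnt c v₂ e ≡ 0 → cnt c v₃ e ≢ 0 → Fill c (v₁ ∷ v₂ ∷ v₃ ∷ [])
    fill-triangle-seen {e} valid-e unseen₂ seen₃ = fill-∷ e (fill-step
      (colour-two good₁ c₁v₂ (~⇒≢ e₁₃) (~-sym e₁₂) e₂₃
        (σ-slack≥1 c₁ (slack-h good₁ e₁₂ c₁v₂ (subst (2 ≤_) (sym (uniq-self c b₁ e)) u₁))) (σ-blank c₁ c₁v₃))
      λ a good₂ → let c₂v₃ = still-blank c₁ a (~⇒≢ e₂₃) c₁v₃ in fill-one
      (colour-rep good₂ c₂v₃ (≤-trans rep₃ (rep-⊑ (⊑-update c₁ a c₁v₂) v₃)) (~-sym e₂₃)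
        (σ-slack≥1 _ (slack-h good₂ e₂₃ c₂v₃ (subst (2 ≤_) (sym (uniq-self c₁ c₁v₂ a)) u₂′)))))
      where
      c₁ : Partial
      c₁ = c [ v₁ ↦ e ]
      good₁ : Good c₁
      good₁ = valid⇒good good b₁ valid-e
      c₁v₂ : c₁ v₂ ≡ nothing
      c₁v₂ = still-blank c e (~⇒≢ e₁₂) b₂
      c₁v₃ : c₁ v₃ ≡ nothing
      c₁v₃ = still-blank c e (~⇒≢ e₁₃) b₃
      rep₃ : 1 ≤ rep (cnt c₁ v₃)
      rep₃ = rep-repeated c b₁ e (~-sym e₁₃) (n≢0⇒n>0 seen₃)
      u₂′ : 2 ≤ uniq (cnt c₁ v₂)
      u₂′ = ≤-trans u₂ (uniq≤uniq-fresh c b₁ e (~-sym e₁₂) unseen₂)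

  -- If the colour of `v₂` is fresh at `v₁`, then `v₁` and `v₂` pay for `v₃`. A common neighbour of
  -- all three provides the surplus for such a choice; without one, colours valid after `v₁` were
  -- valid before, and the roles can be rotated.
  fill-triangle : ∀ {c v₁ v₂ v₃} → Good c → T v₁ → v₁ ~ v₂ → v₂ ~ v₃ → v₁ ~ v₃ → c v₁ ≡ nothing → c v₂ ≡ nothing → c v₃ ≡ nothing →
    (∀ y → T y → 2 ≤ free c y → deg y ≡ 4 × free c y ≡ A y v₁ + (A y v₂ + A y v₃)) → Fill c (v₁ ∷ v₂ ∷ v₃ ∷ [])
  fill-triangle {c} {v₁} {v₂} {v₃} good t₁ e₁₂ e₂₃ e₁₃ b₁ b₂ b₃ local = after-choice (choose-avoiding good b₁ (cnt c v₂) surplus)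
    where
    S : List (Fin n)
    S = v₁ ∷ v₂ ∷ v₃ ∷ []
    d₁₂ : v₁ ≢ v₂
    d₁₂ = ~⇒≢ e₁₂
    d₁₃ : v₁ ≢ v₃
    d₁₃ = ~⇒≢ e₁₃
    d₂₃ : v₂ ≢ v₃
    d₂₃ = ~⇒≢ e₂₃
    f₁ : 2 ≤ free c v₁
    f₁ = two-blank-nbrs≤free c d₂₃ e₁₂ b₂ e₁₃ b₃
    f₂ : 2 ≤ free c v₂
    f₂ = two-blank-nbrs≤free c d₁₃ (~-sym e₁₂) b₁ e₂₃ b₃
    f₃ : 2 ≤ free c v₃
    f₃ = two-blank-nbrs≤free c d₁₂ (~-sym e₁₃) b₁ (~-sym e₂₃) b₂
    exactly : ∀ {y} → T y → 2 ≤ free c y → A y v₁ + (A y v₂ + A y v₃) ≡ 2 → 2 ≤ uniq (cnt c y)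
    exactly ty 2≤f eq = uniq≥2 good (trans (proj₂ (local _ ty 2≤f)) eq) (proj₁ (local _ ty 2≤f))
    u₁ : 2 ≤ uniq (cnt c v₁)
    u₁ = exactly t₁ f₁ (cong₂ _+_ (A-diag v₁) (cong₂ _+_ (A≡1 e₁₂) (A≡1 e₁₃)))
    u₂ : 2 ≤ uniq (cnt c v₂)
    u₂ = exactly (closed t₁ e₁₂) f₂ (cong₂ _+_ (A≡1 (~-sym e₁₂)) (cong₂ _+_ (A-diag v₂) (A≡1 e₂₃)))
    u₃ : 2 ≤ uniq (cnt c v₃)
    u₃ = exactly (closed t₁ e₁₃) f₃ (cong₂ _+_ (A≡1 (~-sym e₁₃)) (cong₂ _+_ (A≡1 (~-sym e₂₃)) (A-diag v₃)))
    surplus : 2 + sum (cnt c v₂) ≤ rep (cnt c v₁) + gain c v₁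
    surplus = ≤-trans (+-monoʳ-≤ 2 (total≤1+g c f₂)) (≤-trans
      (+-mono-≤ (σ-blank-slack c b₂ (slack-h good (~-sym e₁₂) b₁ u₂)) (σ-blank-slack c b₃ (slack-h good (~-sym e₁₃) b₁ u₃)))
      (≤-trans (σ+σ≤gain c d₂₃ e₁₂ e₁₃) (m≤n+m _ (rep (cnt c v₁)))))
    after-choice : (∃ λ e → cnt c v₂ e ≡ 0 × Valid c v₁ e) → Fill c S
    after-choice (e , unseen₂ , valid-e) = seen? (cnt c v₃ e ≟ⁿ 0)
      where
      c₁ : Partial
      c₁ = c [ v₁ ↦ e ]
      good₁ : Good c₁
      good₁ = valid⇒good good b₁ valid-e
      c₁v₂ : c₁ v₂ ≡ nothing
      c₁v₂ = still-blank c e d₁₂ b₂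
      c₁v₃ : c₁ v₃ ≡ nothing
      c₁v₃ = still-blank c e d₁₃ b₃
      u₁′ : 2 ≤ uniq (cnt c₁ v₁)
      u₁′ = subst (2 ≤_) (sym (uniq-self c b₁ e)) u₁
      u₂′ : 2 ≤ uniq (cnt c₁ v₂)
      u₂′ = ≤-trans u₂ (uniq≤uniq-fresh c b₁ e (~-sym e₁₂) unseen₂)
      finish-fresh : ∀ d → Valid c₁ v₂ d → cnt c₁ v₁ d ≡ 0 → Fill c S
      finish-fresh d valid-d unseen₁ = fill-∷ e (fill-∷ d (fill-one
        (colour-two good₂ c₂v₃ d₁₂ (~-sym e₁₃) (~-sym e₂₃)
          (σ-slack≥1 _ (slack-h good₂ e₁₃ c₂v₃ (≤-trans u₁′ (uniq≤uniq-fresh c₁ c₁v₂ d e₁₂ unseen₁))))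
          (σ-slack≥1 _ (slack-h good₂ e₂₃ c₂v₃ (subst (2 ≤_) (sym (uniq-self c₁ c₁v₂ d)) u₂′))))))
        where
        good₂ : Good (c₁ [ v₂ ↦ d ])
        good₂ = valid⇒good good₁ c₁v₂ valid-d
        c₂v₃ : (c₁ [ v₂ ↦ d ]) v₃ ≡ nothing
        c₂v₃ = still-blank c₁ d d₂₃ c₁v₃
      seen? : Dec (cnt c v₃ e ≡ 0) → Fill c S
      seen? (no seen₃)    = fill-triangle-seen good e₁₂ e₂₃ e₁₃ b₁ b₂ b₃ u₁ u₂ valid-e unseen₂ seen₃
      seen? (yes unseen₃) = common? (any? (λ y → (y ~? v₁) ×-dec ((y ~? v₂) ×-dec (y ~? v₃))))
        where
        slack₁ : Slack c₁ v₁
        slack₁ = slack-h good₁ e₁₂ c₁v₂ u₁′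
        slack₃ : Slack c₁ v₃
        slack₃ = slack-h good₁ (~-sym e₂₃) c₁v₂
          (≤-trans u₃ (uniq≤uniq-fresh c b₁ e (~-sym e₁₃) unseen₃))
        common? : Dec (∃ λ y → y ~ v₁ × y ~ v₂ × y ~ v₃) → Fill c S
        common? (yes (y , y~v₁ , y~v₂ , y~v₃)) = after (choose-avoiding good₁ c₁v₂ (cnt c₁ v₁) surplus₁)
          where
          ty : T y
          ty = closed t₁ (~-sym y~v₁)
          free-y : free c y ≡ 3
          free-y = trans (proj₂ (local y ty (two-blank-nbrs≤free c d₁₂ y~v₁ b₁ y~v₂ b₂)))
            (cong₂ _+_ (A≡1 y~v₁) (cong₂ _+_ (A≡1 y~v₂) (A≡1 y~v₃)))
          uniq-y : 2 ≤ uniq (cnt c₁ y)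
          uniq-y = uniq≥2 good₁ (trans (free-update-adj c b₁ e y~v₁) (cong pred free-y))
            (proj₁ (local y ty (two-blank-nbrs≤free c d₁₂ y~v₁ b₁ y~v₂ b₂)))
          -- One saving from `v₁`, two from the blank `v₃`, one from `y`: just 2 plus the two
          -- colours at `v₁`.
          surplus₁ : 2 + sum (cnt c₁ v₁) ≤ rep (cnt c₁ v₂) + gain c₁ v₂
          surplus₁ = ≤-trans (+-monoʳ-≤ 2 (total≤1+g c₁ (two-blank-nbrs≤free c₁ d₂₃ e₁₂ c₁v₂ e₁₃ c₁v₃))) (≤-trans
            (+-mono-≤ (σ-slack≥1 c₁ slack₁) (+-mono-≤ (σ-blank-slack c₁ c₁v₃ slack₃)
              (σ-slack≥1 c₁ (slack-h good₁ y~v₂ c₁v₂ uniq-y))))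
            (≤-trans (σ+σ+σ≤gain c₁ d₁₃ (~⇒≢ (~-sym y~v₁)) (~⇒≢ (~-sym y~v₃)) (~-sym e₁₂) e₂₃ (~-sym y~v₂))
              (m≤n+m _ (rep (cnt c₁ v₂)))))
          after : (∃ λ d → cnt c₁ v₁ d ≡ 0 × Valid c₁ v₂ d) → Fill c S
          after (d , unseen₁ , valid-d) = finish-fresh d valid-d unseen₁
        common? (no none) = after (choose good₁ c₁v₂ (≤-trans (σ-blank-slack c₁ c₁v₃ slack₃)
            (≤-trans (σ≤gain c₁ e₂₃) (m≤n+m _ (rep (cnt c₁ v₂))))))
          where
          after : (∃ λ d → Valid c₁ v₂ d) → Fill c S
          after (d , valid-d) = by-cases (cnt c₁ v₁ d ≟ⁿ 0) (cnt c₁ v₃ d ≟ⁿ 0)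
            where
            common : ∀ y → y ~ v₁ → y ~ v₂ → 2 ≤ uniq (cnt c y)
            common y y~v₁ y~v₂ = exactly (closed t₁ (~-sym y~v₁)) (two-blank-nbrs≤free c d₁₂ y~v₁ b₁ y~v₂ b₂) (cong₂ _+_ (A≡1 y~v₁)
              (cong₂ _+_ (A≡1 y~v₂) (A≡0 (λ y~v₃ → none (y , y~v₁ , y~v₂ , y~v₃)))))
            by-cases : Dec (cnt c₁ v₁ d ≡ 0) → Dec (cnt c₁ v₃ d ≡ 0) → Fill c S
            by-cases (yes unseen₁) _ = finish-fresh d valid-d unseen₁
            by-cases (no _) (no seen) = fill-∷ e (fill-∷ d (fill-one
              (colour-rep good₂ c₂v₃ (rep-repeated c₁ c₁v₂ d (~-sym e₂₃) (n≢0⇒n>0 seen)) (~-sym e₂₃)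
                (σ-slack≥1 _ (slack-h good₂ e₂₃ c₂v₃ (subst (2 ≤_) (sym (uniq-self c₁ c₁v₂ d)) u₂′))))))
              where
              good₂ : Good (c₁ [ v₂ ↦ d ])
              good₂ = valid⇒good good₁ c₁v₂ valid-d
              c₂v₃ : (c₁ [ v₂ ↦ d ]) v₃ ≡ nothing
              c₂v₃ = still-blank c₁ d d₂₃ c₁v₃
            -- Restart from `c` with `v₂` first: `d` is fresh at `v₃` and repeats a colour at `v₁`.
            by-cases (no seen₁) (yes unseen) = fill-↭ (↭-sym (∷↭∷ʳ v₁ (v₂ ∷ v₃ ∷ [])))
              (fill-triangle-seen good e₂₃ (~-sym e₁₃) (~-sym e₁₂) b₂ b₃ b₁ u₂ u₃
                (valid-before good common b₁ valid-d)
                (n≤0⇒n≡0 (≤-trans (cnt-mono c b₁ e v₃ d) (≤-reflexive unseen)))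
                (seen₁ ∘ trans (cnt-update-nonadj c b₁ e (~-irrefl v₁) d)))

-- Maximum degree at least h + 3: choosing what to colour last

module Strict {n : ℕ} {G : Graph n} {k h D : ℕ} (setting : Colourings.Setting G k h h D) (h+3≤D : h + 3 ≤ D) where

  open PartialColourings setting

  Full Thin : VertexSet → Set
  Full U = ∀ {v} → U v ≡ false → deg v ≡ D
  Thin U = ∀ {v} → U v ≡ false → outside U v ≤ 1

  Smaller : VertexSet → Set
  Smaller U = ∀ v vs → U v ≡ false → Colourable (addAll (v ∷ vs) U)

  outside-nbr : ∀ U {w} → outside U w ≡ 1 → ∃ λ z → U z ≡ true × w ~ z
  outside-nbr U {w} eq with any? (λ z → (U z ≟ᵇ true) ×-dec (w ~? z))
  ... | yes found = found
  ... | no none with trans (sym eq) (sum-zero pointwise)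
    where
    pointwise : ∀ z → A w z * ⟦ U z ⟧ ≡ 0
    pointwise z with w ~? z | U z in Uz
    ... | no w≁z  | _     = cong (_* _) (A≡0 w≁z)
    ... | yes w~z | true  = contradiction (z , Uz , w~z) none
    ... | yes _   | false = *-zeroʳ (A w z)
  ...   | ()

  true∉ : ∀ {U vs y} → U y ≡ true → Avoids U vs → y ∉ vs
  true∉ Uy avoids y∈ = false≢true (lookup avoids y∈) Uy

  -- A vertex of degree below `D`, or with two neighbours in `U`, can be coloured last on its own.
  reduce-to : (∀ U v → U v ≡ false → Full U → Thin U → Smaller U → Colourable U) → Colourable (λ _ → false)
  reduce-to core = colourable-by-induction (λ _ → ⊤) reduce (λ _ → false) tt
    where
    reduce : ∀ U v → U v ≡ false → ⊤ → (∀ v vs → U v ≡ false → ⊤ → Colourable (addAll (v ∷ vs) U)) → Colourable U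
    reduce U v Uv _ IH = by-low (low? U)
      where
      crowded : ∀ w → U w ≡ false → 2 ≤ outside U w → Colourable (add w U) → Colourable U
      crowded w Uw many (c , good , blankOn) = complete {vs = w ∷ []} blankOn (Uw ∷ []) (fill-one
        (colour-gain good (blank-in blankOn (add-self w U)) (≤-trans (≤-trans many (≤-trans (m≤m+n _ (A w w))
          (≤-reflexive (sym (trans (free≡outside blankOn w) (outside-add U w Uw)))))) (free≤gain c w))))
      by-crowd : Full U → Dec (∃ λ w → U w ≡ false × 2 ≤ outside U w) → Colourable U
      by-crowd _ (yes (w , Uw , many)) = crowded w Uw many (IH w [] Uw tt)
      by-crowd full (no none) = core U v Uv full (λ {w} Uw → ≤-pred (≰⇒> (λ many → none (w , Uw , many))))
        (λ w ws Uw → IH w ws Uw tt)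
      by-low : Dec (∃ λ w → U w ≡ false × deg w < D) → Colourable U
      by-low (yes (w , Uw , low)) = colour-low-vertex Uw low (IH w [] Uw tt)
      by-low (no none) = by-crowd (all-full {U} none) (any? (λ w → (U w ≟ᵇ false) ×-dec (2 ≤? outside U w)))

  colourable-roomy : h + 4 ≤ D → Colourable (λ _ → false)
  colourable-roomy room = reduce-to core
    where
    module R = Roomy setting room
    core : ∀ U v → U v ≡ false → Full U → Thin U → Smaller U → Colourable U
    core U v Uv full thin IH = [ by-cycle , by-rooted ]′ (cycle-or-rooted U branching (λ _ → thin) v Uv)
      where
      branching : ∀ v → U v ≡ false → 2 + outside U v ≤ deg v
      branching v Uv = ≤-trans (+-monoʳ-≤ 2 (thin Uv)) (≤-trans (m≤n+m 3 h) (≤-trans h+3≤D (≤-reflexive (sym (full Uv)))))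
      by-cycle : Cycle U → Colourable U
      by-cycle cyc = finish (IH z (u ∷ x ∷ ws) (All.head avoids))
        where
        open Cycle cyc
        finish : Colourable (addAll (z ∷ u ∷ x ∷ ws) U) → Colourable U
        finish (c , good , blankOn) = complete blankOn avoids (R.fill-cycle good walk unique
          (All.tabulate λ {w} w∈ → blank-in blankOn (addAll-∈ {z ∷ u ∷ x ∷ ws} U w∈) , full (lookup avoids w∈)
            , trans (free≡ blankOn unique avoids w) (lookup balanced w∈)))
      by-rooted : Rooted U → Colourable U
      by-rooted r = finish (IH z (w ∷ ws) (All.head avoids)) (outside-nbr U root)
        where
        open Rooted r
        finish : Colourable (addAll (z ∷ w ∷ ws) U) → (∃ λ y → U y ≡ true × z ~ y) → Colourable U
        finish (c , good , blankOn) (y , Uy , z~y) = complete blankOn avoids (R.fill-rooted good walk unique blankOn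
          (full (All.head avoids)) root z~y Uy (true∉ Uy avoids)
          (All.tabulate λ {v} v∈ → full (lookup avoids (there v∈)) , trans (free≡ blankOn unique avoids v) (lookup balanced v∈)))

  module _ (D≡ : 3 + h ≡ D) where

    open Tight D≡

    base⇒1+h≤uniq : ∀ {c x} → 2 ≤ free c x → Base c x → suc h ≤ uniq (cnt c x)
    base⇒1+h≤uniq {c} {x} 2≤f base-x = +-cancelʳ-≤ (suc h) (suc h) _ (≤-trans base-x (+-monoʳ-≤ (uniq (cnt c x)) (total≤1+g c 2≤f)))

    -- Without repetitions `uniq = total ≥ D - 2 = h + 1`.
    rep-or-uniq : ∀ (c : Partial) x → deg x ≡ D → free c x ≤ 2 → 1 ≤ rep (cnt c x) ⊎ suc h ≤ uniq (cnt c x)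
    rep-or-uniq c x deg≡ few with rep (cnt c x) in eq
    ... | suc _ = inj₁ (s≤s z≤n)
    ... | zero  = inj₂ (subst (suc h ≤_) (sym (rep≡0⇒uniq≡total (cnt c x) eq)) (+-cancelʳ-≤ 2 (suc h) _
        (≤-trans (≤-reflexive (trans (+-comm (suc h) 2) (trans D≡ (trans (sym deg≡) (sym (total+free≡deg c x))))))
          (+-monoʳ-≤ (total (cnt c x)) few))))

    -- The edge from `w` to a neighbour `x` outside `U` goes last. Exactly `z` and `x` are blank
    -- around `w`, so `w` sees `h + 1` unique colours.
    colour-at-boundary : ∀ {U w z} → Full U → Thin U → Smaller U → U w ≡ false → U z ≡ true → w ~ z → Colourable U
    colour-at-boundary {U} {w} {z} full thin IH Uw Uz w~z = with-nbr (inner-nbr U w w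
        (≤-trans (+-monoʳ-≤ 2 (thin Uw)) (≤-trans (m≤n+m 3 h) (≤-trans h+3≤D (≤-reflexive (sym (full Uw)))))))
      where
      with-nbr : (∃ λ x → w ~ x × U x ≡ false × x ≢ w) → Colourable U
      with-nbr (x , w~x , Ux , _) = finish (IH w (x ∷ []) Uw)
        where
        avoids : Avoids U (w ∷ x ∷ [])
        avoids = Uw ∷ Ux ∷ []
        unique : Unique (w ∷ x ∷ [])
        unique = (~⇒≢ w~x ∷ []) ∷ [] ∷ []
        finish : Colourable (addAll (w ∷ x ∷ []) U) → Colourable U
        finish (c , good , blankOn) with all-blank {U = U} {w ∷ x ∷ []} blankOn
        ... | cw ∷ cx ∷ [] = complete {vs = w ∷ x ∷ []} blankOn avoids (fill-edge good cw cx
                (blank-in blankOn (addAll-⊇ (w ∷ x ∷ []) U Uz)) w~x w~z (λ { refl → false≢true Ux Uz })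
                (inj₁ (base⇒1+h≤uniq (≤-reflexive (sym free-w)) (base good (full Uw) free-w)
                  , swap (rep-or-uniq c x (full Ux) few-x))))
          where
          free-w : free c w ≡ 2
          free-w = trans (free≡ blankOn unique avoids w) (cong₂ _+_ (≤-antisym (thin Uw) (outside≥1 U w~z Uz))
            (cong₂ _+_ (A-diag w) (cong (_+ 0) (A≡1 w~x))))
          few-x : free c x ≤ 2
          few-x = ≤-trans (≤-reflexive (free≡ blankOn unique avoids x)) (+-mono-≤ (thin Ux)
            (≤-reflexive (cong₂ _+_ (A≡1 (~-sym w~x)) (cong (_+ 0) (A-diag x)))))

    colourable-tight : 2 ≤ h → Colourable (λ _ → false)
    colourable-tight 2≤h = reduce-to core
      where
      core : ∀ U v → U v ≡ false → Full U → Thin U → Smaller U → Colourable U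
      core U v Uv full thin IH = by-cases (closed-or-boundary U)
        where
        by-cases : Closed U ⊎ Boundary U → Colourable U
        by-cases (inj₁ closed) =
          colour-closed D≡ closed full (λ v vs avoids _ → IH v vs (All.head avoids)) (+-monoˡ-≤ h 2≤h) v Uv
        by-cases (inj₂ (w , z , Uw , Uz , w~z)) = colour-at-boundary full thin IH Uw Uz w~z

-- Choice of a triangle or path in the quartic case

module StrictQuartic {n : ℕ} {G : Graph n} {k : ℕ} (setting : Colourings.Setting G k 1 1 4) where

  open PartialColourings setting
  open Strict setting ≤-refl

  module _ {U : VertexSet} (closed : Closed U) (full : Full U) (IH : Smaller U) where

    open Quartic setting (λ v → U v ≡ false) closed using (fill-triangle; Path; fill-square; fill-path)

    colour-triangle : ∀ {v₁ v₂ v₃} → U v₁ ≡ false → v₁ ~ v₂ → v₂ ~ v₃ → v₁ ~ v₃ → Colourable U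
    colour-triangle {v₁} {v₂} {v₃} U₁ e₁₂ e₂₃ e₁₃ = finish (IH v₁ (v₂ ∷ v₃ ∷ []) U₁)
      where
      S : List (Fin n)
      S = v₁ ∷ v₂ ∷ v₃ ∷ []
      avoids : Avoids U S
      avoids = U₁ ∷ closed U₁ e₁₂ ∷ closed U₁ e₁₃ ∷ []
      unique : Unique S
      unique = (~⇒≢ e₁₂ ∷ ~⇒≢ e₁₃ ∷ []) ∷ (~⇒≢ e₂₃ ∷ []) ∷ [] ∷ []
      finish : Colourable (addAll S U) → Colourable U
      finish (c , good , blankOn) with all-blank {U = U} {S} blankOn
      ... | b₁ ∷ b₂ ∷ b₃ ∷ [] = complete {vs = S} blankOn avoids (fill-triangle good U₁ e₁₂ e₂₃ e₁₃ b₁ b₂ b₃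
              λ y Uy _ → full Uy , trans (free≡ blankOn unique avoids y) (cong₂ _+_ (closed⇒outside≡0 closed Uy)
                (cong (A y v₁ +_) (cong (A y v₂ +_) (+-identityʳ (A y v₃))))))

    module _ (no-triangle : ∀ {u v w} → U u ≡ false → u ~ v → v ~ w → ¬ u ~ w) where

      edge-nbrs : ∀ {u v} → U u ≡ false → u ~ v → ∀ y → A y u + A y v ≤ 1
      edge-nbrs {u} {v} Uu u~v y with y ~? u | y ~? v
      ... | no y≁u  | _       = ≤-trans (≤-reflexive (cong (_+ A y v) (A≡0 y≁u))) (⟦⟧≤1 (adj G y v))
      ... | yes y~u | no y≁v  = ≤-trans (≤-reflexive (trans (cong (A y u +_) (A≡0 y≁v)) (+-identityʳ _))) (⟦⟧≤1 (adj G y u))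
      ... | yes y~u | yes y~v = contradiction (~-sym y~u) (no-triangle Uu u~v (~-sym y~v))

      -- Without triangles a vertex has at most one neighbour on each of the edges `v₁ v₂` and
      -- `v₃ v₄`, hence at most two blank ones.
      colour-path : ∀ {v₁ v₂ v₃ v₄} → U v₁ ≡ false → v₁ ~ v₂ → v₂ ~ v₃ → v₃ ~ v₄ → v₁ ≢ v₃ → v₂ ≢ v₄ → Colourable U
      colour-path {v₁} {v₂} {v₃} {v₄} U₁ e₁₂ e₂₃ e₃₄ d₁₃ d₂₄ = finish (IH v₁ (v₂ ∷ v₃ ∷ v₄ ∷ []) U₁)
        where
        S : List (Fin n)
        S = v₁ ∷ v₂ ∷ v₃ ∷ v₄ ∷ []
        U₂ : U v₂ ≡ false
        U₂ = closed U₁ e₁₂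
        U₃ : U v₃ ≡ false
        U₃ = closed U₂ e₂₃
        n₁₃ : ¬ v₁ ~ v₃
        n₁₃ = no-triangle U₁ e₁₂ e₂₃
        d₁₄ : v₁ ≢ v₄
        d₁₄ refl = n₁₃ (~-sym e₃₄)
        avoids : Avoids U S
        avoids = U₁ ∷ U₂ ∷ U₃ ∷ closed U₃ e₃₄ ∷ []
        unique : Unique S
        unique = (~⇒≢ e₁₂ ∷ d₁₃ ∷ d₁₄ ∷ []) ∷ (~⇒≢ e₂₃ ∷ d₂₄ ∷ []) ∷ (~⇒≢ e₃₄ ∷ []) ∷ [] ∷ []
        finish : Colourable (addAll S U) → Colourable U
        finish (c , good , blankOn) with all-blank {U = U} {S} blankOn
        ... | b₁ ∷ b₂ ∷ b₃ ∷ b₄ ∷ [] = complete {vs = S} blankOn avoids (by-adjacency (v₁ ~? v₄))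
          where
          regroup : ∀ a b c d → a + (b + (c + (d + 0))) ≡ a + b + (c + d)
          regroup = solve-∀
          few : ∀ {y} → U y ≡ false → free c y ≤ 2
          few {y} Uy = ≤-trans (≤-reflexive (trans (free≡ blankOn unique avoids y) (cong₂ _+_ (closed⇒outside≡0 closed Uy)
              (regroup (A y v₁) (A y v₂) (A y v₃) (A y v₄)))))
            (+-mono-≤ (edge-nbrs U₁ e₁₂ y) (edge-nbrs U₃ e₃₄ y))
          path : Path c v₁ v₂ v₃ v₄
          path = record
            { good = good ; two = λ y Uy 2≤f → ≤-antisym (few Uy) 2≤f , full Uy ; t₁ = U₁
            ; e₁₂ = e₁₂ ; e₂₃ = e₂₃ ; e₃₄ = e₃₄ ; n₁₃ = n₁₃ ; n₂₄ = no-triangle U₂ e₂₃ e₃₄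
            ; d₁₃ = d₁₃ ; d₂₄ = d₂₄ ; d₁₄ = d₁₄ ; b₁ = b₁ ; b₂ = b₂ ; b₃ = b₃ ; b₄ = b₄ }
          kind : ∀ {x} → U x ≡ false → 1 ≤ rep (cnt c x) ⊎ 2 ≤ uniq (cnt c x)
          kind {x} Ux = rep-or-uniq refl c x (full Ux) (few Ux)
          by-adjacency : Dec (v₁ ~ v₄) → Fill c S
          by-adjacency (yes e₁₄) = fill-square path e₁₄
          by-adjacency (no n₁₄)  = fill-path path n₁₄ (kind U₁) (kind (closed U₃ e₃₄))

      colour-triangle-free : ∀ v → U v ≡ false → Colourable U
      colour-triangle-free v₂ U₂ = first (nbr v₂ U₂ v₂)
        where
        nbr : ∀ v → U v ≡ false → ∀ p → ∃ λ u → v ~ u × U u ≡ false × u ≢ p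
        nbr v Uv p = inner-nbr U v p (≤-trans (≤-reflexive (cong (2 +_) (closed⇒outside≡0 closed Uv)))
          (≤-trans (s≤s (s≤s z≤n)) (≤-reflexive (sym (full Uv)))))
        first : (∃ λ u → v₂ ~ u × U u ≡ false × u ≢ v₂) → Colourable U
        first (v₃ , e₂₃ , U₃ , _) = rest (nbr v₂ U₂ v₃) (nbr v₃ U₃ v₂)
          where
          rest : (∃ λ u → v₂ ~ u × U u ≡ false × u ≢ v₃) → (∃ λ u → v₃ ~ u × U u ≡ false × u ≢ v₂) → Colourable U
          rest (v₁ , e₂₁ , U₁ , d₁₃) (v₄ , e₃₄ , _ , d₄₂) = colour-path U₁ (~-sym e₂₁) e₂₃ e₃₄ d₁₃ (d₄₂ ∘ sym)

    colour-quartic : ∀ v → U v ≡ false → Colourable U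
    colour-quartic v Uv = by-cases (any? (λ u → any? (λ v → any? (λ w → (U u ≟ᵇ false) ×-dec ((u ~? v) ×-dec ((v ~? w) ×-dec (u ~? w)))))))
      where
      by-cases : Dec (∃ λ u → ∃ λ v → ∃ λ w → U u ≡ false × u ~ v × v ~ w × u ~ w) → Colourable U
      by-cases (yes (u , v , w , Uu , u~v , v~w , u~w)) = colour-triangle Uu u~v v~w u~w
      by-cases (no none) = colour-triangle-free (λ {u} {v} {w} Uu u~v v~w u~w → none (u , v , w , Uu , u~v , v~w , u~w)) v Uv

  colourable-quartic : Colourable (λ _ → false)
  colourable-quartic = reduce-to core
    where
    core : ∀ U v → U v ≡ false → Full U → Thin U → Smaller U → Colourable U
    core U v Uv full thin IH = by-cases (closed-or-boundary U)
      where
      by-cases : Closed U ⊎ Boundary U → Colourable U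
      by-cases (inj₁ closed) = colour-quartic closed full IH v Uv
      by-cases (inj₂ (w , z , Uw , Uz , w~z)) = colour-at-boundary refl full thin IH Uw Uz w~z

-- Translation to lists and total colourings

length-filter : ∀ {A : Set} {m} {P : A → Set} (P? : ∀ a → Dec (P a)) (f : Fin m → A) →
  length (filter P? (tabulate f)) ≡ sum (λ i → ⟦ does (P? (f i)) ⟧)
length-filter {m = zero}  P? f = refl
length-filter {m = suc m} P? f with does (P? (f zero))
... | true  = cong suc (length-filter P? (f ∘ suc))
... | false = length-filter P? (f ∘ suc)

length-filter₂ : ∀ {A : Set} {m} {P Q : A → Set} (P? : ∀ a → Dec (P a)) (Q? : ∀ a → Dec (Q a)) (f : Fin m → A) →
  length (filter Q? (filter P? (tabulate f))) ≡ sum (λ i → ⟦ does (P? (f i)) ⟧ * ⟦ does (Q? (f i)) ⟧)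
length-filter₂ {m = zero}  P? Q? f = refl
length-filter₂ {m = suc m} P? Q? f with does (P? (f zero))
... | false = length-filter₂ P? Q? (f ∘ suc)
... | true with does (Q? (f zero))
...   | true  = cong suc (length-filter₂ P? Q? (f ∘ suc))
...   | false = length-filter₂ P? Q? (f ∘ suc)

degree≤maxDegree : ∀ {n} (G : Graph n) v → degree G v ≤ maxDegree G
degree≤maxDegree {n} G v = bound (∈-allFin v)
  where
  bound : ∀ {vs} → v ∈ vs → degree G v ≤ foldr _⊔_ 0 (map (degree G) vs)
  bound (here refl) = m≤m⊔n _ _
  bound {u ∷ vs} (there v∈) = ≤-trans (bound v∈) (m≤n⊔m (degree G u) _)

module Conversion {n : ℕ} {G : Graph n} {k h g D : ℕ} (setting : Colourings.Setting G k h g D) where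

  open PartialColourings setting

  deg≡degree : ∀ v → deg v ≡ degree G v
  deg≡degree v = sym (length-filter (λ u → T? (adj G v u)) id)

  -- With no blank vertex left the demand is `deg ⊓ h` everywhere, also when `g < h`.
  has-pcf : Colourable (λ _ → false) → HasPCFColoring h G k
  has-pcf (c , good , blankOn) = colour-of , proper-of , unique-of
    where
    coloured : ∀ (m : Maybe (Fin k)) → blank m ≡ 0 → ∃ λ a → m ≡ just a
    coloured (just a) _ = a , refl
    colour-of : Fin n → Fin k
    colour-of u = proj₁ (coloured (c u) (blankOn u))
    c≡ : ∀ u → c u ≡ just (colour-of u)
    c≡ u = proj₂ (coloured (c u) (blankOn u))
    proper-of : IsProperColoring G colour-of
    proper-of u v u~v same = proper good u~v (c≡ u) (trans (c≡ v) (cong just (sym same)))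
    count≡cnt : ∀ v i → colourCount G colour-of v i ≡ cnt c v i
    count≡cnt v i = trans (length-filter₂ (λ u → T? (adj G v u)) (λ u → colour-of u ≟ i) id)
      (sum-cong-≗ λ u → cong (λ m → A v u * has m i) (sym (c≡ u)))
    one≡ : ∀ x → ⟦ does (x ≟ⁿ 1) ⟧ ≡ one x
    one≡ 0 = refl
    one≡ 1 = refl
    one≡ (suc (suc x)) = refl
    unique≡uniq : ∀ v → length (uniqueColours G colour-of v) ≡ uniq (cnt c v)
    unique≡uniq v = trans (length-filter (λ i → colourCount G colour-of v i ≟ⁿ 1) id)
      (sum-cong-≗ λ i → trans (one≡ (colourCount G colour-of v i)) (cong one (count≡cnt v i)))
    free≡0 : ∀ v → free c v ≡ 0
    free≡0 v = trans (free≡outside blankOn v) (sum-zero {n} {λ u → A v u * 0} (λ u → *-zeroʳ (A v u)))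
    total≡deg : ∀ v → total (cnt c v) ≡ degree G v
    total≡deg v = trans (sym (+-identityʳ _)) (trans (cong (total (cnt c v) +_) (sym (free≡0 v)))
      (trans (total+free≡deg c v) (deg≡degree v)))
    unique-of : ∀ v → degree G v ⊓ h ≤ length (uniqueColours G colour-of v)
    unique-of v = subst₂ _≤_ (trans (cong (λ j → need j (total (cnt c v))) (free≡0 v)) (cong (_⊓ h) (total≡deg v)))
      (sym (unique≡uniq v)) (okAt good v)

theorem1p3 : (h : ℕ) → 1 ≤ h → (n : ℕ) → (G : Graph n) →
    h + 2 ≤ maxDegree G →
    χpcf≤ h G ((h + 1) * maxDegree G ∸ 1)
theorem1p3 h 1≤h n G h+2≤D = k , ≤-refl , by-degree (m≤n⇒m<n∨m≡n h+2≤D)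
  where
  D k : ℕ
  D = maxDegree G
  k = (h + 1) * D ∸ 1
  deg≤D : ∀ v → Colourings.deg G v ≤ D
  deg≤D v = ≤-trans (≤-reflexive (sym (length-filter (λ u → T? (adj G v u)) id))) (degree≤maxDegree G v)
  enough : suc h * D ≤ suc k
  enough = ≤-trans (≤-reflexive (cong (_* D) (+-comm 1 h))) (m≤n+m∸n ((h + 1) * D) 1)
  strict : Colourings.Setting G k h h D
  strict = record { g≤h = ≤-refl ; h≤1+g = n≤1+n h ; 1≤h = 1≤h ; mode = inj₁ refl ; deg≤D = deg≤D ; enough = enough }
  by-degree : h + 2 < D ⊎ h + 2 ≡ D → HasPCFColoring h G k
  by-degree (inj₂ h+2≡D) = Conversion.has-pcf relaxed (PartialColourings.Relaxed.colourable relaxed D≡ h≡)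
    where
    h≡ : suc (pred h) ≡ h
    h≡ = suc-pred h ⦃ >-nonZero 1≤h ⦄
    D≡ : 3 + pred h ≡ D
    D≡ = trans (cong (2 +_) h≡) (trans (+-comm 2 h) h+2≡D)
    relaxed : Colourings.Setting G k h (pred h) D
    relaxed = record { g≤h = pred[n]≤n ; h≤1+g = ≤-reflexive (sym h≡) ; 1≤h = 1≤h
                     ; mode = inj₂ (≤-reflexive (trans (sym h+2≡D) (+-comm h 2))) ; deg≤D = deg≤D ; enough = enough }
  by-degree (inj₁ h+2<D) = by-excess (m≤n⇒m<n∨m≡n h+3≤D)
    where
    h+3≤D : h + 3 ≤ D
    h+3≤D = ≤-trans (≤-reflexive (+-suc h 2)) h+2<D
    by-excess : h + 3 < D ⊎ h + 3 ≡ D → HasPCFColoring h G k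
    by-excess (inj₁ h+3<D) = Conversion.has-pcf strict (Strict.colourable-roomy strict h+3≤D
      (≤-trans (≤-reflexive (+-suc h 3)) h+3<D))
    by-excess (inj₂ h+3≡D) = by-h (m≤n⇒m<n∨m≡n 1≤h)
      where
      by-h : 1 < h ⊎ 1 ≡ h → HasPCFColoring h G k
      by-h (inj₁ 2≤h)  = Conversion.has-pcf strict (Strict.colourable-tight strict h+3≤D (trans (+-comm 3 h) h+3≡D) 2≤h)
      by-h (inj₂ refl) = Conversion.has-pcf strict (quartic h+3≡D strict)
        where
        -- The degree is generalised to a variable so that the equation can be matched.
        quartic : ∀ {D} → 4 ≡ D → (s : Colourings.Setting G k 1 1 D) → PartialColourings.Colourable s (λ _ → false)
        quartic refl s = StrictQuartic.colourable-quartic s
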